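{- Let $G$ be a finite simple graph and $\theta$ a real number. Let $Q_1,\dots,Q_m$ be all the connected components $Q$ of $G\setminus A_\theta(G)$ with $\textnormal{mult}(\theta,Q)=0$. Then for distinct $u,v\in V(G)$, $uv\in E(D_\theta(G))$ if and only if (a) at least one of $u,v$ lies in $B_\theta(G)$, or (b) $u,v\in N_\theta(G)$ with $u\in V(Q_{j_1})$ and $v\in V(Q_{j_2})$ for some $j_1\neq j_2$, or (c) $uv\in E(D_{0,\theta}(Q_{j_0}))$ for some $j_0$.
   Context: $\mu(G,x)=\sum_{r\ge 0}(-1)^r p(G,r)x^{|V(G)|-2r}$ is the matching polynomial ($p(G,r)$ = number of $r$-matchings, $p(G,0)=1$, empty graph has $\mu=1$); $\textnormal{mult}(\theta,G)$ is the multiplicity of $\theta$ as a root of $\mu(G,x)$ ($0$ if not a root). $G\setminus X$, $G\setminus uv$ denote vertex deletion. A vertex $u$ is $\theta$-essential if $\textnormal{mult}(\theta,G\setminus u)=\textnormal{mult}(\theta,G)-1$, $\theta$-neutral if $\textnormal{mult}(\theta,G\setminus u)=\textnormal{mult}(\theta,G)$, and $\theta$-special if it is not $\theta$-essential but adjacent to a $\theta$-essential vertex. $B_\theta(G)$, $N_\theta(G)$, $A_\theta(G)$ are the sets of $\theta$-essential, $\theta$-neutral, $\theta$-special vertices. $D_\theta(G)$ is the graph on $V(G)$ in which distinct $x,y$ are adjacent iff $\textnormal{mult}(\theta,G\setminus xy)\le\textnormal{mult}(\theta,G)$. For a graph $F$, $D_{0,\theta}(F)$ is the graph on $V(F)$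 in which distinct $u,v$ are adjacent iff $\textnormal{mult}(\theta,F\setminus uv)=\textnormal{mult}(\theta,F)$. -}

module Defs where

open import Level using (0ℓ)
open import Algebra.Bundles using (CommutativeRing)
open import Relation.Binary.Structures using (IsStrictTotalOrder)
open import Data.Nat as ℕ using (ℕ; zero; suc; _∸_; _≡ᵇ_; _<ᵇ_)
open import Data.Bool using (Bool; true; false; _∧_; if_then_else_; not)
open import Data.Fin using (Fin; toℕ)
open import Data.Fin.Properties using () renaming (_≟_ to _≟F_)
open import Data.Fin.Subset using (Subset; _∈_; _⊆_; _─_; ⁅_⁆; _∪_; ∣_∣)
open import Data.List using (List; []; _∷_; _++_; length; filter; map; concatMap; replicate; upTo; allFin; foldr)
open import Data.Vec using (lookup)
open import Data.Product using (Σ; ∃; _×_; _,_)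
open import Data.Sum using (_⊎_)
open import Relation.Nullary using (¬_; does)
open import Relation.Binary.PropositionalEquality using (_≡_)

record RealField : Set₁ where
  field
    commutativeRing : CommutativeRing 0ℓ 0ℓ
  open CommutativeRing commutativeRing public
  field
    _<_ : Carrier → Carrier → Set
    <-isStrictTotalOrder : IsStrictTotalOrder _≈_ _<_
    0<1 : 0# < 1#
    inverse : ∀ x → ¬ (x ≈ 0#) → ∃ λ y → (x * y) ≈ 1#
    +-mono-< : ∀ x y z → x < y → (x + z) < (y + z)
    *-pos : ∀ x y → 0# < x → 0# < y → 0# < (x * y)

  _≤_ : Carrier → Carrier → Set
  x ≤ y = x < y ⊎ x ≈ y

  field
    lub : (P : Carrier → Set) → ∃ P → (∃ λ b → ∀ x → P x → x ≤ b) →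
          ∃ λ s → (∀ x → P x → x ≤ s) × (∀ b → (∀ x → P x → x ≤ b) → s ≤ b)

-- Polynomials over the reals (ascending coefficient lists) and
-- multiplicity of a root.

module Poly (ℝ : RealField) where
  open RealField ℝ

  Pol : Set
  Pol = List Carrier

  _+ₚ_ : Pol → Pol → Pol
  [] +ₚ q = q
  (a ∷ p) +ₚ [] = a ∷ p
  (a ∷ p) +ₚ (b ∷ q) = (a + b) ∷ (p +ₚ q)

  scale : Carrier → Pol → Pol
  scale c = map (c *_)

  _*ₚ_ : Pol → Pol → Pol
  [] *ₚ q = []
  (a ∷ p) *ₚ q = scale a q +ₚ (0# ∷ (p *ₚ q))

  _^ₚ_ : Pol → ℕ → Pol
  p ^ₚ zero = 1# ∷ []
  p ^ₚ suc k = p *ₚ (p ^ₚ k)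

  coeff : Pol → ℕ → Carrier
  coeff [] i = 0#
  coeff (a ∷ p) zero = a
  coeff (a ∷ p) (suc i) = coeff p i

  _≈ₚ_ : Pol → Pol → Set
  p ≈ₚ q = ∀ i → coeff p i ≈ coeff q i

  eval : Pol → Carrier → Carrier
  eval [] x = 0#
  eval (a ∷ p) x = a + x * eval p x

  monomial : Carrier → ℕ → Pol
  monomial c k = replicate k 0# ++ (c ∷ [])

  X-_ : Carrier → Pol
  X- θ = (- θ) ∷ 1# ∷ []

  IsMult : Carrier → Pol → ℕ → Set
  IsMult θ p k = ∃ λ q → (p ≈ₚ (((X- θ) ^ₚ k) *ₚ q)) × ¬ (eval q θ ≈ 0#)

  fromℕ : ℕ → Carrier
  fromℕ zero = 0#
  fromℕ (suc m) = 1# + fromℕ m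

record Graph (n : ℕ) : Set where
  field
    adj : Fin n → Fin n → Bool
    adj-sym : ∀ i j → adj i j ≡ adj j i
    adj-irrefl : ∀ i → adj i i ≡ false
open Graph public

boolFilter : {A : Set} → (A → Bool) → List A → List A
boolFilter p [] = []
boolFilter p (x ∷ xs) = if p x then x ∷ boolFilter p xs else boolFilter p xs

module _ {n : ℕ} (G : Graph n) where

  mem : Subset n → Fin n → Bool
  mem S i = lookup S i

  edgesOf : Subset n → List (Σ (Fin n) λ _ → Fin n)
  edgesOf S = concatMap (λ i → map (λ j → (i , j))
                (boolFilter (λ j → (toℕ i <ᵇ toℕ j) ∧ mem S i ∧ mem S j ∧ adj G i j)
                  (allFin n)))
              (allFin n)

  sublists : {A : Set} → List A → List (List A)
  sublists [] = [] ∷ []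
  sublists (x ∷ xs) = let r = sublists xs in r ++ map (x ∷_) r

  eqF : Fin n → Fin n → Bool
  eqF i j = does (i ≟F j)

  disjointE : Σ (Fin n) (λ _ → Fin n) → Σ (Fin n) (λ _ → Fin n) → Bool
  disjointE (a , b) (c , d) = not (eqF a c) ∧ not (eqF a d) ∧ not (eqF b c) ∧ not (eqF b d)

  pairwiseDisjoint : List (Σ (Fin n) λ _ → Fin n) → Bool
  pairwiseDisjoint [] = true
  pairwiseDisjoint (e ∷ es) = foldr (λ f acc → disjointE e f ∧ acc) true es ∧ pairwiseDisjoint es

  numMatchings : Subset n → ℕ → ℕ
  numMatchings S r = length (boolFilter (λ M → (length M ≡ᵇ r) ∧ pairwiseDisjoint M)
                                        (sublists (edgesOf S)))

  data Reach (Q : Subset n) : Fin n → Fin n → Set where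
    here : ∀ {x} → Reach Q x x
    step : ∀ {x z y} → adj G x z ≡ true → z ∈ Q → Reach Q z y → Reach Q x y

  IsComponent : Subset n → Subset n → Set
  IsComponent S Q = Q ⊆ S × (∃ λ x → x ∈ Q)
                  × (∀ x y → x ∈ Q → y ∈ Q → Reach Q x y)
                  × (∀ x y → x ∈ Q → y ∈ S → adj G x y ≡ true → y ∈ Q)

  module Match (ℝ : RealField) where
    open RealField ℝ
    open Poly ℝ

    -- μ(G[S], x) = Σ_r (-1)^r p(G[S], r) x^{|S| - 2r}
    -- (-1)^r · m
    signed : ℕ → ℕ → Carrier
    signed zero m = fromℕ m
    signed (suc r) m = - signed r m

    μ : Subset n → Pol
    μ S = foldr (λ r acc → (if (2 ℕ.* r) ℕ.≤ᵇ ∣ S ∣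
                              then monomial (signed r (numMatchings S r)) (∣ S ∣ ∸ 2 ℕ.* r)
                              else [])
                           +ₚ acc)
                [] (upTo (suc ∣ S ∣))

    Mult : Carrier → Subset n → ℕ → Set
    Mult θ S k = IsMult θ (μ S) k

    Essential : Carrier → Subset n → Fin n → Set
    Essential θ S u = u ∈ S × (∀ k k′ → Mult θ S k → Mult θ (S ─ ⁅ u ⁆) k′ → suc k′ ≡ k)

    Neutral : Carrier → Subset n → Fin n → Set
    Neutral θ S u = u ∈ S × (∀ k k′ → Mult θ S k → Mult θ (S ─ ⁅ u ⁆) k′ → k′ ≡ k)

    Special : Carrier → Subset n → Fin n → Set
    Special θ S u = u ∈ S × ¬ Essential θ S u
                  × (∃ λ w → adj G u w ≡ true × Essential θ S w)

    DEdge : Carrier → Subset n → Fin n → Fin n → Set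
    DEdge θ S u v = u ∈ S × v ∈ S × ¬ (u ≡ v)
                  × (∀ k k′ → Mult θ S k → Mult θ (S ─ (⁅ u ⁆ ∪ ⁅ v ⁆)) k′ → k′ ℕ.≤ k)

    D0Edge : Carrier → Subset n → Fin n → Fin n → Set
    D0Edge θ S u v = u ∈ S × v ∈ S × ¬ (u ≡ v)
                   × (∀ k k′ → Mult θ S k → Mult θ (S ─ (⁅ u ⁆ ∪ ⁅ v ⁆)) k′ → k′ ≡ k)

{-# OPTIONS --safe #-}
module Submission where

-- Write F S for the Taylor expansion at θ of the matching polynomial of the subgraph induced
-- on S, and m S for its order. Two sums of squares control the orders. Summing over the paths
-- from a to b, F(S-a) F(S-b) - F(S) F(S-a-b) is a sum of squares, for arbitrary vertex weights;
-- hence its order is even. The Wronskian F(S)' F(S-u) - F(S) F(S-u)' is F(S-u)² plus a sum of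
-- squares; hence orders interlace, and F(S-u)/F(S) has at most a simple pole, with positive
-- residue. So a vertex u with a neighbour that is essential in S-u is positive in S.
--
-- From this comes stability: deleting a special vertex a raises by one the order of S, of S-v
-- and of S-u-v, for u and v different from a and u not essential. The delicate case, where
-- a and v are positive and m (S-a-v) = m S, is excluded by applying the parity constraint to
-- the polynomial whose weight at an essential neighbour of a is shifted by one.
--
-- Deleting all of A therefore reduces the theorem to G \ A, where m is additive over the
-- components. A component with a non-essential vertex has no essential vertex at all, and
-- its order is zero because the derivative of F Q is the sum of the F(Q-w).

open import Defs
open import Level using (0ℓ)
open import Algebra.Bundles using (CommutativeRing; RawRing)
import Algebra.Properties.Ring as RingProps
import Algebra.Properties.Semiring.Mult as SemiringMult
import Algebra.Properties.Semiring.Sum as SemiringSum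
import Algebra.Solver.Ring as RingSolver
open import Algebra.Solver.Ring.AlmostCommutativeRing using (_-Raw-AlmostCommutative⟶_; fromCommutativeRing; Induced-equivalence)
open import Data.Bool using (Bool; true; false; if_then_else_; _∧_; not; T)
import Data.Bool.Properties as Boolₚ
import Data.Empty as Empty
open import Data.Fin using (Fin; zero; suc; toℕ)
open import Data.Fin.Properties as Finₚ using (_≟_)
open import Data.List using (List; []; _∷_; _++_; length; map; foldr; concatMap; allFin; tabulate; applyUpTo)
open import Data.List.Relation.Unary.All as All using (All; []; _∷_)
open import Data.List.Relation.Unary.All.Properties using (++⁺; map⁺)
open import Data.Maybe using (just; nothing)
open import Data.Nat as ℕ using (ℕ; zero; suc; z≤n; s≤s)
import Data.Nat.Properties as ℕₚ
open import Data.Product using (Σ; ∃; _×_; _,_; proj₁; proj₂)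
open import Data.Product.Function.NonDependent.Propositional using (_×-⇔_)
open import Data.Sum using (_⊎_; inj₁; inj₂)
open import Data.Sum.Function.Propositional using (_⊎-⇔_)
open import Data.Vec using ([]; _∷_; lookup; here; there)
open import Data.Vec.Properties using (lookup-zipWith; lookup⇒[]=; []=⇒lookup; lookup-replicate; tabulate∘lookup; tabulate-cong)
open import Function using (_∘_)
open import Function.Bundles using (_⇔_; mk⇔; module Equivalence)
open import Relation.Binary.Definitions using (WeaklyDecidable; tri<; tri≈; tri>)
open import Relation.Binary.PropositionalEquality as ≡ using (_≡_; _≢_)
open import Relation.Binary.Structures using (IsStrictTotalOrder)
open import Relation.Nullary using (¬_; Dec; yes; no; does; contradiction)
open import Relation.Nullary.Decidable using (dec-true; dec-false; _×-dec_; ¬?)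

-- A ring solver that can cancel terms although equality in the ring is not
-- decidable: coefficients are formal differences of natural numbers.

-- No root is located and nothing is factored over the reals. All information comes from lowest
-- coefficients of series in `t`: a nonzero sum of squares of real series starts in an even degree,
-- with a positive coefficient. The Wronskian uses the sign, the path sums use the parity.
--
-- For two positive vertices a and v, these constraints still allow the order of S - a - v to fall
-- back to that of S, since the path sum then has an even order. Raising the weight of w by one
-- merges T and T - w into the single series F T + F (T - w), whose order is the smaller of the two
-- whenever they differ; in the last surviving case an even total becomes odd. For this reason the
-- path identity is proved for weights that vary with the vertex.
--
-- Stability for pairs is stated for a non-essential u, and this is exactly what the theorem can
-- supply: if a pair has an essential member, one deletion lowers the order and the other raises it
-- by at most one, so the pair is an edge without any structure theory.

module DifferenceSolver (R : CommutativeRing 0ℓ 0ℓ) where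
  open CommutativeRing R
  open RingProps ring
  open SemiringMult semiring renaming (_×_ to _·_)
  open import Relation.Binary.Reasoning.Setoid setoid

  Diff : RawRing 0ℓ 0ℓ
  Diff = record
    { Carrier = ℕ × ℕ
    ; _≈_ = _≡_
    ; _+_ = λ (a , b) (c , d) → a ℕ.+ c , b ℕ.+ d
    ; _*_ = λ (a , b) (c , d) → a ℕ.* c ℕ.+ b ℕ.* d , a ℕ.* d ℕ.+ b ℕ.* c
    ; -_ = λ (a , b) → b , a
    ; 0# = 0 , 0
    ; 1# = 1 , 0
    }

  -- The clauses for zero and one make `con (0 , 0)` and `con (1 , 0)` evaluate to the ring's own
  -- constants, so that solved equations match goals in which these occur literally.
  ⟦_⟧ᵈ : ℕ × ℕ → Carrier
  ⟦ 0 , 0 ⟧ᵈ = 0#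
  ⟦ 1 , 0 ⟧ᵈ = 1#
  ⟦ a , b ⟧ᵈ = a · 1# - b · 1#

  ⟦⟧ᵈ-diff : ∀ a b → ⟦ a , b ⟧ᵈ ≈ a · 1# - b · 1#
  ⟦⟧ᵈ-diff 0 0 = sym (-‿inverseʳ _)
  ⟦⟧ᵈ-diff 0 (suc b) = refl
  ⟦⟧ᵈ-diff 1 0 = sym (trans (+-congˡ -0#≈0#) (trans (+-identityʳ _) (+-identityʳ _)))
  ⟦⟧ᵈ-diff 1 (suc b) = refl
  ⟦⟧ᵈ-diff (suc (suc a)) 0 = refl
  ⟦⟧ᵈ-diff (suc (suc a)) (suc b) = refl

  interchange : ∀ x y z w → (x + y) + (z + w) ≈ (x + z) + (y + w)
  interchange x y z w = begin
    (x + y) + (z + w) ≈⟨ +-assoc x y (z + w) ⟩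
    x + (y + (z + w)) ≈⟨ +-congˡ (+-assoc y z w) ⟨
    x + ((y + z) + w) ≈⟨ +-congˡ (+-congʳ (+-comm y z)) ⟩
    x + ((z + y) + w) ≈⟨ +-congˡ (+-assoc z y w) ⟩
    x + (z + (y + w)) ≈⟨ +-assoc x z (y + w) ⟨
    (x + z) + (y + w) ∎

  diff-+ : ∀ x y z w → (x + z) - (y + w) ≈ (x - y) + (z - w)
  diff-+ x y z w = trans (+-congˡ (sym (-‿+-comm y w))) (interchange x z (- y) (- w))

  diff-* : ∀ x y z w → (x * z + y * w) - (x * w + y * z) ≈ (x - y) * (z - w)
  diff-* x y z w = sym (begin
    (x - y) * (z - w)                                     ≈⟨ distribʳ _ _ _ ⟩
    x * (z - w) + - y * (z - w)                           ≈⟨ +-cong (distribˡ _ _ _) (distribˡ _ _ _) ⟩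
    (x * z + x * - w) + (- y * z + - y * - w)             ≈⟨ +-congˡ (+-comm _ _) ⟩
    (x * z + x * - w) + (- y * - w + - y * z)             ≈⟨ interchange _ _ _ _ ⟩
    (x * z + - y * - w) + (x * - w + - y * z)             ≈⟨ +-cong (+-congˡ (trans (sym (-‿distribˡ-* _ _)) (trans (-‿cong (sym (-‿distribʳ-* _ _))) (-‿involutive _))))
                                                                (+-cong (sym (-‿distribʳ-* _ _)) (sym (-‿distribˡ-* _ _))) ⟩
    (x * z + y * w) + (- (x * w) + - (y * z))             ≈⟨ +-congˡ (-‿+-comm _ _) ⟩
    (x * z + y * w) - (x * w + y * z)                     ∎)

  morphism : Diff -Raw-AlmostCommutative⟶ fromCommutativeRing R
  morphism = record
    { ⟦_⟧ = ⟦_⟧ᵈ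
    ; +-homo = λ (a , b) (c , d) → trans (⟦⟧ᵈ-diff (a ℕ.+ c) (b ℕ.+ d)) (trans
        (+-cong (×-homo-+ 1# a c) (-‿cong (×-homo-+ 1# b d))) (trans (diff-+ _ _ _ _)
        (sym (+-cong (⟦⟧ᵈ-diff a b) (⟦⟧ᵈ-diff c d)))))
    ; *-homo = λ (a , b) (c , d) → trans (⟦⟧ᵈ-diff (a ℕ.* c ℕ.+ b ℕ.* d) (a ℕ.* d ℕ.+ b ℕ.* c)) (trans
        (+-cong (trans (×-homo-+ 1# (a ℕ.* c) (b ℕ.* d)) (+-cong (×1-homo-* a c) (×1-homo-* b d)))
                (-‿cong (trans (×-homo-+ 1# (a ℕ.* d) (b ℕ.* c)) (+-cong (×1-homo-* a d) (×1-homo-* b c)))))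
        (trans (diff-* _ _ _ _) (sym (*-cong (⟦⟧ᵈ-diff a b) (⟦⟧ᵈ-diff c d)))))
    ; -‿homo = λ (a , b) → trans (⟦⟧ᵈ-diff b a) (sym (trans (-‿cong (⟦⟧ᵈ-diff a b))
        (trans (sym (-‿+-comm _ _)) (trans (+-congˡ (-‿involutive _)) (+-comm _ _)))))
    ; 0-homo = refl
    ; 1-homo = refl
    }

  coefficients? : WeaklyDecidable (Induced-equivalence morphism)
  coefficients? (a , b) (c , d) with a ℕ.+ d ℕ.≟ c ℕ.+ b
  ... | no _ = nothing
  ... | yes eq = just (begin
    ⟦ a , b ⟧ᵈ                                     ≈⟨ ⟦⟧ᵈ-diff a b ⟩
    a · 1# - b · 1#                                ≈⟨ shift a b d ⟩
    (a ℕ.+ d) · 1# - (b ℕ.+ d) · 1#                ≡⟨ ≡.cong₂ (λ i j → i · 1# - j · 1#) eq (ℕₚ.+-comm b d) ⟩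
    (c ℕ.+ b) · 1# - (d ℕ.+ b) · 1#                ≈⟨ shift c d b ⟨
    c · 1# - d · 1#                                ≈⟨ ⟦⟧ᵈ-diff c d ⟨
    ⟦ c , d ⟧ᵈ                                     ∎)
    where
    shift : ∀ a b d → a · 1# - b · 1# ≈ (a ℕ.+ d) · 1# - (b ℕ.+ d) · 1#
    shift a b d = sym (begin
      (a ℕ.+ d) · 1# - (b ℕ.+ d) · 1#                ≈⟨ +-cong (×-homo-+ 1# a d) (-‿cong (×-homo-+ 1# b d)) ⟩
      (a · 1# + d · 1#) - (b · 1# + d · 1#)          ≈⟨ diff-+ _ _ _ _ ⟩
      (a · 1# - b · 1#) + (d · 1# - d · 1#)          ≈⟨ +-congˡ (-‿inverseʳ _) ⟩
      (a · 1# - b · 1#) + 0#                         ≈⟨ +-identityʳ _ ⟩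
      a · 1# - b · 1#                                ∎)

  open RingSolver Diff (fromCommutativeRing R) morphism coefficients? public using (solve; _:=_; _:+_; _:*_; _:-_; :-_; con)

-- Signs and squares in an ordered field

module OrderedField (ℝ : RealField) where
  open RealField ℝ hiding (zero)
  open IsStrictTotalOrder <-isStrictTotalOrder using (compare; <-resp-≈) renaming (trans to <-trans; irrefl to <-irrefl)
  open DifferenceSolver commutativeRing
  open RingProps ring using (-0#≈0#)
  open Poly ℝ using (fromℕ)

  <-respʳ : ∀ {x y z} → y ≈ z → x < y → x < z
  <-respʳ = proj₁ <-resp-≈

  <-respˡ : ∀ {x y z} → y ≈ z → y < x → z < x
  <-respˡ = proj₂ <-resp-≈

  -- Trichotomy decides this; the search for the first nonzero coefficient of a series rests on it.
  zero? : ∀ x → Dec (x ≈ 0#)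
  zero? x with compare x 0#
  ... | tri< _ ne _ = no ne
  ... | tri≈ _ e _ = yes e
  ... | tri> _ ne _ = no ne

  ≤-resp : ∀ {x y} → x ≈ y → 0# ≤ x → 0# ≤ y
  ≤-resp e (inj₁ l) = inj₁ (<-respʳ e l)
  ≤-resp e (inj₂ l) = inj₂ (trans l e)

  pos+nonneg : ∀ {x y} → 0# < x → 0# ≤ y → 0# < (x + y)
  pos+nonneg {x} {y} p (inj₁ q) = <-trans q (<-respˡ (+-identityˡ y) (+-mono-< 0# x y p))
  pos+nonneg {x} {y} p (inj₂ q) = <-respʳ (trans (sym (+-identityʳ x)) (+-congˡ q)) p

  nonneg+ : ∀ {x y} → 0# ≤ x → 0# ≤ y → 0# ≤ (x + y)
  nonneg+ (inj₁ p) q = inj₁ (pos+nonneg p q)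
  nonneg+ {x} {y} (inj₂ p) q = ≤-resp (trans (sym (+-identityˡ y)) (+-congʳ p)) q

  sum-zero : ∀ {x y} → 0# ≤ x → 0# ≤ y → x + y ≈ 0# → x ≈ 0# × y ≈ 0#
  sum-zero {x} {y} (inj₁ p) q e = contradiction (pos+nonneg p q) (<-irrefl (sym e))
  sum-zero {x} {y} (inj₂ p) q e = sym p , trans (trans (sym (+-identityˡ y)) (+-congʳ p)) e

  square-nonneg : ∀ x → 0# ≤ (x * x)
  square-nonneg x with compare 0# x
  ... | tri< p _ _ = inj₁ (*-pos x x p p)
  ... | tri≈ _ e _ = inj₂ (trans (sym (zeroˡ x)) (*-congʳ e))
  ... | tri> _ _ p = inj₁ (<-respʳ (solve 1 (λ x → (:- x) :* (:- x) := x :* x) refl x) (*-pos _ _ neg neg))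
    where
    neg : 0# < (- x)
    neg = <-respˡ (-‿inverseʳ x) (<-respʳ (+-identityˡ _) (+-mono-< x 0# (- x) p))

  cancel-nonzero : ∀ {x y} → ¬ (x ≈ 0#) → x * y ≈ 0# → y ≈ 0#
  cancel-nonzero {x} {y} nz e with inverse x nz
  ... | z , xz = begin
    y            ≈⟨ *-identityˡ y ⟨
    1# * y       ≈⟨ *-congʳ xz ⟨
    (x * z) * y  ≈⟨ solve 3 (λ x y z → (x :* z) :* y := z :* (x :* y)) refl x y z ⟩
    z * (x * y)  ≈⟨ *-congˡ e ⟩
    z * 0#       ≈⟨ zeroʳ z ⟩
    0#           ∎
    where open import Relation.Binary.Reasoning.Setoid setoid

  *-nonzero : ∀ {x y} → ¬ (x ≈ 0#) → ¬ (y ≈ 0#) → ¬ (x * y ≈ 0#)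
  *-nonzero nx ny e = ny (cancel-nonzero nx e)

  square-zero : ∀ {x} → x * x ≈ 0# → x ≈ 0#
  square-zero {x} e with zero? x
  ... | yes z = z
  ... | no nz = cancel-nonzero nz e

  fromℕ-nonneg : ∀ n → 0# ≤ fromℕ n
  fromℕ-nonneg zero = inj₂ refl
  fromℕ-nonneg (suc n) = inj₁ (pos+nonneg 0<1 (fromℕ-nonneg n))

  fromℕ-suc-nonzero : ∀ n → ¬ (fromℕ (suc n) ≈ 0#)
  fromℕ-suc-nonzero n e = <-irrefl (sym e) (pos+nonneg 0<1 (fromℕ-nonneg n))

  1≉0 : ¬ (1# ≈ 0#)
  1≉0 e = <-irrefl (sym e) 0<1

  -‿nonzero : ∀ {x} → ¬ (x ≈ 0#) → ¬ (- x ≈ 0#)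
  -‿nonzero {x} nz e = nz (trans (solve 1 (λ x → x := :- (:- x)) refl x) (trans (-‿cong e) -0#≈0#))

-- Power series: orders of vanishing and sums of squares

module Series (ℝ : RealField) where
  open RealField ℝ hiding (zero)
  open DifferenceSolver commutativeRing
  open RingProps ring using (-0#≈0#)
  open OrderedField ℝ
  open import Relation.Binary.Reasoning.Setoid setoid

  Ser : Set
  Ser = ℕ → Carrier

  infix 4 _≋_
  -- A record rather than a bare family of equations, so that both series stay visible to inference
  -- instead of unfolding into coefficients.
  record _≋_ (f g : Ser) : Set where
    constructor ext
    field at : ∀ n → f n ≈ g n
  open _≋_ public

  mul : Ser → Ser → Ser
  mul f g zero = f 0 * g 0
  mul f g (suc n) = f 0 * g (suc n) + mul (f ∘ suc) g n

  one : Ser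
  one zero = 1#
  one (suc n) = 0#

  mul-cong : ∀ {f f′ g g′} → (∀ n → f n ≈ f′ n) → (∀ n → g n ≈ g′ n) → ∀ n → mul f g n ≈ mul f′ g′ n
  mul-cong p q zero = *-cong (p 0) (q 0)
  mul-cong p q (suc n) = +-cong (*-cong (p 0) (q (suc n))) (mul-cong (p ∘ suc) q n)

  mul-distribʳ : ∀ h f g → ∀ n → mul (λ n → f n + g n) h n ≈ mul f h n + mul g h n
  mul-distribʳ h f g zero = distribʳ _ _ _
  mul-distribʳ h f g (suc n) = trans (+-cong (distribʳ _ _ _) (mul-distribʳ h (f ∘ suc) (g ∘ suc) n))
    (solve 4 (λ a b c d → (a :+ b) :+ (c :+ d) := (a :+ c) :+ (b :+ d)) refl _ _ _ _)

  mul-scale : ∀ c f g → ∀ n → mul (λ n → c * f n) g n ≈ c * mul f g n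
  mul-scale c f g zero = *-assoc _ _ _
  mul-scale c f g (suc n) = trans (+-cong (*-assoc _ _ _) (mul-scale c (f ∘ suc) g n)) (sym (distribˡ _ _ _))

  -- `mul` peels the left factor; peeling the right one too turns commutativity into an induction.
  mul-sucʳ : ∀ f g n → mul f g (suc n) ≈ f (suc n) * g 0 + mul f (g ∘ suc) n
  mul-sucʳ f g zero = +-comm _ _
  mul-sucʳ f g (suc n) = trans (+-congˡ (mul-sucʳ (f ∘ suc) g n))
    (solve 3 (λ a b c → a :+ (b :+ c) := b :+ (a :+ c)) refl _ _ _)

  mul-comm : ∀ f g n → mul f g n ≈ mul g f n
  mul-comm f g zero = *-comm _ _
  mul-comm f g (suc n) = trans (+-cong (*-comm _ _) (mul-comm (f ∘ suc) g n)) (sym (mul-sucʳ g f n))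

  mul-assoc : ∀ f g h n → mul (mul f g) h n ≈ mul f (mul g h) n
  mul-assoc f g h zero = *-assoc _ _ _
  mul-assoc f g h (suc n) = begin
    (f 0 * g 0) * h (suc n) + mul (λ k → f 0 * g (suc k) + mul (f ∘ suc) g k) h n
      ≈⟨ +-congˡ (mul-distribʳ h (λ k → f 0 * g (suc k)) (mul (f ∘ suc) g) n) ⟩
    (f 0 * g 0) * h (suc n) + (mul (λ k → f 0 * g (suc k)) h n + mul (mul (f ∘ suc) g) h n)
      ≈⟨ +-congˡ (+-cong (mul-scale (f 0) (g ∘ suc) h n) (mul-assoc (f ∘ suc) g h n)) ⟩
    (f 0 * g 0) * h (suc n) + (f 0 * mul (g ∘ suc) h n + mul (f ∘ suc) (mul g h) n)
      ≈⟨ solve 5 (λ a b c d e → (a :* b) :* c :+ (a :* d :+ e) := a :* (b :* c :+ d) :+ e) refl _ _ _ _ _ ⟩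
    f 0 * (g 0 * h (suc n) + mul (g ∘ suc) h n) + mul (f ∘ suc) (mul g h) n ∎

  mul-zeroˡ : ∀ {f} g → (∀ n → f n ≈ 0#) → ∀ n → mul f g n ≈ 0#
  mul-zeroˡ g z zero = trans (*-congʳ (z 0)) (zeroˡ _)
  mul-zeroˡ g z (suc n) = trans (+-cong (trans (*-congʳ (z 0)) (zeroˡ _)) (mul-zeroˡ g (z ∘ suc) n)) (+-identityˡ _)

  mul-identityˡ : ∀ g n → mul one g n ≈ g n
  mul-identityˡ g zero = *-identityˡ _
  mul-identityˡ g (suc n) = trans (+-cong (*-identityˡ _) (mul-zeroˡ {one ∘ suc} g (λ _ → refl) n)) (+-identityʳ _)

  seriesRing : CommutativeRing 0ℓ 0ℓ
  seriesRing = record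
    { Carrier = Ser
    ; _≈_ = _≋_
    ; _+_ = λ f g n → f n + g n
    ; _*_ = mul
    ; -_ = λ f n → - f n
    ; 0# = λ _ → 0#
    ; 1# = one
    ; isCommutativeRing = record
      { isRing = record
        { +-isAbelianGroup = record
          { isGroup = record
            { isMonoid = record
              { isSemigroup = record
                { isMagma = record
                  { isEquivalence = record
                    { refl = ext λ _ → refl
                    ; sym = λ p → ext λ n → sym (at p n)
                    ; trans = λ p q → ext λ n → trans (at p n) (at q n)
                    }
                  ; ∙-cong = λ p q → ext λ n → +-cong (at p n) (at q n)
                  }
                ; assoc = λ f g h → ext λ n → +-assoc _ _ _
                }
              ; identity = (λ f → ext λ n → +-identityˡ _) , (λ f → ext λ n → +-identityʳ _)
              }
            ; inverse = (λ f → ext λ n → -‿inverseˡ _) , (λ f → ext λ n → -‿inverseʳ _)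
            ; ⁻¹-cong = λ p → ext λ n → -‿cong (at p n)
            }
          ; comm = λ f g → ext λ n → +-comm _ _
          }
        ; *-cong = λ p q → ext (mul-cong (at p) (at q))
        ; *-assoc = λ f g h → ext (mul-assoc f g h)
        ; *-identity = (λ f → ext (mul-identityˡ f)) , (λ f → ext λ n → trans (mul-comm f one n) (mul-identityˡ f n))
        ; distrib = (λ f g h → ext λ n → trans (mul-comm f _ n) (trans (mul-distribʳ f g h n) (+-cong (mul-comm g f n) (mul-comm h f n))))
                  , (λ f g h → ext (mul-distribʳ f g h))
        }
      ; *-comm = λ f g → ext (mul-comm f g)
      }
    }

  module S = CommutativeRing seriesRing
  module SSum = SemiringSum S.semiring
  module RSum = SemiringSum semiring

  sum-at : ∀ {n} (f : Fin n → Ser) k → SSum.sum f k ≈ RSum.sum (λ i → f i k)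
  sum-at {zero} f k = refl
  sum-at {suc n} f k = +-congˡ (sum-at (f ∘ suc) k)

  Van : ℕ → Ser → Set
  Van k f = ∀ j → j ℕ.< k → f j ≈ 0#

  -- A relation, because the zero series has no order. `Van k` is the half "order at least k", which
  -- the zero series satisfies for every k.
  Ord : Ser → ℕ → Set
  Ord f k = Van k f × ¬ (f k ≈ 0#)

  van-resp : ∀ {k f g} → f ≋ g → Van k f → Van k g
  van-resp e v j l = trans (sym (at e j)) (v j l)

  ord-resp : ∀ {k f g} → f ≋ g → Ord f k → Ord g k
  ord-resp {k} e (v , nz) = van-resp e v , λ z → nz (trans (at e k) z)

  van-mono : ∀ {k l f} → k ℕ.≤ l → Van l f → Van k f
  van-mono le v j lt = v j (ℕₚ.<-≤-trans lt le)

  van-suc : ∀ {k f} → Van k f → f k ≈ 0# → Van (suc k) f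
  van-suc {k} {f} v z j (s≤s le) with ℕₚ.m≤n⇒m<n∨m≡n le
  ... | inj₁ lt = v j lt
  ... | inj₂ ≡.refl = z

  van-+ : ∀ {k f g} → Van k f → Van k g → Van k (f S.+ g)
  van-+ v w j l = trans (+-cong (v j l) (w j l)) (+-identityˡ _)

  van-neg : ∀ {k f} → Van k f → Van k (S.- f)
  van-neg v j l = trans (-‿cong (v j l)) -0#≈0#

  van-sum : ∀ {n k} (f : Fin n → Ser) → (∀ i → Van k (f i)) → Van k (SSum.sum f)
  van-sum {zero} f v j l = refl
  van-sum {suc n} f v = van-+ (v zero) (van-sum (f ∘ suc) (v ∘ suc))

  mul-van₀ : ∀ l f g → Van l g → Van l (mul f g) × mul f g l ≈ f 0 * g l
  mul-van₀ zero f g v = (λ _ ()) , refl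
  mul-van₀ (suc l) f g v = low , trans (mul-sucʳ f g l) (trans (+-cong g₀ (proj₂ rest)) (+-identityˡ _))
    where
    rest : Van l (mul f (g ∘ suc)) × mul f (g ∘ suc) l ≈ f 0 * g (suc l)
    rest = mul-van₀ l f (g ∘ suc) (λ j lt → v (suc j) (s≤s lt))
    g₀ : ∀ {x} → x * g 0 ≈ 0#
    g₀ = trans (*-congˡ (v 0 (s≤s z≤n))) (zeroʳ _)
    low : Van (suc l) (mul f g)
    low zero _ = g₀
    low (suc j) (s≤s lt) = trans (mul-sucʳ f g j) (trans (+-cong g₀ (proj₁ rest j lt)) (+-identityˡ _))

  -- In degree k + l, every pair of indices other than (k , l) has one index below its bound, so the
  -- convolution collapses to a single product.
  mul-van : ∀ k l f g → Van k f → Van l g → Van (k ℕ.+ l) (mul f g) × mul f g (k ℕ.+ l) ≈ f k * g l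
  mul-van zero l f g v w = mul-van₀ l f g w
  mul-van (suc k) l f g v w = low , trans (+-cong f₀ (proj₂ rest)) (+-identityˡ _)
    where
    rest : Van (k ℕ.+ l) (mul (f ∘ suc) g) × mul (f ∘ suc) g (k ℕ.+ l) ≈ f (suc k) * g l
    rest = mul-van k l (f ∘ suc) g (λ j lt → v (suc j) (s≤s lt)) w
    f₀ : ∀ {x} → f 0 * x ≈ 0#
    f₀ = trans (*-congʳ (v 0 (s≤s z≤n))) (zeroˡ _)
    low : Van (suc k ℕ.+ l) (mul f g)
    low zero _ = f₀
    low (suc j) (s≤s lt) = trans (+-cong f₀ (proj₁ rest j lt)) (+-identityˡ _)

  ord-mul : ∀ {k l f g} → Ord f k → Ord g l → Ord (mul f g) (k ℕ.+ l)
  ord-mul {k} {l} {f} {g} (v , nf) (w , ng) with mul-van k l f g v w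
  ... | low , top = low , λ z → *-nonzero nf ng (trans (sym top) z)

  ord-≤ : ∀ {k l f} → Ord f k → Van l f → l ℕ.≤ k
  ord-≤ {k} {l} (_ , nz) v with l ℕ.≤? k
  ... | yes le = le
  ... | no gt = contradiction (v k (ℕₚ.≰⇒> gt)) nz

  ord-unique : ∀ {k l f} → Ord f k → Ord f l → k ≡ l
  ord-unique o p = ℕₚ.≤-antisym (ord-≤ p (proj₁ o)) (ord-≤ o (proj₁ p))

  -- Vanishing of all coefficients cannot be tested, so the search for a nonzero one is cut off at
  -- `k`.
  van-or-ord : ∀ k f → Van k f ⊎ ∃ λ j → Ord f j
  van-or-ord zero f = inj₁ λ _ ()
  van-or-ord (suc k) f with van-or-ord k f
  ... | inj₂ o = inj₂ o
  ... | inj₁ v with zero? (f k)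
  ...   | yes z = inj₁ (van-suc v z)
  ...   | no nz = inj₂ (k , v , nz)

  ord-+ : ∀ {k f g} → Ord f k → Van (suc k) g → Ord (f S.+ g) k
  ord-+ {k} (v , nz) w = van-+ v (van-mono (ℕₚ.n≤1+n k) w) ,
    λ z → nz (trans (sym (trans (+-congˡ (w k ℕₚ.≤-refl)) (+-identityʳ _))) z)

  ord-neg : ∀ {k f} → Ord f k → Ord (S.- f) k
  ord-neg (v , nz) = van-neg v , -‿nonzero nz

  squares : List Ser → Ser
  squares [] = S.0#
  squares (h ∷ hs) = mul h h S.+ squares hs

  -- The squared series are kept as an explicit list, because vanishing of the sum has to be passed
  -- on to each of them.
  IsSOS : Ser → Set
  IsSOS p = ∃ λ hs → p ≋ squares hs

  squares-++ : ∀ hs ks → squares (hs ++ ks) ≋ squares hs S.+ squares ks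
  squares-++ [] ks = S.sym (S.+-identityˡ _)
  squares-++ (h ∷ hs) ks = S.trans (S.+-congˡ (squares-++ hs ks)) (S.sym (S.+-assoc _ _ _))

  sos-0 : IsSOS S.0#
  sos-0 = [] , S.refl

  sos-square : ∀ h → IsSOS (mul h h)
  sos-square h = h ∷ [] , S.sym (S.+-identityʳ _)

  sos-+ : ∀ {p q} → IsSOS p → IsSOS q → IsSOS (p S.+ q)
  sos-+ (hs , e) (ks , e′) = hs ++ ks , S.trans (S.+-cong e e′) (S.sym (squares-++ hs ks))

  sos-resp : ∀ {p q} → p ≋ q → IsSOS p → IsSOS q
  sos-resp e (hs , e′) = hs , S.trans (S.sym e) e′

  sos-sum : ∀ {n} (f : Fin n → Ser) → (∀ i → IsSOS (f i)) → IsSOS (SSum.sum f)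
  sos-sum {zero} f s = sos-0
  sos-sum {suc n} f s = sos-+ (s zero) (sos-sum (f ∘ suc) (s ∘ suc))

  -- The coefficient at k + k is the sum of the squares of the coefficients at k.
  squares-nonneg : ∀ k hs → All (Van k) hs → Van (k ℕ.+ k) (squares hs) × 0# ≤ squares hs (k ℕ.+ k)
  squares-nonneg k [] [] = (λ _ _ → refl) , inj₂ refl
  squares-nonneg k (h ∷ hs) (v ∷ vs) with mul-van k k h h v v | squares-nonneg k hs vs
  ... | low , top | lows , nn = van-+ low lows , nonneg+ (≤-resp (sym top) (square-nonneg _)) nn

  squares-zero : ∀ k hs → All (Van k) hs → squares hs (k ℕ.+ k) ≈ 0# → All (Van (suc k)) hs
  squares-zero k [] [] z = []
  squares-zero k (h ∷ hs) (v ∷ vs) z with mul-van k k h h v v | squares-nonneg k hs vs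
  ... | low , top | _ , nn with sum-zero (≤-resp (sym top) (square-nonneg _)) nn z
  ...   | z₁ , z₂ = van-suc v (square-zero (trans (sym top) z₁)) ∷ squares-zero k hs vs z₂

  -- Real squares cannot cancel. Climbing with k, each vanishing coefficient of the sum at an even
  -- degree 2j kills the coefficient at j of every squared series.
  squares-van : ∀ k hs → Van (k ℕ.+ k) (squares hs) → All (Van k) hs
  squares-van zero [] v = []
  squares-van zero (h ∷ hs) v = (λ _ ()) ∷ squares-van zero hs (λ _ ())
  squares-van (suc k) hs v = squares-zero k hs
    (squares-van k hs (van-mono (ℕₚ.+-mono-≤ (ℕₚ.n≤1+n k) (ℕₚ.n≤1+n k)) v))
    (v (k ℕ.+ k) (s≤s (ℕₚ.+-monoʳ-≤ k (ℕₚ.n≤1+n k))))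

  -- Vanishing at degree 2k forces every squared series to vanish through degree k, and then the sum
  -- also vanishes at 2k + 1.
  sos-ord-not-odd : ∀ {p} k → IsSOS p → ¬ Ord p (suc (k ℕ.+ k))
  sos-ord-not-odd k (hs , e) o with ord-resp e o
  ... | v , nz = nz (proj₁ (squares-nonneg (suc k) hs vs) (suc (k ℕ.+ k)) (s≤s (ℕₚ.+-monoʳ-< k ℕₚ.≤-refl)))
    where
    vs : All (Van (suc k)) hs
    vs = squares-zero k hs (squares-van k hs (van-mono (ℕₚ.n≤1+n _) v)) (v (k ℕ.+ k) ℕₚ.≤-refl)

-- Subsets under vertex deletion

open import Data.Fin.Subset using (Subset; _∈_; _∉_; _⊆_; _─_; _-_; ⁅_⁆; _∪_; _∩_; ∣_∣; ⊤; ⊥)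
open import Data.Fin.Subset.Properties

subset-ext : ∀ {n} {p q : Subset n} → (∀ i → lookup p i ≡ lookup q i) → p ≡ q
subset-ext {p = p} {q} e = ≡.trans (≡.sym (tabulate∘lookup p)) (≡.trans (tabulate-cong e) (tabulate∘lookup q))

lookup-─ : ∀ {n} (p q : Subset n) i → lookup (p ─ q) i ≡ lookup p i ∧ not (lookup q i)
lookup-─ (true ∷ p) (true ∷ q) zero = ≡.refl
lookup-─ (true ∷ p) (false ∷ q) zero = ≡.refl
lookup-─ (false ∷ p) (true ∷ q) zero = ≡.refl
lookup-─ (false ∷ p) (false ∷ q) zero = ≡.refl
lookup-─ (x ∷ p) (y ∷ q) (suc i) = lookup-─ p q i

lookup-∩ : ∀ {n} (p q : Subset n) i → lookup (p ∩ q) i ≡ lookup p i ∧ lookup q i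
lookup-∩ p q i = lookup-zipWith _∧_ i p q

lookup-⁅⁆ : ∀ {n} (u v : Fin n) → lookup ⁅ u ⁆ v ≡ does (u ≟ v)
lookup-⁅⁆ u v with u ≟ v
... | yes ≡.refl = []=⇒lookup (x∈⁅x⁆ u)
... | no u≢v with lookup ⁅ u ⁆ v in eq
...   | false = ≡.refl
...   | true = contradiction (≡.sym (x∈⁅y⁆⇒x≡y u (lookup⇒[]= v _ eq))) u≢v

lookup-minus : ∀ {n} (p : Subset n) u v → lookup (p - u) v ≡ lookup p v ∧ not (does (u ≟ v))
lookup-minus p u v = ≡.trans (lookup-─ p ⁅ u ⁆ v) (≡.cong (λ b → lookup p v ∧ not b) (lookup-⁅⁆ u v))

∈-lookup : ∀ {n} {p : Subset n} {x} → x ∈ p → lookup p x ≡ true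
∈-lookup = []=⇒lookup

lookup-∈ : ∀ {n} {p : Subset n} {x} → lookup p x ≡ true → x ∈ p
lookup-∈ {p = p} {x} = lookup⇒[]= x p

x∉p-x : ∀ {n} (p : Subset n) u → lookup (p - u) u ≡ false
x∉p-x p u with lookup-minus p u u
... | e rewrite dec-true (u ≟ u) ≡.refl with lookup p u
...   | true = e
...   | false = e

lookup-minus-≢ : ∀ {n} (p : Subset n) {u v} → u ≢ v → lookup (p - u) v ≡ lookup p v
lookup-minus-≢ p {u} {v} ne with lookup-minus p u v
... | e rewrite dec-false (u ≟ v) ne with lookup p v
...   | true = e
...   | false = e

∈-minus : ∀ {n} {p : Subset n} {u v} → v ∈ p → v ≢ u → v ∈ p - u
∈-minus = x∈p∧x≢y⇒x∈p-y

∈-minus⁻ : ∀ {n} {p : Subset n} {u v} → v ∈ p - u → v ∈ p × v ≢ u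
∈-minus⁻ {p = p} {u} {v} m = p─q⊆p p ⁅ u ⁆ m , λ { ≡.refl → contradiction (≡.trans (≡.sym (∈-lookup m)) (x∉p-x p u)) (λ ()) }

minus-shrinks : ∀ {n k} {p : Subset n} {u} → u ∈ p → ∣ p ∣ ℕ.< suc k → ∣ p - u ∣ ℕ.< k
minus-shrinks u∈p lt = ℕₚ.<-≤-trans (x∈p⇒∣p-x∣<∣p∣ u∈p) (ℕₚ.≤-pred lt)

outside-minus : ∀ {n} (p : Subset n) {w} → lookup p w ≡ false → ∀ v → lookup (p - v) w ≡ false
outside-minus p {w} e v rewrite lookup-minus p v w | e = ≡.refl

size-minus : ∀ {n} {p : Subset n} {u} → u ∈ p → ∣ p ∣ ≡ suc ∣ p - u ∣
size-minus {p = true ∷ p} here = ≡.cong (λ q → suc ∣ q ∣) (≡.sym (p─⊥≡p p))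
size-minus {p = true ∷ p} (there m) = ≡.cong suc (size-minus m)
size-minus {p = false ∷ p} (there m) = size-minus m

minus-∩ : ∀ {n} (S Q : Subset n) u → (S - u) ∩ Q ≡ (S ∩ Q) - u
minus-∩ S Q u = subset-ext λ i → lemma i
  where
  lemma : ∀ i → lookup ((S - u) ∩ Q) i ≡ lookup ((S ∩ Q) - u) i
  lemma i rewrite lookup-∩ (S - u) Q i | lookup-minus S u i | lookup-minus (S ∩ Q) u i | lookup-∩ S Q i
    with lookup S i | lookup Q i | does (u ≟ i)
  ... | true | true | x = Boolₚ.∧-identityʳ (not x)
  ... | true | false | x = Boolₚ.∧-zeroʳ (not x)
  ... | false | y | x = ≡.refl

minus-─ : ∀ {n} (S Q : Subset n) {u} → u ∈ Q → (S - u) ─ Q ≡ S ─ Q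
minus-─ S Q {u} u∈Q = subset-ext lemma
  where
  lemma : ∀ i → lookup ((S - u) ─ Q) i ≡ lookup (S ─ Q) i
  lemma i with u ≟ i
  ... | yes ≡.refl rewrite lookup-─ (S - u) Q u | lookup-─ S Q u | ∈-lookup u∈Q =
    ≡.trans (Boolₚ.∧-zeroʳ (lookup (S - u) u)) (≡.sym (Boolₚ.∧-zeroʳ (lookup S u)))
  ... | no u≢i rewrite lookup-─ (S - u) Q i | lookup-─ S Q i | lookup-minus-≢ S u≢i = ≡.refl

─-disjoint : ∀ {n} (S Q : Subset n) → S ∩ Q ≡ ⊥ → S ─ Q ≡ S
─-disjoint S Q e = subset-ext lemma
  where
  lemma : ∀ i → lookup (S ─ Q) i ≡ lookup S i
  lemma i with ≡.trans (≡.sym (lookup-∩ S Q i)) (≡.trans (≡.cong (λ p → lookup p i) e) (lookup-replicate i false))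
  ... | e′ rewrite lookup-─ S Q i with lookup S i | lookup Q i
  ...   | true | false = ≡.refl
  ...   | false | _ = ≡.refl

∉-lookup : ∀ {n} {p : Subset n} {x} → x ∉ p → lookup p x ≡ false
∉-lookup {p = p} {x} x∉p with lookup p x in eq
... | false = ≡.refl
... | true = contradiction (lookup-∈ eq) x∉p

minus-absent : ∀ {n} {p : Subset n} {u} → u ∉ p → p - u ≡ p
minus-absent {p = p} {u} u∉p = subset-ext lemma
  where
  lemma : ∀ i → lookup (p - u) i ≡ lookup p i
  lemma i with u ≟ i
  ... | yes ≡.refl = ≡.trans (x∉p-x p u) (≡.sym (∉-lookup u∉p))
  ... | no u≢i = lookup-minus-≢ p u≢i

∩-subset : ∀ {n} {S Q : Subset n} → Q ⊆ S → S ∩ Q ≡ Q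
∩-subset {S = S} {Q} Q⊆S = ⊆-antisym (p∩q⊆q S Q) (λ x∈ → x∈p∩q⁺ (Q⊆S x∈ , x∈))

∈─⁻ : ∀ {n} {p q : Subset n} {x} → x ∈ p ─ q → x ∉ q
∈─⁻ {p = p} {q} {x} x∈ x∈q with ≡.trans (≡.sym (∈-lookup x∈)) (lookup-─ p q x)
... | e rewrite ∈-lookup x∈q | Boolₚ.∧-zeroʳ (lookup p x) = contradiction e (λ ())

─-restore : ∀ {n} {A : Subset n} {a} → a ∈ A → (⊤ ─ (A - a)) - a ≡ ⊤ ─ A
─-restore {A = A} {a} a∈A = subset-ext lemma
  where
  lemma : ∀ i → lookup ((⊤ ─ (A - a)) - a) i ≡ lookup (⊤ ─ A) i
  lemma i with a ≟ i
  ... | yes ≡.refl rewrite x∉p-x (⊤ ─ (A - a)) a | lookup-─ ⊤ A a | ∈-lookup a∈A = ≡.sym (Boolₚ.∧-zeroʳ (lookup ⊤ a))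
  ... | no a≢i rewrite lookup-minus-≢ (⊤ ─ (A - a)) a≢i | lookup-─ ⊤ (A - a) i | lookup-─ ⊤ A i | lookup-minus-≢ A a≢i = ≡.refl

adj⇒≢ : ∀ {n} (G : Graph n) {u v} → adj G u v ≡ true → u ≢ v
adj⇒≢ G {u} e ≡.refl = contradiction (≡.trans (≡.sym e) (adj-irrefl G u)) (λ ())

∧-true : ∀ {a b} → a ∧ b ≡ true → a ≡ true × b ≡ true
∧-true {true} {true} _ = ≡.refl , ≡.refl

-- Guarded sums and the vertex recursion

module SeriesTools (ℝ : RealField) where
  open Series ℝ
  open DifferenceSolver seriesRing

  -- Conditions enter as Boolean guards so that every sum ranges over all of `Fin n` and case
  -- analysis on the Boolean evaluates its terms.
  guard : Bool → Ser → Ser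
  guard b f = if b then f else S.0#

  guard-cong : ∀ b {f g} → f ≋ g → guard b f ≋ guard b g
  guard-cong true e = e
  guard-cong false e = S.refl

  guard-0 : ∀ b → guard b S.0# ≋ S.0#
  guard-0 true = S.refl
  guard-0 false = S.refl

  guard-+ : ∀ b f g → guard b (f S.+ g) ≋ guard b f S.+ guard b g
  guard-+ true f g = S.refl
  guard-+ false f g = S.sym (S.+-identityˡ S.0#)

  guard-minus : ∀ b f g → guard b (f S.- g) ≋ guard b f S.- guard b g
  guard-minus true f g = S.refl
  guard-minus false f g = S.sym (S.-‿inverseʳ S.0#)

  guard-comm : ∀ b c f → guard b (guard c f) ≋ guard c (guard b f)
  guard-comm true c f = S.refl
  guard-comm false true f = S.refl
  guard-comm false false f = S.refl

  guard-sum : ∀ {k} b (f : Fin k → Ser) → SSum.sum (λ i → guard b (f i)) ≋ guard b (SSum.sum f)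
  guard-sum true f = S.refl
  guard-sum {k} false f = SSum.sum-replicate-zero k

  sum-minus : ∀ {n} (f g : Fin n → Ser) → SSum.sum (λ i → f i S.- g i) ≋ SSum.sum f S.- SSum.sum g
  sum-minus {zero} f g = S.sym (S.-‿inverseʳ S.0#)
  sum-minus {suc n} f g = S.trans (S.+-congˡ {f zero S.- g zero} (sum-minus (f ∘ suc) (g ∘ suc)))
    (solve 4 (λ a b c d → (a :- b) :+ (c :- d) := (a :+ c) :- (b :+ d)) S.refl (f zero) (g zero) (SSum.sum (f ∘ suc)) (SSum.sum (g ∘ suc)))

  neighbourSum : ∀ {n} → Graph n → Subset n → Fin n → (Fin n → Ser) → Ser
  neighbourSum G S u h = SSum.sum (λ v → guard (lookup S v ∧ adj G u v) (h v))

  -- The classical expansion of the matching polynomial at a vertex, with its own weight X u at each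
  -- vertex in place of the common variable x.
  IsMatchingSystem : ∀ {n} → Graph n → (Fin n → Ser) → (Subset n → Ser) → Set
  IsMatchingSystem G X F = ∀ S u → u ∈ S →
    F S ≋ X u S.* F (S - u) S.- neighbourSum G S u (λ v → F (S - u - v))

-- Path sums as sums of squares

module Paths (ℝ : RealField) {n : ℕ} (G : Graph n) where
  open Series ℝ
  open SeriesTools ℝ
  open DifferenceSolver seriesRing
  open import Relation.Binary.Reasoning.Setoid S.setoid

  module _ {X : Fin n → Ser} {F : Subset n → Ser} (rec : IsMatchingSystem G X F) where

    opaque
      -- Expand both F S and F (S - b) at a: the weight of a cancels. What a neighbour v of a leaves
      -- is the same expression in S - a for the pair v, b. Unrolled, this is the sum of F (S - P)²
      -- over the paths P from a to b.
      paths-sos-bounded : ∀ k S → ∣ S ∣ ℕ.< k → ∀ a b → a ∈ S → b ∈ S → a ≢ b →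
        IsSOS (F (S - a) S.* F (S - b) S.- F S S.* F (S - a - b))
      paths-sos-bounded zero S ()
      paths-sos-bounded (suc k) S lt a b a∈S b∈S a≢b =
        sos-resp (S.sym expand) (sos-sum term each)
        where
        c d term : Fin n → Ser
        c v = guard (lookup S v ∧ adj G a v) (F (S - a - v))
        d v = guard (lookup (S - b) v ∧ adj G a v) (F (S - b - a - v))
        term v = c v S.* F (S - a - b) S.- F (S - a) S.* d v
        a∈S-b : a ∈ S - b
        a∈S-b = ∈-minus a∈S a≢b
        expand : F (S - a) S.* F (S - b) S.- F S S.* F (S - a - b) ≋ SSum.sum term
        expand = begin
          F (S - a) S.* F (S - b) S.- F S S.* F (S - a - b)
            ≈⟨ S.+-cong {F (S - a) S.* F (S - b)} (S.*-congˡ {F (S - a)} (rec (S - b) a a∈S-b)) (S.-‿cong (S.*-congʳ {F (S - a - b)} (rec S a a∈S))) ⟩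
          F (S - a) S.* (X a S.* F (S - b - a) S.- SSum.sum d) S.- (X a S.* F (S - a) S.- SSum.sum c) S.* F (S - a - b)
            ≡⟨ ≡.cong (λ T → F (S - a) S.* (X a S.* F T S.- SSum.sum d) S.- (X a S.* F (S - a) S.- SSum.sum c) S.* F (S - a - b)) (p─x─y≡p─y─x S b a) ⟩
          F (S - a) S.* (X a S.* F (S - a - b) S.- SSum.sum d) S.- (X a S.* F (S - a) S.- SSum.sum c) S.* F (S - a - b)
            ≈⟨ solve 5 (λ f x h d c → f :* (x :* h :- d) :- (x :* f :- c) :* h := c :* h :- f :* d) S.refl
                 (F (S - a)) (X a) (F (S - a - b)) (SSum.sum d) (SSum.sum c) ⟩
          SSum.sum c S.* F (S - a - b) S.- F (S - a) S.* SSum.sum d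
            ≈⟨ S.+-cong (SSum.*-distribʳ-sum (F (S - a - b)) c) (S.-‿cong (SSum.*-distribˡ-sum (F (S - a)) d)) ⟩
          SSum.sum (λ v → c v S.* F (S - a - b)) S.- SSum.sum (λ v → F (S - a) S.* d v)
            ≈⟨ sum-minus (λ v → c v S.* F (S - a - b)) (λ v → F (S - a) S.* d v) ⟨
          SSum.sum term ∎
        sos-zero-term : IsSOS (S.0# S.* F (S - a - b) S.- F (S - a) S.* S.0#)
        sos-zero-term = sos-resp (solve 2 (λ x y → con (0 , 0) := con (0 , 0) :* x :- y :* con (0 , 0)) S.refl (F (S - a - b)) (F (S - a))) sos-0
        each : ∀ v → IsSOS (term v)
        each v with v ≟ b
        -- The path that goes straight to b: b is absent from S - b, so nothing is subtracted and a
        -- square remains.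
        ... | yes ≡.refl rewrite x∉p-x S v | ∈-lookup b∈S with adj G a v
        ...   | true = sos-resp (solve 2 (λ x y → x :* x := x :* x :- y :* con (0 , 0)) S.refl (F (S - a - v)) (F (S - a))) (sos-square (F (S - a - v)))
        ...   | false = sos-zero-term
        each v | no v≢b rewrite lookup-minus-≢ S {b} {v} (v≢b ∘ ≡.sym) with lookup S v in inS | adj G a v in isAdj
        ... | true | true rewrite p─x─y≡p─y─x S b a | p─x─y≡p─y─x (S - a) b v =
          paths-sos-bounded k (S - a) (minus-shrinks a∈S lt) v b
            (∈-minus (lookup-∈ inS) (adj⇒≢ G isAdj ∘ ≡.sym)) (∈-minus b∈S (a≢b ∘ ≡.sym)) v≢b
        ... | true | false = sos-zero-term
        ... | false | _ = sos-zero-term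

      paths-sos : ∀ S a b → a ∈ S → b ∈ S → a ≢ b →
        IsSOS (F (S - a) S.* F (S - b) S.- F S S.* F (S - a - b))
      paths-sos S = paths-sos-bounded _ S ℕₚ.≤-refl

-- Series in t = x - θ and the leading term of a Wronskian

module Taylor (ℝ : RealField) (θ : RealField.Carrier ℝ) where
  open RealField ℝ hiding (zero; _-_)
  open OrderedField ℝ
  open Series ℝ
  open Poly ℝ using (fromℕ)
  open DifferenceSolver commutativeRing

  t : Ser
  t zero = 0#
  t (suc k) = one k

  -- The variable x = θ + t, as a series in t.
  X : Ser
  X zero = θ
  X (suc k) = one k

  -- The derivation t d/dt, which unlike d/dt does not shift indices.
  ϑ : Ser → Ser
  ϑ f k = fromℕ k * f k

  t*-suc : ∀ f k → mul t f (suc k) ≈ f k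
  t*-suc f k = trans (+-cong (zeroˡ _) (mul-identityˡ f k)) (+-identityˡ _)

  X*-suc : ∀ f k → mul X f (suc k) ≈ θ * f (suc k) + f k
  X*-suc f k = +-congˡ (mul-identityˡ f k)

  van-X* : ∀ {k f} → Van k f → Van k (mul X f)
  van-X* {k} {f} v = proj₁ (mul-van₀ k X f v)

  ϑ-cong : ∀ {f g} → f ≋ g → ϑ f ≋ ϑ g
  ϑ-cong e = ext λ k → *-congˡ (at e k)

  ϑ-minus : ∀ f g → ϑ (f S.- g) ≋ ϑ f S.- ϑ g
  ϑ-minus f g = ext λ k → solve 3 (λ a b c → a :* (b :- c) := a :* b :- a :* c) refl _ _ _

  ϑ-0 : ϑ S.0# ≋ S.0#
  ϑ-0 = ext λ k → zeroʳ _

  ϑ-one : ϑ one ≋ S.0#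
  ϑ-one = ext λ where
    zero → zeroˡ _
    (suc k) → zeroʳ _

  ϑ-sum : ∀ {n} (f : Fin n → Ser) → ϑ (SSum.sum f) ≋ SSum.sum (λ i → ϑ (f i))
  ϑ-sum {zero} f = ϑ-0
  ϑ-sum {suc n} f = ext λ k → trans (distribˡ _ _ _) (+-congˡ (at (ϑ-sum (f ∘ suc)) k))

  -- Leibniz rule, with ϑ X = t.
  ϑ-X* : ∀ f → ϑ (mul X f) ≋ mul X (ϑ f) S.+ mul t f
  ϑ-X* f = ext λ where
    zero → solve 2 (λ a b → con (0 , 0) :* (a :* b) := a :* (con (0 , 0) :* b) :+ con (0 , 0) :* b) refl θ (f 0)
    (suc k) → trans (*-congˡ (X*-suc f k)) (trans
      (solve 4 (λ n θ a b → (con (1 , 0) :+ n) :* (θ :* a :+ b) := (θ :* ((con (1 , 0) :+ n) :* a) :+ n :* b) :+ b) refl (fromℕ k) θ (f (suc k)) (f k))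
      (sym (+-cong (X*-suc (ϑ f) k) (t*-suc f k))))

  ϑ-van : ∀ {j f} → Van j f → Van j (ϑ f)
  ϑ-van v i l = trans (*-congˡ (v i l)) (zeroʳ _)

  -- In degree 2k + 1 the derivation contributes the factors k + 1 and k, whose difference is one,
  -- so the left side is f (k + 1) times g k. On the right this is the coefficient of a sum of
  -- squares at 2k; as g is among the squared series, it can be zero only if g k is.
  wronskian-leading : ∀ k f g hs →
    ϑ f S.* g S.- f S.* ϑ g ≋ t S.* squares (g ∷ hs) → Van (suc k) f → Van k g →
    0# ≤ (f (suc k) * g k) × (f (suc k) ≈ 0# → g k ≈ 0#)
  wronskian-leading k f g hs e vf vg = ≤-resp top (proj₂ (squares-nonneg k (g ∷ hs) vs)) , vanish
    where
    fg : Van (suc k ℕ.+ k) (mul (ϑ f) g) × mul (ϑ f) g (suc k ℕ.+ k) ≈ ϑ f (suc k) * g k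
    fg = mul-van (suc k) k (ϑ f) g (ϑ-van vf) vg
    fg′ : Van (suc k ℕ.+ k) (mul f (ϑ g)) × mul f (ϑ g) (suc k ℕ.+ k) ≈ f (suc k) * ϑ g k
    fg′ = mul-van (suc k) k f (ϑ g) vf (ϑ-van vg)
    shifted : ∀ j → squares (g ∷ hs) j ≈ mul (ϑ f) g (suc j) + - mul f (ϑ g) (suc j)
    shifted j = trans (sym (t*-suc (squares (g ∷ hs)) j)) (sym (at e (suc j)))
    vp : Van (k ℕ.+ k) (squares (g ∷ hs))
    vp j l = trans (shifted j) (van-+ (proj₁ fg) (van-neg (proj₁ fg′)) (suc j) (s≤s l))
    vs : All (Van k) (g ∷ hs)
    vs = squares-van k (g ∷ hs) vp
    top : squares (g ∷ hs) (k ℕ.+ k) ≈ f (suc k) * g k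
    top = trans (shifted (k ℕ.+ k)) (trans (+-cong (proj₂ fg) (-‿cong (proj₂ fg′)))
      (solve 3 (λ n a b → ((con (1 , 0) :+ n) :* a) :* b :- a :* (n :* b) := a :* b)
        refl (fromℕ k) (f (suc k)) (g k)))
    vanish : f (suc k) ≈ 0# → g k ≈ 0#
    vanish z with squares-zero k (g ∷ hs) vs (trans top (trans (*-congʳ z) (zeroˡ _)))
    ... | v ∷ _ = v k ℕₚ.≤-refl

module SumTools (ℝ : RealField) where
  open RealField ℝ hiding (zero)
  open OrderedField ℝ
  open Series ℝ
  open SeriesTools ℝ

  sum-≋0 : ∀ {n} (f : Fin n → Ser) → (∀ i → f i ≋ S.0#) → SSum.sum f ≋ S.0#
  sum-≋0 {n} f z = S.trans (SSum.sum-cong-≋ z) (SSum.sum-replicate-zero n)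

  sum-δ : ∀ {n} (u : Fin n) (h : Fin n → Ser) → SSum.sum (λ w → guard (does (u ≟ w)) (h w)) ≋ h u
  sum-δ {suc n} zero h = S.trans (S.+-congˡ {h zero} (sum-≋0 {n} (λ _ → S.0#) (λ i → S.refl))) (S.+-identityʳ (h zero))
  sum-δ (suc u) h = S.trans (S.+-identityˡ (SSum.sum (λ w → guard (does (u ≟ w)) (h (suc w))))) (sum-δ u (h ∘ suc))

  sum-nonneg : ∀ {n} (f : Fin n → Carrier) → (∀ i → 0# ≤ f i) → 0# ≤ RSum.sum f
  sum-nonneg {zero} f nn = inj₂ refl
  sum-nonneg {suc n} f nn = nonneg+ (nn zero) (sum-nonneg (f ∘ suc) (nn ∘ suc))

  sum-nonneg-zero : ∀ {n} (f : Fin n → Carrier) → (∀ i → 0# ≤ f i) → RSum.sum f ≈ 0# → ∀ i → f i ≈ 0#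
  sum-nonneg-zero {suc n} f nn z i with sum-zero (nn zero) (sum-nonneg (f ∘ suc) (nn ∘ suc)) z
  sum-nonneg-zero {suc n} f nn z zero | z₁ , _ = z₁
  sum-nonneg-zero {suc n} f nn z (suc i) | _ , z₂ = sum-nonneg-zero (f ∘ suc) (nn ∘ suc) z₂ i

-- Interlacing, derivative and multiplicativity for weight x

module UniformSystem (ℝ : RealField) (θ : RealField.Carrier ℝ) {n : ℕ} (G : Graph n)
  (F : Subset n → Series.Ser ℝ)
  (F-⊥ : Series._≋_ ℝ (F ⊥) (Series.one ℝ))
  (rec : SeriesTools.IsMatchingSystem ℝ G (λ _ → Taylor.X ℝ θ) F) where
  open RealField ℝ hiding (zero; _-_)
  open OrderedField ℝ
  open Poly ℝ using (fromℕ)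
  open Series ℝ
  open SeriesTools ℝ
  open SumTools ℝ
  open Taylor ℝ θ
  open DifferenceSolver seriesRing
  module RSolve = DifferenceSolver commutativeRing
  open import Relation.Binary.Reasoning.Setoid S.setoid

  opaque
    -- Apply ϑ to the expansion at u. The term with X yields t g² for g = F (S - u), and each
    -- neighbour v yields the Wronskian of S - u and S - u - v, to which induction applies. The
    -- square g² is displayed apart from q because `wronskian-leading` concludes about it.
    wronskian : ∀ k S → ∣ S ∣ ℕ.< k → ∀ u → u ∈ S → ∃ λ q → IsSOS q ×
      ϑ (F S) S.* F (S - u) S.- F S S.* ϑ (F (S - u)) ≋ t S.* (F (S - u) S.* F (S - u) S.+ q)
    wronskian zero S ()
    wronskian (suc k) S lt u u∈S = SSum.sum q , sos-sum q (λ v → proj₁ (proj₂ (each v))) , (begin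
      ϑ (F S) S.* g S.- F S S.* ϑ g
        ≈⟨ S.+-cong (S.*-congʳ {g} ϑF) (S.-‿cong (S.*-congʳ {ϑ g} (rec S u u∈S))) ⟩
      (X S.* ϑ g S.+ t S.* g S.- SSum.sum (λ v → ϑ (c v))) S.* g S.- (X S.* g S.- SSum.sum c) S.* ϑ g
        ≈⟨ solve 6 (λ x t g g′ s s′ → (x :* g′ :+ t :* g :- s′) :* g :- (x :* g :- s) :* g′ := t :* (g :* g) :+ (s :* g′ :- s′ :* g)) S.refl
             X t g (ϑ g) (SSum.sum c) (SSum.sum (λ v → ϑ (c v))) ⟩
      t S.* (g S.* g) S.+ (SSum.sum c S.* ϑ g S.- SSum.sum (λ v → ϑ (c v)) S.* g)
        ≈⟨ S.+-congˡ {t S.* (g S.* g)} (S.+-cong (SSum.*-distribʳ-sum (ϑ g) c) (S.-‿cong (SSum.*-distribʳ-sum g (λ v → ϑ (c v))))) ⟩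
      t S.* (g S.* g) S.+ (SSum.sum (λ v → c v S.* ϑ g) S.- SSum.sum (λ v → ϑ (c v) S.* g))
        ≈⟨ S.+-congˡ {t S.* (g S.* g)} (sum-minus (λ v → c v S.* ϑ g) (λ v → ϑ (c v) S.* g)) ⟨
      t S.* (g S.* g) S.+ SSum.sum (λ v → c v S.* ϑ g S.- ϑ (c v) S.* g)
        ≈⟨ S.+-congˡ {t S.* (g S.* g)} (SSum.sum-cong-≋ (λ v → proj₂ (proj₂ (each v)))) ⟩
      t S.* (g S.* g) S.+ SSum.sum (λ v → t S.* q v)
        ≈⟨ S.+-congˡ {t S.* (g S.* g)} (SSum.*-distribˡ-sum t q) ⟨
      t S.* (g S.* g) S.+ t S.* SSum.sum q
        ≈⟨ S.distribˡ t (g S.* g) (SSum.sum q) ⟨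
      t S.* (g S.* g S.+ SSum.sum q) ∎)
      where
      g : Ser
      g = F (S - u)
      c : Fin n → Ser
      c v = guard (lookup S v ∧ adj G u v) (F (S - u - v))
      each : ∀ v → ∃ λ q → IsSOS q × c v S.* ϑ g S.- ϑ (c v) S.* g ≋ t S.* q
      each v with lookup S v in inS | adj G u v in isAdj
      ... | true | true with wronskian k (S - u) (minus-shrinks u∈S lt) v (∈-minus (lookup-∈ inS) (adj⇒≢ G isAdj ∘ ≡.sym))
      ...   | q , sos , e = F (S - u - v) S.* F (S - u - v) S.+ q , sos-+ (sos-square (F (S - u - v))) sos ,
        S.trans (solve 4 (λ a b c d → a :* b :- c :* d := b :* a :- d :* c) S.refl (F (S - u - v)) (ϑ g) (ϑ (F (S - u - v))) g) e
      each v | true | false = S.0# , sos-0 , S.trans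
        (S.+-congˡ {S.0# S.* ϑ g} (S.-‿cong (S.*-congʳ {g} ϑ-0)))
        (solve 3 (λ a b c → con (0 , 0) :* a :- con (0 , 0) :* b := c :* con (0 , 0)) S.refl (ϑ g) g t)
      each v | false | _ = S.0# , sos-0 , S.trans
        (S.+-congˡ {S.0# S.* ϑ g} (S.-‿cong (S.*-congʳ {g} ϑ-0)))
        (solve 3 (λ a b c → con (0 , 0) :* a :- con (0 , 0) :* b := c :* con (0 , 0)) S.refl (ϑ g) g t)
      q : Fin n → Ser
      q v = proj₁ (each v)
      ϑF : ϑ (F S) ≋ X S.* ϑ g S.+ t S.* g S.- SSum.sum (λ v → ϑ (c v))
      ϑF = S.trans (ϑ-cong (rec S u u∈S)) (S.trans (ϑ-minus (X S.* g) (SSum.sum c)) (S.+-cong (ϑ-X* g) (S.-‿cong (ϑ-sum c))))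

  wronskian-coefficient : ∀ k S u → u ∈ S → Van (suc k) (F S) → Van k (F (S - u)) →
    0# ≤ (F S (suc k) * F (S - u) k) × (F S (suc k) ≈ 0# → F (S - u) k ≈ 0#)
  wronskian-coefficient k S u u∈S vf vg with wronskian _ S ℕₚ.≤-refl u u∈S
  ... | q , (hs , q≋) , e = wronskian-leading k (F S) (F (S - u)) hs
    (S.trans e (S.*-congˡ {t} (S.+-congˡ {F (S - u) S.* F (S - u)} q≋))) vf vg

  -- If j is the order of F (S - u), then F S cannot vanish through degree j + 1, since the
  -- Wronskian would make the leading coefficient of F (S - u) zero. This gives the cut-off j + 2 of
  -- the search.
  order-bounded : ∀ k S → ∣ S ∣ ℕ.< k → ∃ λ j → Ord (F S) j
  order-bounded zero S ()
  order-bounded (suc k) S lt with nonempty? S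
  ... | no empty rewrite Empty-unique empty = 0 , (λ _ ()) , λ z → 1≉0 (trans (sym (at F-⊥ 0)) z)
  ... | yes (u , u∈S) with order-bounded k (S - u) (minus-shrinks u∈S lt)
  ...   | j , vg , nz with van-or-ord (suc (suc j)) (F S)
  ...     | inj₂ o = o
  ...     | inj₁ v = contradiction (proj₂ (wronskian-coefficient j S u u∈S (van-mono (ℕₚ.n≤1+n _) v) vg) (v (suc j) ℕₚ.≤-refl)) nz

  opaque
    order : ∀ S → ∃ λ j → Ord (F S) j
    order S = order-bounded _ S ℕₚ.≤-refl

  m : Subset n → ℕ
  m S = proj₁ (order S)

  ord-m : ∀ S → Ord (F S) (m S)
  ord-m S = proj₂ (order S)

  opaque
    m-unique : ∀ {S k} → Ord (F S) k → m S ≡ k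
    m-unique {S} o = ord-unique (ord-m S) o

  van-m : ∀ S → Van (m S) (F S)
  van-m S = proj₁ (ord-m S)

  opaque
    -- The Wronskian argument again: a larger order at S would kill the leading coefficient of F (S
    -- - u).
    interlace₁ : ∀ {S u} → u ∈ S → m S ℕ.≤ suc (m (S - u))
    interlace₁ {S} {u} u∈S with m S ℕ.≤? suc (m (S - u))
    ... | yes le = le
    ... | no gt = contradiction
      (proj₂ (wronskian-coefficient (m (S - u)) S u u∈S (van-mono (ℕₚ.<⇒≤ (ℕₚ.≰⇒> gt)) (van-m S)) (van-m (S - u)))
        (van-m S _ (ℕₚ.≰⇒> gt)))
      (proj₂ (ord-m (S - u)))

  neighbour-term : Subset n → Fin n → Fin n → Ser
  neighbour-term S u v = guard (lookup S v ∧ adj G u v) (F (S - u - v))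

  neighbour-van : ∀ {S u k} → m (S - u) ≡ suc k → ∀ v → Van k (neighbour-term S u v)
  neighbour-van {S} {u} {k} eq v with lookup S v in inS | adj G u v in isAdj
  ... | true | true = van-mono (ℕₚ.≤-pred (≡.subst (ℕ._≤ suc (m (S - u - v))) eq (interlace₁ (∈-minus (lookup-∈ inS) (adj⇒≢ G isAdj ∘ ≡.sym))))) (van-m (S - u - v))
  ... | true | false = λ _ _ → refl
  ... | false | _ = λ _ _ → refl

  van-step : ∀ {S u k} → u ∈ S → m (S - u) ≡ suc k → Van k (F S)
  van-step {S} {u} {k} u∈S eq = van-resp (S.sym (rec S u u∈S))
    (van-+ (van-X* (van-mono (ℕₚ.≤-trans (ℕₚ.n≤1+n k) (ℕₚ.≤-reflexive (≡.sym eq))) (van-m (S - u))))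
           (van-neg (van-sum (neighbour-term S u) (neighbour-van {S} {u} eq))))

  opaque
    -- By the expansion at u: applied inside S - u, `interlace₁` shows that no neighbour term has
    -- order below m (S - u) - 1.
    interlace₂ : ∀ {S u} → u ∈ S → m (S - u) ℕ.≤ suc (m S)
    interlace₂ {S} {u} u∈S with m (S - u) in eq
    ... | zero = z≤n
    ... | suc k = s≤s (ord-≤ (ord-m S) (van-step u∈S eq))

  opaque
    -- The neighbours of u that are essential in S - u contribute poles to F S / F (S - u)
    -- whose residues all have the same sign, so these poles cannot cancel.
    essential-neighbour : ∀ {S u v} → u ∈ S → v ∈ S → adj G u v ≡ true →
      m (S - u) ≡ suc (m (S - u - v)) → m (S - u) ≡ suc (m S)
    essential-neighbour {S} {u} {v} u∈S v∈S isAdj eq = ≡.trans eq (≡.cong suc (≡.sym (m-unique (van-step u∈S eq , nonzero))))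
      where
      k : ℕ
      k = m (S - u - v)
      g : Ser
      g = F (S - u)
      g-ord : Ord g (suc k)
      g-ord = ≡.subst (Ord g) eq (ord-m (S - u))
      c : Fin n → Ser
      c = neighbour-term S u
      -- The common factor g (k + 1) normalizes the signs: the Wronskian of S - u and S - u - w
      -- makes each such product nonnegative.
      signs : ∀ w → 0# ≤ (g (suc k) * c w k)
      signs w with lookup S w in inS | adj G u w in isAdj | neighbour-van {S} {u} eq w
      ... | true | true | van = proj₁ (wronskian-coefficient k (S - u) w (∈-minus (lookup-∈ inS) (adj⇒≢ G isAdj ∘ ≡.sym)) (proj₁ g-ord) van)
      ... | true | false | _ = inj₂ (sym (zeroʳ _))
      ... | false | _ | _ = inj₂ (sym (zeroʳ _))
      c-v : c v k ≈ F (S - u - v) k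
      c-v rewrite ∈-lookup v∈S | isAdj = refl
      nonzero : ¬ (F S k ≈ 0#)
      nonzero z = *-nonzero (proj₂ g-ord) (λ z′ → proj₂ (ord-m (S - u - v)) (trans (sym c-v) z′))
        (sum-nonneg-zero (λ w → g (suc k) * c w k) signs total v)
        where
        -- As g has order k + 1, degree k of F S is made of the neighbour terms alone; if it
        -- vanished, so would each product of `signs`, including the nonzero one at v.
        Xg : mul X g k ≈ 0#
        Xg = van-X* (proj₁ g-ord) k ℕₚ.≤-refl
        Σc : SSum.sum c k ≈ 0#
        Σc = trans (RSolve.solve 2 (λ x y → y RSolve.:= x RSolve.:- (x RSolve.:- y)) refl (mul X g k) (SSum.sum c k))
          (trans (+-cong Xg (-‿cong (trans (sym (at (rec S u u∈S) k)) z))) (-‿inverseʳ _))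
        total : RSum.sum (λ w → g (suc k) * c w k) ≈ 0#
        total = trans (sym (RSum.*-distribˡ-sum (g (suc k)) (λ w → c w k)))
          (trans (*-congˡ (trans (sym (sum-at c k)) Σc)) (zeroʳ _))

  vertexSum : Subset n → Ser
  vertexSum S = SSum.sum (λ w → guard (lookup S w) (F (S - w)))

  opaque
    -- The identity μ' = sum of the μ (S - w), multiplied by t. Differentiating the expansion at u
    -- and using induction on every smaller set reassembles, for each w other than u, the expansion
    -- of S - w at u.
    derivative-bounded : ∀ k S → ∣ S ∣ ℕ.< k → ϑ (F S) ≋ t S.* vertexSum S
    derivative-bounded zero S ()
    derivative-bounded (suc k) S lt with nonempty? S
    ... | no empty rewrite Empty-unique empty = begin
      ϑ (F ⊥)            ≈⟨ ϑ-cong F-⊥ ⟩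
      ϑ one              ≈⟨ ϑ-one ⟩
      S.0#               ≈⟨ S.zeroʳ t ⟨
      t S.* S.0#         ≈⟨ S.*-congˡ (sum-≋0 _ (λ w → outside w)) ⟨
      t S.* vertexSum ⊥  ∎
      where
      outside : ∀ w → guard (lookup ⊥ w) (F (⊥ - w)) ≋ S.0#
      outside w rewrite lookup-replicate w false = S.refl
    ... | yes (u , u∈S) = begin
      ϑ (F S)
        ≈⟨ ϑ-cong (rec S u u∈S) ⟩
      ϑ (X S.* g S.- SSum.sum c)
        ≈⟨ ϑ-minus (X S.* g) (SSum.sum c) ⟩
      ϑ (X S.* g) S.- ϑ (SSum.sum c)
        ≈⟨ S.+-cong (ϑ-X* g) (S.-‿cong (S.trans (ϑ-sum c) (SSum.sum-cong-≋ ϑc))) ⟩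
      (X S.* ϑ g S.+ t S.* g) S.- SSum.sum (λ v → t S.* SSum.sum (b v))
        ≈⟨ S.+-cong (S.+-congʳ (S.*-congˡ (derivative-bounded k (S - u) (minus-shrinks u∈S lt)))) (S.-‿cong (S.sym (SSum.*-distribˡ-sum t (λ v → SSum.sum (b v))))) ⟩
      (X S.* (t S.* SSum.sum a) S.+ t S.* g) S.- t S.* SSum.sum (λ v → SSum.sum (b v))
        ≈⟨ solve 5 (λ x t a g b → (x :* (t :* a) :+ t :* g) :- t :* b := t :* (g :+ (x :* a :- b))) S.refl
             X t (SSum.sum a) g (SSum.sum (λ v → SSum.sum (b v))) ⟩
      t S.* (g S.+ (X S.* SSum.sum a S.- SSum.sum (λ v → SSum.sum (b v))))
        -- g becomes the summand at w = u, and the double sum is reordered so that the deleted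
        -- vertex w is outermost.
        ≈⟨ S.*-congˡ (S.+-cong (S.sym (sum-δ u (λ _ → g))) (S.+-cong (SSum.*-distribˡ-sum X a) (S.-‿cong (SSum.∑-comm b)))) ⟩
      t S.* (SSum.sum δ S.+ (SSum.sum (λ w → X S.* a w) S.- SSum.sum (λ w → SSum.sum (λ v → b v w))))
        ≈⟨ S.*-congˡ (S.+-congˡ (S.sym (sum-minus (λ w → X S.* a w) (λ w → SSum.sum (λ v → b v w))))) ⟩
      t S.* (SSum.sum δ S.+ SSum.sum (λ w → X S.* a w S.- SSum.sum (λ v → b v w)))
        ≈⟨ S.*-congˡ (S.sym (SSum.∑-distrib-+ δ (λ w → X S.* a w S.- SSum.sum (λ v → b v w)))) ⟩
      t S.* SSum.sum (λ w → δ w S.+ (X S.* a w S.- SSum.sum (λ v → b v w)))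
        ≈⟨ S.*-congˡ (SSum.sum-cong-≋ summand) ⟩
      t S.* vertexSum S ∎
      where
      g : Ser
      g = F (S - u)
      a c δ : Fin n → Ser
      a w = guard (lookup (S - u) w) (F (S - u - w))
      c v = guard (lookup S v ∧ adj G u v) (F (S - u - v))
      δ w = guard (does (u ≟ w)) g
      b : Fin n → Fin n → Ser
      b v w = guard (lookup S v ∧ adj G u v) (guard (lookup (S - u - v) w) (F (S - u - v - w)))
      ϑc : ∀ v → ϑ (c v) ≋ t S.* SSum.sum (b v)
      ϑc v with lookup S v in inS | adj G u v in isAdj
      ... | true | true = derivative-bounded k (S - u - v)
        (ℕₚ.≤-<-trans (∣p─q∣≤∣p∣ (S - u) ⁅ v ⁆) (minus-shrinks u∈S lt))
      ... | true | false = S.trans ϑ-0 (S.sym (S.trans (S.*-congˡ (SSum.sum-replicate-zero n)) (S.zeroʳ t)))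
      ... | false | _ = S.trans ϑ-0 (S.sym (S.trans (S.*-congˡ (SSum.sum-replicate-zero n)) (S.zeroʳ t)))
      simplify : ∀ {f a s} → a ≋ S.0# → s ≋ S.0# → f S.+ (X S.* a S.- s) ≋ f
      simplify {f} {a} {s} ea es = S.trans (S.+-congˡ (S.+-cong (S.*-congˡ ea) (S.-‿cong es)))
        (solve 2 (λ f x → f :+ (x :* con (0 , 0) :- con (0 , 0)) := f) S.refl f X)
      guard-outside : ∀ {b f} → b ≡ false → guard b f ≋ S.0#
      guard-outside ≡.refl = S.refl
      b-outside : ∀ w → (∀ v → lookup (S - u - v) w ≡ false) → SSum.sum (λ v → b v w) ≋ S.0#
      b-outside w out = sum-≋0 (λ v → b v w) (λ v → S.trans (guard-cong (lookup S v ∧ adj G u v) (guard-outside (out v))) (guard-0 (lookup S v ∧ adj G u v)))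
      summand : ∀ w → δ w S.+ (X S.* a w S.- SSum.sum (λ v → b v w)) ≋ guard (lookup S w) (F (S - w))
      summand w with u ≟ w
      ... | yes ≡.refl = S.trans (simplify (guard-outside (x∉p-x S u)) (b-outside u (outside-minus (S - u) (x∉p-x S u))))
                (S.reflexive (≡.cong (λ b → guard b g) (≡.sym (∈-lookup u∈S))))
      ... | no u≢w with lookup S w in inS
      ...   | false = simplify (guard-outside out) (b-outside w (outside-minus (S - u) out))
        where
        out : lookup (S - u) w ≡ false
        out = outside-minus S inS u
      ...   | true = begin
        S.0# S.+ (X S.* a w S.- SSum.sum (λ v → b v w))    ≈⟨ S.+-identityˡ _ ⟩
        X S.* a w S.- SSum.sum (λ v → b v w)               ≈⟨ S.+-cong (S.*-congˡ (S.reflexive aw)) (S.-‿cong (SSum.sum-cong-≋ bw)) ⟩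
        X S.* F (S - w - u) S.- neighbourSum G (S - w) u (λ v → F (S - w - u - v)) ≈⟨ rec (S - w) u (∈-minus u∈S u≢w) ⟨
        F (S - w) ∎
        where
        aw : a w ≡ F (S - w - u)
        aw rewrite lookup-minus-≢ S u≢w | inS | p─x─y≡p─y─x S u w = ≡.refl
        bw : ∀ v → b v w ≋ guard (lookup (S - w) v ∧ adj G u v) (F (S - w - u - v))
        bw v with w ≟ v
        ... | yes ≡.refl rewrite x∉p-x (S - u) v | x∉p-x S v = guard-0 (lookup S v ∧ adj G u v)
        ... | no w≢v rewrite lookup-minus-≢ S w≢v | lookup-minus-≢ (S - u) (w≢v ∘ ≡.sym) | lookup-minus-≢ S u≢w | inS
                | p─x─y≡p─y─x (S - u) v w | p─x─y≡p─y─x S u w = S.refl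

  derivative : ∀ S → ϑ (F S) ≋ t S.* vertexSum S
  derivative S = derivative-bounded _ S ℕₚ.≤-refl

  -- If F S had order j + 1, all the F (S - w) would vanish through degree j, hence so would their
  -- sum, the derivative; but its coefficient at j is (j + 1) times the leading coefficient of F S.
  no-essential⇒order-zero : ∀ S → (∀ u → u ∈ S → m S ℕ.≤ m (S - u)) → m S ≡ 0
  no-essential⇒order-zero S none with m S in eq
  ... | zero = ≡.refl
  ... | suc j = contradiction (cancel-nonzero (fromℕ-suc-nonzero j) (trans (at (derivative S) (suc j)) (trans (t*-suc (vertexSum S) j) (van-sum _ each j ℕₚ.≤-refl))))
    (≡.subst (λ i → ¬ (F S i ≈ 0#)) eq (proj₂ (ord-m S)))
    where
    each : ∀ w → Van (suc j) (guard (lookup S w) (F (S - w)))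
    each w with lookup S w in inS
    ... | true = van-mono (none w (lookup-∈ inS)) (van-m (S - w))
    ... | false = λ _ _ → refl

  -- Only closure under adjacency inside S: unlike being a component, this survives deletion of
  -- vertices from S.
  Separated : Subset n → Subset n → Set
  Separated Q S = ∀ x y → x ∈ S → y ∈ S → x ∈ Q → adj G x y ≡ true → y ∈ Q

  separated-minus : ∀ {Q S} u → Separated Q S → Separated Q (S - u)
  separated-minus u sep x y x∈ y∈ = sep x y (proj₁ (∈-minus⁻ x∈)) (proj₁ (∈-minus⁻ y∈))

  opaque
    -- Expand at a vertex of S ∩ Q. Its neighbours in S all lie in Q, so every term carries the
    -- factor F (S ─ Q).
    multiplicative-bounded : ∀ k Q S → ∣ S ∣ ℕ.< k → Separated Q S → F S ≋ F (S ∩ Q) S.* F (S ─ Q)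
    multiplicative-bounded zero Q S ()
    multiplicative-bounded (suc k) Q S lt sep with nonempty? (S ∩ Q)
    ... | no empty rewrite Empty-unique empty | ─-disjoint S Q (Empty-unique empty) =
      S.sym (S.trans (S.*-congʳ F-⊥) (S.*-identityˡ (F S)))
    ... | yes (u , u∈) = begin
      F S
        ≈⟨ rec S u u∈S ⟩
      X S.* F (S - u) S.- neighbourSum G S u (λ v → F (S - u - v))
        ≈⟨ S.+-cong (S.*-congˡ split-u) (S.-‿cong (SSum.sum-cong-≋ split-v)) ⟩
      X S.* (F (S ∩ Q - u) S.* R) S.- SSum.sum (λ v → c v S.* R)
        ≈⟨ S.+-cong (S.sym (S.*-assoc X (F (S ∩ Q - u)) R)) (S.-‿cong (S.sym (SSum.*-distribʳ-sum R c))) ⟩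
      (X S.* F (S ∩ Q - u)) S.* R S.- SSum.sum c S.* R
        ≈⟨ solve 3 (λ a b r → a :* r :- b :* r := (a :- b) :* r) S.refl (X S.* F (S ∩ Q - u)) (SSum.sum c) R ⟩
      (X S.* F (S ∩ Q - u) S.- SSum.sum c) S.* R
        ≈⟨ S.*-congʳ (rec (S ∩ Q) u u∈) ⟨
      F (S ∩ Q) S.* R ∎
      where
      R : Ser
      R = F (S ─ Q)
      u∈S : u ∈ S
      u∈S = proj₁ (x∈p∩q⁻ S Q u∈)
      u∈Q : u ∈ Q
      u∈Q = proj₂ (x∈p∩q⁻ S Q u∈)
      c : Fin n → Ser
      c v = guard (lookup (S ∩ Q) v ∧ adj G u v) (F (S ∩ Q - u - v))
      split-u : F (S - u) ≋ F (S ∩ Q - u) S.* R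
      split-u = S.trans (multiplicative-bounded k Q (S - u) (minus-shrinks u∈S lt) (separated-minus u sep))
        (S.reflexive (≡.cong₂ (λ p q → F p S.* F q) (minus-∩ S Q u) (minus-─ S Q u∈Q)))
      split-v : ∀ v → guard (lookup S v ∧ adj G u v) (F (S - u - v)) ≋ c v S.* R
      split-v v rewrite lookup-∩ S Q v with lookup S v in inS | adj G u v in isAdj
      ... | false | _ = S.sym (S.zeroˡ R)
      ... | true | false rewrite Boolₚ.∧-zeroʳ (lookup Q v) = S.sym (S.zeroˡ R)
      ... | true | true rewrite ∈-lookup (sep u v u∈S (lookup-∈ inS) u∈Q isAdj) =
        S.trans (multiplicative-bounded k Q (S - u - v)
            (ℕₚ.≤-<-trans (∣p─q∣≤∣p∣ (S - u) ⁅ v ⁆) (minus-shrinks u∈S lt)) (separated-minus v (separated-minus u sep)))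
          (S.reflexive (≡.cong₂ (λ p q → F p S.* F q)
            (≡.trans (minus-∩ (S - u) Q v) (≡.cong (_- v) (minus-∩ S Q u)))
            (≡.trans (minus-─ (S - u) Q (sep u v u∈S (lookup-∈ inS) u∈Q isAdj)) (minus-─ S Q u∈Q))))

  order-additive : ∀ {Q S} → Separated Q S → m S ≡ m (S ∩ Q) ℕ.+ m (S ─ Q)
  order-additive {Q} {S} sep = m-unique (ord-resp (S.sym (multiplicative-bounded _ Q S ℕₚ.≤-refl sep))
    (ord-mul (ord-m (S ∩ Q)) (ord-m (S ─ Q))))

-- Stability under deletion of a special vertex

between : ∀ {a c} → a ℕ.≤ c → c ℕ.≤ suc a → c ≡ a ⊎ c ≡ suc a
between lo hi with ℕₚ.m≤n⇒m<n∨m≡n lo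
... | inj₁ lt = inj₂ (ℕₚ.≤-antisym hi lt)
... | inj₂ eq = inj₁ (≡.sym eq)

between₂ : ∀ {a c} → a ℕ.≤ c → c ℕ.≤ suc (suc a) → c ≡ a ⊎ (c ≡ suc a ⊎ c ≡ suc (suc a))
between₂ lo hi with ℕₚ.m≤n⇒m<n∨m≡n lo
... | inj₁ lt = inj₂ (between lt hi)
... | inj₂ eq = inj₁ (≡.sym eq)

module Stability (ℝ : RealField) (θ : RealField.Carrier ℝ) {n : ℕ} (G : Graph n)
  (F : Subset n → Series.Ser ℝ)
  (F-⊥ : Series._≋_ ℝ (F ⊥) (Series.one ℝ))
  (rec : SeriesTools.IsMatchingSystem ℝ G (λ _ → Taylor.X ℝ θ) F) where
  open Series ℝ
  open SeriesTools ℝ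
  open Taylor ℝ θ
  open DifferenceSolver seriesRing
  open UniformSystem ℝ θ G F F-⊥ rec
  open Paths ℝ G
  open import Relation.Binary.Reasoning.Setoid S.setoid

  module _ {Y : Fin n → Ser} {H : Subset n → Ser} (sys : IsMatchingSystem G Y H)
    {S : Subset n} {a b : Fin n} (a∈S : a ∈ S) (b∈S : b ∈ S) (a≢b : a ≢ b) (k : ℕ) where

    -- When one of the two products has odd order and the other vanishes beyond that degree, their
    -- difference inherits the odd order, which a sum of squares cannot have. Stated for any system
    -- so as to cover the perturbed one.
    outer-not-odd : Ord (H S S.* H (S - a - b)) (suc (k ℕ.+ k)) → ¬ Van (suc (suc (k ℕ.+ k))) (H (S - a) S.* H (S - b))
    outer-not-odd o v = sos-ord-not-odd k (paths-sos sys S a b a∈S b∈S a≢b)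
      (ord-resp (S.+-comm _ _) (ord-+ (ord-neg o) v))

    inner-not-odd : Ord (H (S - a) S.* H (S - b)) (suc (k ℕ.+ k)) → ¬ Van (suc (suc (k ℕ.+ k))) (H S S.* H (S - a - b))
    inner-not-odd o v = sos-ord-not-odd k (paths-sos sys S a b a∈S b∈S a≢b) (ord-+ o (van-neg v))

  -- The matching polynomial with the weight x of the vertex w replaced by x + 1. The parity
  -- constraint on path sums also holds for it, and there the orders at S and S - w mix.
  perturbed : Fin n → Subset n → Ser
  perturbed w S = F S S.+ guard (lookup S w) (F (S - w))

  perturbedWeight : Fin n → Fin n → Ser
  perturbedWeight w u = X S.+ guard (does (w ≟ u)) one

  perturbed-inside : ∀ {w S} → w ∈ S → perturbed w S ≡ F S S.+ F (S - w)
  perturbed-inside w∈S rewrite ∈-lookup w∈S = ≡.refl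

  perturbed-outside : ∀ {w} S → lookup S w ≡ false → perturbed w S ≋ F S
  perturbed-outside S e rewrite e = S.+-identityʳ (F S)

  -- At u = w the extra F (S - w) is absorbed by the weight x + 1, and w is gone from every other
  -- term. At any other u, the expansions of S and of S - w are added.
  perturbed-system : ∀ w → IsMatchingSystem G (perturbedWeight w) (perturbed w)
  perturbed-system w S u u∈S with w ≟ u
  ... | yes ≡.refl = begin
    perturbed w S
      ≡⟨ perturbed-inside u∈S ⟩
    F S S.+ F (S - w)
      ≈⟨ S.+-congʳ (rec S w u∈S) ⟩
    (X S.* F (S - w) S.- neighbourSum G S w (λ v → F (S - w - v))) S.+ F (S - w)
      ≈⟨ solve 3 (λ x f s → (x :* f :- s) :+ f := (x :+ con (1 , 0)) :* f :- s) S.refl X (F (S - w)) (neighbourSum G S w (λ v → F (S - w - v))) ⟩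
    (X S.+ one) S.* F (S - w) S.- neighbourSum G S w (λ v → F (S - w - v))
      ≈⟨ S.+-cong (S.*-congˡ (perturbed-outside (S - w) (x∉p-x S w)))
           (S.-‿cong (SSum.sum-cong-≋ λ v → guard-cong (lookup S v ∧ adj G w v) (perturbed-outside (S - w - v) (out v)))) ⟨
    (X S.+ one) S.* perturbed w (S - w) S.- neighbourSum G S w (λ v → perturbed w (S - w - v)) ∎
    where
    out : ∀ v → lookup (S - w - v) w ≡ false
    out v rewrite lookup-minus (S - w) v w | x∉p-x S w = ≡.refl
  ... | no w≢u with lookup S w in inS
  ...   | false = begin
    F S S.+ S.0#
      ≈⟨ S.+-identityʳ (F S) ⟩
    F S
      ≈⟨ rec S u u∈S ⟩
    X S.* F (S - u) S.- neighbourSum G S u (λ v → F (S - u - v))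
      ≈⟨ S.+-cong (S.*-cong (S.+-identityʳ X) (perturbed-outside (S - u) out))
           (S.-‿cong (SSum.sum-cong-≋ λ v → guard-cong (lookup S v ∧ adj G u v) (perturbed-outside (S - u - v) (out₂ v)))) ⟨
    (X S.+ S.0#) S.* perturbed w (S - u) S.- neighbourSum G S u (λ v → perturbed w (S - u - v)) ∎
    where
    out : lookup (S - u) w ≡ false
    out rewrite lookup-minus S u w | inS = ≡.refl
    out₂ : ∀ v → lookup (S - u - v) w ≡ false
    out₂ v rewrite lookup-minus (S - u) v w | out = ≡.refl
  ...   | true = begin
    F S S.+ F (S - w)
      ≈⟨ S.+-cong (rec S u u∈S) (rec (S - w) u (∈-minus u∈S (w≢u ∘ ≡.sym))) ⟩
    (X S.* F (S - u) S.- SSum.sum c) S.+ (X S.* F (S - w - u) S.- SSum.sum d)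
      ≈⟨ solve 5 (λ x f c g d → (x :* f :- c) :+ (x :* g :- d) := (x :+ con (0 , 0)) :* (f :+ g) :- (c :+ d)) S.refl
           X (F (S - u)) (SSum.sum c) (F (S - w - u)) (SSum.sum d) ⟩
    (X S.+ S.0#) S.* (F (S - u) S.+ F (S - w - u)) S.- (SSum.sum c S.+ SSum.sum d)
      ≈⟨ S.+-cong (S.*-congˡ (S.reflexive (≡.sym first))) (S.-‿cong (S.trans (S.sym (SSum.∑-distrib-+ c d)) (SSum.sum-cong-≋ rest))) ⟩
    (X S.+ S.0#) S.* perturbed w (S - u) S.- neighbourSum G S u (λ v → perturbed w (S - u - v)) ∎
    where
    c d : Fin n → Ser
    c v = guard (lookup S v ∧ adj G u v) (F (S - u - v))
    d v = guard (lookup (S - w) v ∧ adj G u v) (F (S - w - u - v))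
    first : perturbed w (S - u) ≡ F (S - u) S.+ F (S - w - u)
    first rewrite lookup-minus-≢ S (w≢u ∘ ≡.sym) | inS | p─x─y≡p─y─x S u w = ≡.refl
    rest : ∀ v → c v S.+ d v ≋ guard (lookup S v ∧ adj G u v) (perturbed w (S - u - v))
    rest v with w ≟ v
    ... | yes ≡.refl rewrite x∉p-x (S - u) v | x∉p-x S v = S.trans (S.+-identityʳ (c v))
      (guard-cong (lookup S v ∧ adj G u v) (S.sym (S.+-identityʳ _)))
    ... | no w≢v rewrite lookup-minus-≢ S w≢v | lookup-minus-≢ (S - u) (w≢v ∘ ≡.sym) | lookup-minus-≢ S (w≢u ∘ ≡.sym) | inS
            | p─x─y≡p─y─x (S - u) v w | p─x─y≡p─y─x S u w with lookup S v ∧ adj G u v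
    ...   | true = S.refl
    ...   | false = S.+-identityʳ S.0#

  m-swap : ∀ S u v → m (S - u - v) ≡ m (S - v - u)
  m-swap S u v = ≡.cong m (p─x─y≡p─y─x S u v)

  Essential′ NonEssential : Subset n → Fin n → Set
  Essential′ S u = suc (m (S - u)) ≡ m S
  NonEssential S u = m S ℕ.≤ m (S - u)

  essential-or-not : ∀ {S u} → u ∈ S → Essential′ S u ⊎ NonEssential S u
  essential-or-not u∈S with ℕₚ.m≤n⇒m<n∨m≡n (interlace₁ u∈S)
  ... | inj₁ lt = inj₂ (ℕₚ.≤-pred lt)
  ... | inj₂ eq = inj₁ (≡.sym eq)

  ess-≢-noness : ∀ {S u w} → NonEssential S u → Essential′ S w → w ≢ u
  ess-≢-noness {S} {u} ne e ≡.refl = ℕₚ.<-irrefl ≡.refl (≡.subst (ℕ._≤ m (S - u)) (≡.sym e) ne)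

  ordₘ : ∀ {S k} → m S ≡ k → Ord (F S) k
  ordₘ {S} eq = ≡.subst (Ord (F S)) eq (ord-m S)

  vanₘ : ∀ {S k} → k ℕ.≤ m S → Van k (F S)
  vanₘ {S} le = van-mono le (van-m S)

  opaque
    parity-outer : ∀ {S a b i j k} → a ∈ S → b ∈ S → a ≢ b →
      m S ≡ i → m (S - a - b) ≡ j → i ℕ.+ j ≡ suc (k ℕ.+ k) →
      ¬ (suc (suc (k ℕ.+ k)) ℕ.≤ m (S - a) ℕ.+ m (S - b))
    parity-outer {S} {a} {b} {k = k} a∈S b∈S a≢b ei ej e le = outer-not-odd rec a∈S b∈S a≢b k
      (≡.subst (Ord _) e (ord-mul (ordₘ ei) (ordₘ ej)))
      (van-mono le (proj₁ (mul-van _ _ _ _ (van-m (S - a)) (van-m (S - b)))))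

  opaque
    parity-inner : ∀ {S a b i j k} → a ∈ S → b ∈ S → a ≢ b →
      m (S - a) ≡ i → m (S - b) ≡ j → i ℕ.+ j ≡ suc (k ℕ.+ k) →
      ¬ (suc (suc (k ℕ.+ k)) ℕ.≤ m S ℕ.+ m (S - a - b))
    parity-inner {S} {a} {b} {k = k} a∈S b∈S a≢b ei ej e le = inner-not-odd rec a∈S b∈S a≢b k
      (≡.subst (Ord _) e (ord-mul (ordₘ ei) (ordₘ ej)))
      (van-mono le (proj₁ (mul-van _ _ _ _ (van-m S) (van-m (S - a - b)))))

  opaque
    -- Unperturbed, the path sum has the harmless order 2k + 2. After the perturbation at w, the
    -- orders at S and S - a - b are k and k + 1, with the odd total 2k + 1, while both series at S
    -- - a and S - b vanish below k + 1.
    perturbation-obstruction : ∀ {S a b w k} → a ∈ S → b ∈ S → w ∈ S → a ≢ b → w ≢ a → w ≢ b →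
      m (S - w) ≡ k → m S ≡ suc k → m (S - a) ≡ 2 ℕ.+ k → m (S - b) ≡ 2 ℕ.+ k →
      m (S - a - w) ≡ suc k → m (S - b - w) ≡ suc k → m (S - a - b) ≡ suc k → ¬ (m (S - a - b - w) ≡ 2 ℕ.+ k)
    perturbation-obstruction {S} {a} {b} {w} {k} a∈S b∈S w∈S a≢b w≢a w≢b ew e ea eb eaw ebw eab eabw =
      outer-not-odd (perturbed-system w) a∈S b∈S a≢b k
        (≡.subst (Ord (perturbed w S S.* perturbed w (S - a - b))) (ℕₚ.+-suc k k) (ord-mul
          (≡.subst (λ f → Ord f k) (≡.sym (perturbed-inside w∈S)) (ord-resp (S.+-comm (F (S - w)) (F S)) (ord-+ (ordₘ ew) (vanₘ (ℕₚ.≤-reflexive (≡.sym e))))))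
          (≡.subst (λ f → Ord f (suc k)) (≡.sym (perturbed-inside (∈-minus (∈-minus w∈S w≢a) w≢b))) (ord-+ (ordₘ eab) (vanₘ (ℕₚ.≤-reflexive (≡.sym eabw)))))))
        (≡.subst (λ i → Van i (perturbed w (S - a) S.* perturbed w (S - b))) (≡.cong suc (ℕₚ.+-suc k k)) (proj₁ (mul-van (suc k) (suc k) (perturbed w (S - a)) (perturbed w (S - b)) (van ea eaw w≢a) (van eb ebw w≢b))))
      where
      van : ∀ {c} → m (S - c) ≡ 2 ℕ.+ k → m (S - c - w) ≡ suc k → w ≢ c → Van (suc k) (perturbed w (S - c))
      van {c} ec ecw w≢c = ≡.subst (Van (suc k)) (≡.sym (perturbed-inside (∈-minus w∈S w≢c)))
        (van-+ (vanₘ (ℕₚ.≤-trans (ℕₚ.n≤1+n _) (ℕₚ.≤-reflexive (≡.sym ec)))) (vanₘ (ℕₚ.≤-reflexive (≡.sym ecw))))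

  opaque
    -- With k = m (S - w), interlacing leaves k + 1 or k + 2 for m (S - u). For k + 2 interlacing
    -- already suffices. For k + 1 the only alternative is m (S - u - w) = k + 1; then F (S - u) F
    -- (S - w) has odd order 2k + 1 and F S F (S - u - w) has order 2k + 2, against parity.
    essential-persists : ∀ {S u w} → u ∈ S → w ∈ S → NonEssential S u → Essential′ S w → Essential′ (S - u) w
    essential-persists {S} {u} {w} u∈S w∈S ne e = go (between k+1≤ ≤k+2)
      where
      k : ℕ
      k = m (S - w)
      w≢u : w ≢ u
      w≢u = ess-≢-noness ne e
      k+1≤ : suc k ℕ.≤ m (S - u)
      k+1≤ = ≡.subst (ℕ._≤ m (S - u)) (≡.sym e) ne
      ≤k+2 : m (S - u) ℕ.≤ suc (suc k)
      ≤k+2 = ≡.subst (λ i → m (S - u) ℕ.≤ suc i) (≡.sym e) (interlace₂ u∈S)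
      upper : m (S - u - w) ℕ.≤ suc k
      upper = ≡.subst (ℕ._≤ suc k) (m-swap S w u) (interlace₂ (∈-minus u∈S (w≢u ∘ ≡.sym)))
      lower : m (S - u) ℕ.≤ suc (m (S - u - w))
      lower = interlace₁ (∈-minus w∈S w≢u)
      go : m (S - u) ≡ suc k ⊎ m (S - u) ≡ suc (suc k) → Essential′ (S - u) w
      go (inj₂ eq) = ℕₚ.≤-antisym (≡.subst (suc (m (S - u - w)) ℕ.≤_) (≡.sym eq) (s≤s upper)) lower
      go (inj₁ eq) with between (ℕₚ.≤-pred (≡.subst (ℕ._≤ suc (m (S - u - w))) eq lower)) upper
      ... | inj₁ c≡k = ≡.trans (≡.cong suc c≡k) (≡.sym eq)
      ... | inj₂ c≡k+1 = contradiction
        (ℕₚ.≤-reflexive (≡.trans (≡.cong suc (≡.sym (ℕₚ.+-suc k k))) (≡.cong₂ ℕ._+_ e (≡.sym c≡k+1))))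
        (parity-inner {k = k} u∈S w∈S (w≢u ∘ ≡.sym) eq ≡.refl ≡.refl)

  record Special′ (S : Subset n) (a : Fin n) : Set where
    field
      inside : a ∈ S
      nonEssential : NonEssential S a
      {witness} : Fin n
      adjacent : adj G a witness ≡ true
      witness∈ : witness ∈ S
      essential : Essential′ S witness

  opaque
    -- The essential neighbour stays essential once a is gone, so `essential-neighbour` applies to
    -- it.
    special-positive : ∀ {S a} → Special′ S a → m (S - a) ≡ suc (m S)
    special-positive sp = essential-neighbour inside witness∈ adjacent (≡.sym (essential-persists inside witness∈ nonEssential essential))
      where open Special′ sp

  opaque
    -- Since a is positive, interlacing settles an essential v. If v is neutral, a is special in S -
    -- v with the same witness, hence positive there. Only a positive v calls for parity and the
    -- perturbation.
    stability : ∀ {S a v} → Special′ S a → v ∈ S → v ≢ a → m (S - a - v) ≡ suc (m (S - v))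
    stability {S} {a} {v} sp v∈S v≢a = go (essential-or-not v∈S)
      where
      open Special′ sp renaming (witness to w; witness∈ to w∈S; inside to a∈S)
      k : ℕ
      k = m (S - w)
      mS : m S ≡ suc k
      mS = ≡.sym essential
      mSa : m (S - a) ≡ suc (suc k)
      mSa = ≡.trans (special-positive sp) (≡.cong suc mS)
      a∈S-v : a ∈ S - v
      a∈S-v = ∈-minus a∈S (v≢a ∘ ≡.sym)
      w≢a : w ≢ a
      w≢a = ess-≢-noness nonEssential essential
      lower : suc k ℕ.≤ m (S - a - v)
      lower = ℕₚ.≤-pred (≡.subst (ℕ._≤ suc (m (S - a - v))) mSa (interlace₁ (∈-minus v∈S v≢a)))
      upper : m (S - a - v) ℕ.≤ suc (m (S - v))
      upper = ≡.subst (ℕ._≤ suc (m (S - v))) (m-swap S v a) (interlace₂ a∈S-v)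

      -- If a and v are positive and deleting both gives back the order of S, then parity and the
      -- perturbed system make w essential in S - v - a, so its neighbour a is positive in S - v.
      positive : NonEssential S v → m (S - v) ≡ suc (suc k) → m (S - a - v) ≡ suc (m (S - v))
      positive ne eq with between₂ lower (≡.subst (λ i → m (S - a - v) ℕ.≤ suc i) eq upper)
      ... | inj₂ (inj₂ c≡) = ≡.trans c≡ (≡.cong suc (≡.sym eq))
      -- The products would have orders (k + 1) + (k + 2), which is odd, and 2k + 4, which is
      -- larger.
      ... | inj₂ (inj₁ c≡) = contradiction
        (ℕₚ.≤-reflexive (≡.trans (≡.cong (λ i → suc (suc i)) (≡.sym (ℕₚ.+-suc k (suc k)))) (≡.cong₂ ℕ._+_ (≡.sym mSa) (≡.sym eq))))
        (parity-outer {k = suc k} a∈S v∈S (v≢a ∘ ≡.sym) mS c≡ (≡.cong suc (ℕₚ.+-suc k (suc k))))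
      ... | inj₁ c≡ = Empty.⊥-elim (impossible (between₂ d-lower d-upper))
        where
        w≢v : w ≢ v
        w≢v = ess-≢-noness ne essential
        maw : m (S - a - w) ≡ suc k
        maw = ℕₚ.suc-injective (≡.trans (essential-persists a∈S w∈S nonEssential essential) mSa)
        mvw : m (S - v - w) ≡ suc k
        mvw = ℕₚ.suc-injective (≡.trans (essential-persists v∈S w∈S ne essential) eq)
        d-lower : k ℕ.≤ m (S - a - v - w)
        d-lower = ℕₚ.≤-pred (≡.subst (ℕ._≤ suc (m (S - a - v - w))) c≡ (interlace₁ (∈-minus (∈-minus w∈S w≢a) w≢v)))
        d-upper : m (S - a - v - w) ℕ.≤ suc (suc k)
        d-upper = ≡.subst₂ (λ i j → i ℕ.≤ suc j) (m-swap (S - a) w v) maw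
          (interlace₂ (∈-minus (∈-minus v∈S v≢a) (w≢v ∘ ≡.sym)))
        impossible : m (S - a - v - w) ≡ k ⊎ (m (S - a - v - w) ≡ suc k ⊎ m (S - a - v - w) ≡ suc (suc k)) → Empty.⊥
        impossible (inj₁ d≡) = ℕₚ.<⇒≢ {suc k} (s≤s (ℕₚ.n≤1+n (suc k)))
          (≡.trans (≡.sym c≡) (≡.trans (m-swap S a v) (≡.trans positive-in-S-v (≡.cong suc eq))))
          where
          positive-in-S-v : m (S - v - a) ≡ suc (m (S - v))
          positive-in-S-v = essential-neighbour a∈S-v (∈-minus w∈S w≢v) adjacent
            (≡.trans (m-swap S v a) (≡.trans c≡ (≡.cong suc (≡.trans (≡.sym d≡) (≡.cong (λ T → m (T - w)) (p─x─y≡p─y─x S a v))))))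
        -- Parity in S - w for the pair a, v: the orders k and k + 1 of the outer factors have an
        -- odd sum, and the inner ones, k + 1 each, add up to more.
        impossible (inj₂ (inj₁ d≡)) = parity-outer {k = k} (∈-minus a∈S (w≢a ∘ ≡.sym)) (∈-minus v∈S (w≢v ∘ ≡.sym)) (v≢a ∘ ≡.sym)
          ≡.refl (≡.trans (≡.cong m (≡.trans (≡.cong (_- v) (p─x─y≡p─y─x S w a)) (p─x─y≡p─y─x (S - a) w v))) d≡) (ℕₚ.+-suc k k)
          (ℕₚ.≤-reflexive (≡.trans (≡.cong suc (≡.sym (ℕₚ.+-suc k k))) (≡.cong₂ ℕ._+_ (≡.trans (≡.sym maw) (m-swap S a w)) (≡.trans (≡.sym mvw) (m-swap S v w)))))
        impossible (inj₂ (inj₂ d≡)) = perturbation-obstruction a∈S v∈S w∈S (v≢a ∘ ≡.sym) w≢a w≢v ≡.refl mS mSa eq maw mvw c≡ d≡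

      go : Essential′ S v ⊎ NonEssential S v → m (S - a - v) ≡ suc (m (S - v))
      go (inj₁ e) = ℕₚ.≤-antisym upper (≡.subst (ℕ._≤ m (S - a - v)) (≡.trans (≡.sym mS) (≡.sym e)) lower)
      go (inj₂ ne) with between (≡.subst (ℕ._≤ m (S - v)) mS ne) (≡.subst (λ i → m (S - v) ℕ.≤ suc i) mS (interlace₂ v∈S))
      ... | inj₂ eq = positive ne eq
      ... | inj₁ eq = ≡.trans (m-swap S a v) (special-positive record
        { inside = a∈S-v
        ; nonEssential = ≡.subst₂ ℕ._≤_ (≡.sym eq) (m-swap S a v) lower
        ; adjacent = adjacent
        ; witness∈ = ∈-minus w∈S (ess-≢-noness ne essential)
        ; essential = essential-persists v∈S w∈S ne essential
        })

  -- This is `stability` inside S - u: there a is positive by `stability` at u, and its witness is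
  -- still essential because u is not.
  stability₂ : ∀ {S a u v} → Special′ S a → u ∈ S → v ∈ S → u ≢ a → v ≢ a → u ≢ v → NonEssential S u →
    m (S - a - u - v) ≡ suc (m (S - u - v))
  stability₂ {S} {a} {u} {v} sp u∈S v∈S u≢a v≢a u≢v ne = ≡.trans (≡.cong (λ T → m (T - v)) (p─x─y≡p─y─x S a u))
    (stability record
      { inside = ∈-minus inside (u≢a ∘ ≡.sym)
      ; nonEssential = ℕₚ.≤-trans (ℕₚ.n≤1+n _) (ℕₚ.≤-reflexive (≡.trans (≡.sym (stability sp u∈S u≢a)) (m-swap S a u)))
      ; adjacent = adjacent
      ; witness∈ = ∈-minus witness∈ (ess-≢-noness ne essential)
      ; essential = essential-persists u∈S witness∈ ne essential
      } (∈-minus v∈S (u≢v ∘ ≡.sym)) v≢a)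
    where open Special′ sp

-- Multiplicity of θ as the order of the Taylor expansion

module TaylorShift (ℝ : RealField) (θ : RealField.Carrier ℝ) where
  open RealField ℝ hiding (zero; _-_)
  open OrderedField ℝ
  open Series ℝ
  open Poly ℝ
  open Taylor ℝ θ
  module R = DifferenceSolver commutativeRing
  open DifferenceSolver seriesRing

  const : Carrier → Ser
  const c zero = c
  const c (suc k) = 0#

  const-cong : ∀ {c d} → c ≈ d → const c ≋ const d
  const-cong e = ext λ where
    zero → e
    (suc k) → refl

  const-+ : ∀ c d → const (c + d) ≋ const c S.+ const d
  const-+ c d = ext λ where
    zero → refl
    (suc k) → sym (+-identityˡ _)

  const-neg : ∀ c → const (- c) ≋ S.- const c
  const-neg c = ext λ where
    zero → refl
    (suc k) → sym (RingProps.-0#≈0# ring)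

  const-0 : const 0# ≋ S.0#
  const-0 = ext λ where
    zero → refl
    (suc k) → refl

  const-1 : const 1# ≋ one
  const-1 = ext λ where
    zero → refl
    (suc k) → refl

  const-* : ∀ c f n → mul (const c) f n ≈ c * f n
  const-* c f zero = refl
  const-* c f (suc n) = trans (+-congˡ (mul-zeroˡ {const c ∘ suc} f (λ _ → refl) n)) (+-identityʳ _)

  X≋θ+t : X ≋ const θ S.+ t
  X≋θ+t = ext λ where
    zero → sym (+-identityʳ _)
    (suc k) → sym (+-identityˡ _)

  -- Taylor expansion at θ, in the variable t = x - θ.
  τ : Pol → Ser
  τ [] = S.0#
  τ (a ∷ p) = const a S.+ X S.* τ p

  τ-zero : ∀ p → τ p 0 ≈ eval p θ
  τ-zero [] = refl
  τ-zero (a ∷ p) = +-congˡ (*-congˡ (τ-zero p))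

  τ-+ : ∀ p q → τ (p +ₚ q) ≋ τ p S.+ τ q
  τ-+ [] q = S.sym (S.+-identityˡ (τ q))
  τ-+ (a ∷ p) [] = S.sym (S.+-identityʳ (τ (a ∷ p)))
  τ-+ (a ∷ p) (b ∷ q) = S.trans (S.+-cong (const-+ a b) (S.*-congˡ (τ-+ p q)))
    (solve 5 (λ a b x p q → (a :+ b) :+ x :* (p :+ q) := (a :+ x :* p) :+ (b :+ x :* q)) S.refl (const a) (const b) X (τ p) (τ q))

  τ-scale : ∀ c p → τ (scale c p) ≋ const c S.* τ p
  τ-scale c [] = S.sym (S.zeroʳ (const c))
  τ-scale c (a ∷ p) = S.trans (S.+-cong (ext λ where
        zero → refl
        (suc k) → sym (trans (const-* c (const a) (suc k)) (zeroʳ c))) (S.*-congˡ (τ-scale c p)))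
    (solve 4 (λ c a x p → c :* a :+ x :* (c :* p) := c :* (a :+ x :* p)) S.refl (const c) (const a) X (τ p))

  τ-* : ∀ p q → τ (p *ₚ q) ≋ τ p S.* τ q
  τ-* [] q = S.sym (S.zeroˡ (τ q))
  τ-* (a ∷ p) q = S.trans (τ-+ (scale a q) (0# ∷ (p *ₚ q)))
    (S.trans (S.+-cong (τ-scale a q) (S.+-cong const-0 (S.*-congˡ (τ-* p q))))
    (solve 4 (λ a q x p → a :* q :+ (con (0 , 0) :+ x :* (p :* q)) := (a :+ x :* p) :* q) S.refl (const a) (τ q) X (τ p)))

  τ-null : ∀ p → (∀ i → coeff p i ≈ 0#) → τ p ≋ S.0#
  τ-null [] z = S.refl
  τ-null (a ∷ p) z = S.trans (S.+-cong (S.trans (const-cong (z 0)) const-0) (S.trans (S.*-congˡ (τ-null p (z ∘ suc))) (S.zeroʳ X)))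
    (S.+-identityˡ S.0#)

  τ-cong : ∀ p q → p ≈ₚ q → τ p ≋ τ q
  τ-cong [] q e = S.sym (τ-null q (λ i → sym (e i)))
  τ-cong (a ∷ p) [] e = τ-null (a ∷ p) e
  τ-cong (a ∷ p) (b ∷ q) e = S.+-cong (const-cong (e 0)) (S.*-congˡ (τ-cong p q (e ∘ suc)))

  τ-X-θ : τ (X- θ) ≋ t
  τ-X-θ = S.trans (S.+-cong (const-neg θ) (S.*-cong X≋θ+t (S.+-congʳ const-1)))
    (S.trans (S.+-congˡ (S.*-congˡ (S.+-congˡ (S.zeroʳ X))))
    (solve 2 (λ c t → (:- c) :+ (c :+ t) :* (con (1 , 0) :+ con (0 , 0)) := t) S.refl (const θ) t))

  τ-1 : τ (1# ∷ []) ≋ one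
  τ-1 = S.trans (S.+-cong const-1 (S.zeroʳ X)) (S.+-identityʳ one)

  ord-t : Ord t 1
  ord-t = (λ where zero _ → refl ; (suc j) (s≤s ())) , 1≉0

  ord-τ-power : ∀ k → Ord (τ ((X- θ) ^ₚ k)) k
  ord-τ-power zero = ord-resp (S.sym τ-1) ((λ _ ()) , 1≉0)
  ord-τ-power (suc k) = ord-resp (S.sym (S.trans (τ-* (X- θ) ((X- θ) ^ₚ k)) (S.*-congʳ τ-X-θ))) (ord-mul ord-t (ord-τ-power k))

  mult⇒ord : ∀ {p k} → IsMult θ p k → Ord (τ p) k
  mult⇒ord {p} {k} (q , e , nz) = ord-resp (S.sym (S.trans (τ-cong p (((X- θ) ^ₚ k) *ₚ q) e) (τ-* ((X- θ) ^ₚ k) q)))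
    (≡.subst (Ord (τ ((X- θ) ^ₚ k) S.* τ q)) (ℕₚ.+-identityʳ k)
      (ord-mul (ord-τ-power k) ((λ _ ()) , λ z → nz (trans (sym (τ-zero q)) z))))

  coeff-+ : ∀ p q i → coeff (p +ₚ q) i ≈ coeff p i + coeff q i
  coeff-+ [] q i = sym (+-identityˡ _)
  coeff-+ (a ∷ p) [] i = sym (+-identityʳ _)
  coeff-+ (a ∷ p) (b ∷ q) zero = refl
  coeff-+ (a ∷ p) (b ∷ q) (suc i) = coeff-+ p q i

  coeff-scale : ∀ c p i → coeff (scale c p) i ≈ c * coeff p i
  coeff-scale c [] i = sym (zeroʳ c)
  coeff-scale c (a ∷ p) zero = refl
  coeff-scale c (a ∷ p) (suc i) = coeff-scale c p i

  coeff-* : ∀ p q → coeff (p *ₚ q) ≋ coeff p S.* coeff q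
  coeff-* [] q = ext λ i → sym (mul-zeroˡ {coeff []} (coeff q) (λ _ → refl) i)
  coeff-* (a ∷ p) q = ext λ where
    zero → trans (coeff-+ (scale a q) _ 0) (trans (+-identityʳ _) (coeff-scale a q 0))
    (suc i) → trans (coeff-+ (scale a q) _ (suc i)) (+-cong (coeff-scale a q (suc i)) (at (coeff-* p q) i))

  -- Synthetic division by x - θ: the coefficients are the values at θ of the successive tails. A
  -- trailing zero is harmless, since `≈ₚ` compares coefficients.
  quotient : Pol → Pol
  quotient [] = []
  quotient (a ∷ p) = eval p θ ∷ quotient p

  quotient-zero : ∀ p → coeff p 0 ≈ - θ * coeff (quotient p) 0 + eval p θ
  quotient-zero [] = R.solve 1 (λ x → R.con (0 , 0) R.:= (R.:- x) R.:* R.con (0 , 0) R.:+ R.con (0 , 0)) refl θ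
  quotient-zero (a ∷ p) = R.solve 3 (λ a x e → a R.:= (R.:- x) R.:* e R.:+ (a R.:+ x R.:* e)) refl a θ (eval p θ)

  quotient-suc : ∀ p j → coeff p (suc j) ≈ - θ * coeff (quotient p) (suc j) + coeff (quotient p) j
  quotient-suc [] j = R.solve 1 (λ x → R.con (0 , 0) R.:= (R.:- x) R.:* R.con (0 , 0) R.:+ R.con (0 , 0)) refl θ
  quotient-suc (a ∷ p) zero = quotient-zero p
  quotient-suc (a ∷ p) (suc j) = quotient-suc p j

  coeff-[1] : coeff (1# ∷ []) ≋ one
  coeff-[1] = ext λ where
    zero → refl
    (suc i) → refl

  quotient-factor : ∀ p → eval p θ ≈ 0# → coeff p ≋ coeff (X- θ) S.* coeff (quotient p)
  quotient-factor p z = ext λ where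
    zero → trans (quotient-zero p) (trans (+-congˡ z) (+-identityʳ _))
    (suc j) → trans (quotient-suc p j) (+-congˡ (sym (trans (mul-cong (at coeff-[1]) (λ _ → refl) j) (mul-identityˡ (coeff (quotient p)) j))))

  -- `IsMult` asks for a polynomial cofactor, so the zeros are divided off one at a time by
  -- synthetic division; each division lowers the indices of the expansion by one.
  ord⇒mult : ∀ k p → Ord (τ p) k → IsMult θ p k
  ord⇒mult zero p (_ , nz) = p ,
    at (S.trans (S.sym (S.trans (S.*-congʳ coeff-[1]) (S.*-identityˡ (coeff p)))) (S.sym (coeff-* (1# ∷ []) p))) ,
    λ z → nz (trans (τ-zero p) z)
  ord⇒mult (suc k) p (v , nz) = q , at factor , proj₂ (proj₂ rest)
    where
    root : coeff p ≋ coeff (X- θ) S.* coeff (quotient p)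
    root = quotient-factor p (trans (sym (τ-zero p)) (v 0 (s≤s z≤n)))
    shift : τ p ≋ t S.* τ (quotient p)
    shift = S.trans (τ-cong p ((X- θ) *ₚ quotient p) (at (S.trans root (S.sym (coeff-* (X- θ) (quotient p))))))
      (S.trans (τ-* (X- θ) (quotient p)) (S.*-congʳ τ-X-θ))
    shift-suc : ∀ j → τ p (suc j) ≈ τ (quotient p) j
    shift-suc j = trans (at shift (suc j)) (t*-suc (τ (quotient p)) j)
    rest : IsMult θ (quotient p) k
    rest = ord⇒mult k (quotient p) ((λ j l → trans (sym (shift-suc j)) (v (suc j) (s≤s l))) , λ z → nz (trans (shift-suc k) z))
    q P : Pol
    q = proj₁ rest
    P = (X- θ) ^ₚ k
    factor : coeff p ≋ coeff (((X- θ) *ₚ P) *ₚ q)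
    factor = S.trans root (S.trans (S.*-congˡ (S.trans (ext (proj₁ (proj₂ rest))) (coeff-* P q)))
      (S.trans (S.sym (S.*-assoc (coeff (X- θ)) (coeff P) (coeff q)))
      (S.trans (S.*-congʳ (S.sym (coeff-* (X- θ) P))) (S.sym (coeff-* ((X- θ) *ₚ P) q)))))

-- Counting matchings along a list of edges

module _ {A : Set} where

  count : (A → Bool) → List A → ℕ
  count p xs = length (boolFilter p xs)

  count-++ : ∀ p xs ys → count p (xs ++ ys) ≡ count p xs ℕ.+ count p ys
  count-++ p [] ys = ≡.refl
  count-++ p (x ∷ xs) ys with p x
  ... | true = ≡.cong suc (count-++ p xs ys)
  ... | false = count-++ p xs ys

  count-cong : ∀ {p q} xs → All (λ x → p x ≡ q x) xs → count p xs ≡ count q xs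
  count-cong [] [] = ≡.refl
  count-cong {p} {q} (x ∷ xs) (e ∷ es) rewrite e with q x
  ... | true = ≡.cong suc (count-cong xs es)
  ... | false = count-cong xs es

  count-false : ∀ p xs → (∀ x → p x ≡ false) → count p xs ≡ 0
  count-false p [] f = ≡.refl
  count-false p (x ∷ xs) f rewrite f x = count-false p xs f

count-map : ∀ {A B : Set} (p : B → Bool) (f : A → B) xs → count p (map f xs) ≡ count (p ∘ f) xs
count-map p f [] = ≡.refl
count-map p f (x ∷ xs) with p (f x)
... | true = ≡.cong suc (count-map p f xs)
... | false = count-map p f xs

module EdgeLists {n : ℕ} (G : Graph n) where

  Edge : Set
  Edge = Σ (Fin n) λ _ → Fin n

  _⊆ᵇ_ : Edge → Subset n → Bool
  (a , b) ⊆ᵇ S = lookup S a ∧ lookup S b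

  insideᵇ : Subset n → List Edge → Bool
  insideᵇ S [] = true
  insideᵇ S (e ∷ M) = (e ⊆ᵇ S) ∧ insideᵇ S M

  -- The test `insideᵇ` is automatic for edges of G[S]; it becomes a genuine condition when the
  -- vertex set shrinks while the edge list stays.
  isMatching : Subset n → ℕ → List Edge → Bool
  isMatching S r M = (length M ℕ.≡ᵇ r) ∧ (pairwiseDisjoint G M ∧ insideᵇ S M)

  matchings : List Edge → Subset n → ℕ → ℕ
  matchings E S r = count (isMatching S r) (sublists G E)

  allDisjoint : Edge → List Edge → Bool
  allDisjoint e M = foldr (λ f acc → disjointE G e f ∧ acc) true M

  disjoint-⊆ : ∀ e f S → disjointE G e f ∧ (f ⊆ᵇ S) ≡ f ⊆ᵇ (S - proj₁ e - proj₂ e)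
  disjoint-⊆ (a , b) (c , d) S
    rewrite lookup-minus (S - a) b c | lookup-minus S a c | lookup-minus (S - a) b d | lookup-minus S a d
    with lookup S c | lookup S d | does (a ≟ c) | does (a ≟ d) | does (b ≟ c) | does (b ≟ d)
  ... | true | true | true | _ | _ | _ = ≡.refl
  ... | true | true | false | true | x | y = ≡.sym (Boolₚ.∧-zeroʳ (not x))
  ... | true | true | false | false | x | y = Boolₚ.∧-identityʳ (not x ∧ not y)
  ... | false | _ | x | y | z | w = Boolₚ.∧-zeroʳ (not x ∧ not y ∧ not z ∧ not w)
  ... | true | false | x | y | z | w = ≡.trans (Boolₚ.∧-zeroʳ (not x ∧ not y ∧ not z ∧ not w)) (≡.sym (Boolₚ.∧-zeroʳ (not x ∧ not z)))

  ∧-shuffle : ∀ p q r s → (p ∧ q) ∧ (r ∧ s) ≡ (p ∧ r) ∧ (q ∧ s)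
  ∧-shuffle true true r s = ≡.refl
  ∧-shuffle true false r s = ≡.sym (Boolₚ.∧-zeroʳ r)
  ∧-shuffle false q r s = ≡.refl

  -- Turns disjointness from e into deletion of its endpoints, so that matchings through e are
  -- counted on a smaller vertex set.
  allDisjoint-inside : ∀ e M S → allDisjoint e M ∧ insideᵇ S M ≡ insideᵇ (S - proj₁ e - proj₂ e) M
  allDisjoint-inside e [] S = ≡.refl
  allDisjoint-inside e (f ∷ M) S = ≡.trans (∧-shuffle (disjointE G e f) (allDisjoint e M) (f ⊆ᵇ S) (insideᵇ S M))
    (≡.cong₂ _∧_ (disjoint-⊆ e f S) (allDisjoint-inside e M S))

  isMatching-cons : ∀ e S r → e ⊆ᵇ S ≡ true → ∀ M → isMatching S (suc r) (e ∷ M) ≡ isMatching (S - proj₁ e - proj₂ e) r M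
  isMatching-cons e S r e⊆S M rewrite e⊆S = ≡.cong ((length M ℕ.≡ᵇ r) ∧_) (≡.trans
    (≡.trans (≡.cong (_∧ insideᵇ S M) (Boolₚ.∧-comm (allDisjoint e M) (pairwiseDisjoint G M)))
             (Boolₚ.∧-assoc (pairwiseDisjoint G M) (allDisjoint e M) (insideᵇ S M)))
    (≡.cong (pairwiseDisjoint G M ∧_) (allDisjoint-inside e M S)))

  matchings-zero : ∀ e E S → matchings (e ∷ E) S 0 ≡ matchings E S 0
  matchings-zero e E S = ≡.trans (count-++ (isMatching S 0) (sublists G E) (map (e ∷_) (sublists G E)))
    (≡.trans (≡.cong (matchings E S 0 ℕ.+_) (≡.trans (count-map (isMatching S 0) (e ∷_) (sublists G E)) (count-false _ (sublists G E) (λ M → ≡.refl))))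
      (ℕₚ.+-identityʳ _))

  matchings-suc : ∀ e E S r → e ⊆ᵇ S ≡ true →
    matchings (e ∷ E) S (suc r) ≡ matchings E S (suc r) ℕ.+ matchings E (S - proj₁ e - proj₂ e) r
  matchings-suc e E S r e⊆S = ≡.trans (count-++ (isMatching S (suc r)) (sublists G E) (map (e ∷_) (sublists G E)))
    (≡.cong (matchings E S (suc r) ℕ.+_) (≡.trans (count-map (isMatching S (suc r)) (e ∷_) (sublists G E))
      (count-cong (sublists G E) (All.universal (isMatching-cons e S r e⊆S) (sublists G E)))))

  matchings-outside : ∀ e E S r → e ⊆ᵇ S ≡ false → matchings (e ∷ E) S r ≡ matchings E S r
  matchings-outside e E S r e⊈S = ≡.trans (count-++ (isMatching S r) (sublists G E) (map (e ∷_) (sublists G E)))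
    (≡.trans (≡.cong (matchings E S r ℕ.+_) (≡.trans (count-map (isMatching S r) (e ∷_) (sublists G E)) (count-false _ (sublists G E) none)))
      (ℕₚ.+-identityʳ _))
    where
    none : ∀ M → isMatching S r (e ∷ M) ≡ false
    none M rewrite e⊈S = ≡.trans (≡.cong ((suc (length M) ℕ.≡ᵇ r) ∧_) (Boolₚ.∧-zeroʳ (allDisjoint e M ∧ pairwiseDisjoint G M))) (Boolₚ.∧-zeroʳ (suc (length M) ℕ.≡ᵇ r))

  sublists-inside : ∀ S E → All (λ e → e ⊆ᵇ S ≡ true) E → All (λ M → insideᵇ S M ≡ true) (sublists G E)
  sublists-inside S [] [] = ≡.refl ∷ []
  sublists-inside S (e ∷ E) (i ∷ is) = ++⁺ rest (map⁺ (All.map (λ {M} x → ≡.cong₂ _∧_ i x) rest))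
    where
    rest : All (λ M → insideᵇ S M ≡ true) (sublists G E)
    rest = sublists-inside S E is

  condition : Subset n → Fin n → Fin n → Bool
  condition S i j = (toℕ i ℕ.<ᵇ toℕ j) ∧ mem G S i ∧ mem G S j ∧ adj G i j

  Valid : Subset n → Edge → Set
  Valid S (a , b) = ((a , b) ⊆ᵇ S ≡ true) × a ≢ b

  condition⇒valid : ∀ S i j → condition S i j ≡ true → Valid S (i , j)
  condition⇒valid S i j c with ∧-true {toℕ i ℕ.<ᵇ toℕ j} c
  ... | lt , c₁ with ∧-true {lookup S i} c₁
  ...   | i∈ , c₂ with ∧-true {lookup S j} c₂
  ...     | j∈ , isAdj = ≡.cong₂ _∧_ i∈ j∈ , adj⇒≢ G isAdj

  row : Subset n → Fin n → List (Fin n) → List Edge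
  row S i js = map (λ j → (i , j)) (boolFilter (condition S i) js)

  row-valid : ∀ S i js → All (Valid S) (row S i js)
  row-valid S i [] = []
  row-valid S i (j ∷ js) with condition S i j in c
  ... | true = condition⇒valid S i j c ∷ row-valid S i js
  ... | false = row-valid S i js

  rows-valid : ∀ S is → All (Valid S) (concatMap (λ i → row S i (allFin n)) is)
  rows-valid S [] = []
  rows-valid S (i ∷ is) = ++⁺ (row-valid S i (allFin n)) (rows-valid S is)

  edges-valid : ∀ S → All (Valid S) (edgesOf G S)
  edges-valid S = rows-valid S (allFin n)

  numMatchings≡ : ∀ S r → numMatchings G S r ≡ matchings (edgesOf G S) S r
  numMatchings≡ S r = count-cong (sublists G (edgesOf G S)) (All.map (λ {M} x →
      ≡.cong ((length M ℕ.≡ᵇ r) ∧_) (≡.sym (≡.trans (≡.cong (pairwiseDisjoint G M ∧_) x) (Boolₚ.∧-identityʳ _))))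
    (sublists-inside S (edgesOf G S) (All.map proj₁ (edges-valid S))))

  -- The longer list has extra edges, all leaving S. This relates the edges of G[S] to those of G,
  -- so that one list can serve all vertex sets.
  data Thin (S : Subset n) : List Edge → List Edge → Set where
    nil : Thin S [] []
    keep : ∀ {e E E′} → Thin S E E′ → Thin S (e ∷ E) (e ∷ E′)
    drop : ∀ {e E E′} → e ⊆ᵇ S ≡ false → Thin S E E′ → Thin S E (e ∷ E′)

  thin-++ : ∀ {S E₁ E₂ E₁′ E₂′} → Thin S E₁ E₁′ → Thin S E₂ E₂′ → Thin S (E₁ ++ E₂) (E₁′ ++ E₂′)
  thin-++ nil t = t
  thin-++ (keep s) t = keep (thin-++ s t)
  thin-++ (drop o s) t = drop o (thin-++ s t)

  ⊈-minus : ∀ e S v → e ⊆ᵇ S ≡ false → e ⊆ᵇ (S - v) ≡ false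
  ⊈-minus (a , b) S v o rewrite lookup-minus S v a | lookup-minus S v b with lookup S a | lookup S b
  ... | true | false = Boolₚ.∧-zeroʳ (not (does (v ≟ a)))
  ... | false | _ = ≡.refl

  thin-minus : ∀ {S E E′} v → Thin S E E′ → Thin (S - v) E E′
  thin-minus v nil = nil
  thin-minus v (keep t) = keep (thin-minus v t)
  thin-minus {S} v (drop {e} o t) = drop (⊈-minus e S v o) (thin-minus v t)

  condition-split : ∀ S i j → condition S i j ≡ condition ⊤ i j ∧ ((i , j) ⊆ᵇ S)
  condition-split S i j rewrite lookup-replicate i true | lookup-replicate j true
    with toℕ i ℕ.<ᵇ toℕ j | lookup S i | lookup S j | adj G i j
  ... | false | _ | _ | _ = ≡.refl
  ... | true | true | true | x = ≡.sym (Boolₚ.∧-identityʳ x)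
  ... | true | true | false | x = ≡.sym (Boolₚ.∧-zeroʳ x)
  ... | true | false | _ | x = ≡.sym (Boolₚ.∧-zeroʳ x)

  thin-row : ∀ S i js → Thin S (row S i js) (row ⊤ i js)
  thin-row S i [] = nil
  thin-row S i (j ∷ js) with condition S i j | condition ⊤ i j | condition-split S i j
  ... | true | true | _ = keep (thin-row S i js)
  ... | false | true | e = drop (≡.sym e) (thin-row S i js)
  ... | false | false | _ = thin-row S i js

  thin-edges : ∀ S → Thin S (edgesOf G S) (edgesOf G ⊤)
  thin-edges S = rows (allFin n)
    where
    rows : ∀ is → Thin S (concatMap (λ i → row S i (allFin n)) is) (concatMap (λ i → row ⊤ i (allFin n)) is)
    rows [] = nil
    rows (i ∷ is) = thin-++ (thin-row S i (allFin n)) (rows is)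

-- From matching counts to the vertex recursion

module MatchingPolynomial (ℝ : RealField) (θ : RealField.Carrier ℝ) {n : ℕ} (G : Graph n) where
  open RealField ℝ hiding (zero; _-_)
  open Series ℝ
  open SeriesTools ℝ
  open SumTools ℝ
  open Poly ℝ
  open Taylor ℝ θ
  open TaylorShift ℝ θ
  open EdgeLists G
  open Match G ℝ using (signed; μ)
  open DifferenceSolver seriesRing
  open import Relation.Binary.Reasoning.Setoid S.setoid

  pow : ℕ → Ser
  pow zero = one
  pow (suc k) = X S.* pow k

  τ-monomial : ∀ c k → τ (monomial c k) ≋ const c S.* pow k
  τ-monomial c zero = S.trans (S.+-congˡ (S.zeroʳ X)) (S.trans (S.+-identityʳ (const c)) (S.sym (S.*-identityʳ (const c))))
  τ-monomial c (suc k) = S.trans (S.+-cong const-0 (S.*-congˡ (τ-monomial c k)))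
    (solve 3 (λ x c p → con (0 , 0) :+ x :* (c :* p) := c :* (x :* p)) S.refl X (const c) (pow k))

  -- The edge recursion of the matching polynomial: either the edge is left out, or it is used and
  -- its endpoints disappear. Without edges it is a power of x.
  Φ : List Edge → Subset n → Ser
  Φ [] S = pow ∣ S ∣
  Φ ((a , b) ∷ E) S = Φ E S S.- guard ((a , b) ⊆ᵇ S) (Φ E (S - a - b))

  sumTo : ℕ → (ℕ → Ser) → Ser
  sumTo zero f = S.0#
  sumTo (suc K) f = f 0 S.+ sumTo K (f ∘ suc)

  sumTo-cong : ∀ K {f g} → (∀ r → f r ≋ g r) → sumTo K f ≋ sumTo K g
  sumTo-cong zero e = S.refl
  sumTo-cong (suc K) e = S.+-cong (e 0) (sumTo-cong K (e ∘ suc))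

  sumTo-minus : ∀ K f g → sumTo K (λ r → f r S.- g r) ≋ sumTo K f S.- sumTo K g
  sumTo-minus zero f g = S.sym (S.-‿inverseʳ S.0#)
  sumTo-minus (suc K) f g = S.trans (S.+-congˡ (sumTo-minus K (f ∘ suc) (g ∘ suc)))
    (solve 4 (λ a b c d → (a :- b) :+ (c :- d) := (a :+ c) :- (b :+ d)) S.refl (f 0) (g 0) (sumTo K (f ∘ suc)) (sumTo K (g ∘ suc)))

  sumTo-0 : ∀ K {f} → (∀ r → f r ≋ S.0#) → sumTo K f ≋ S.0#
  sumTo-0 zero z = S.refl
  sumTo-0 (suc K) z = S.trans (S.+-cong (z 0) (sumTo-0 K (z ∘ suc))) (S.+-identityˡ S.0#)

  τ-foldr : ∀ (g : ℕ → Pol) (h : ℕ → ℕ) K → τ (foldr (λ r acc → g r +ₚ acc) [] (applyUpTo h K)) ≋ sumTo K (λ r → τ (g (h r)))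
  τ-foldr g h zero = S.refl
  τ-foldr g h (suc K) = S.trans (τ-+ (g (h 0)) _) (S.+-congˡ (τ-foldr g (h ∘ suc) K))

  term : ℕ → ℕ → ℕ → Ser
  term s r c = guard (2 ℕ.* r ℕ.≤ᵇ s) (const (signed r c) S.* pow (s ℕ.∸ 2 ℕ.* r))

  fromℕ-+ : ∀ a b → fromℕ (a ℕ.+ b) ≈ fromℕ a + fromℕ b
  fromℕ-+ zero b = sym (+-identityˡ _)
  fromℕ-+ (suc a) b = trans (+-congˡ (fromℕ-+ a b)) (sym (+-assoc _ _ _))

  signed-+ : ∀ r a b → signed r (a ℕ.+ b) ≈ signed r a + signed r b
  signed-+ zero a b = fromℕ-+ a b
  signed-+ (suc r) a b = trans (-‿cong (signed-+ r a b)) (sym (RingProps.-‿+-comm ring _ _))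

  signed-0 : ∀ r → signed r 0 ≈ 0#
  signed-0 zero = refl
  signed-0 (suc r) = trans (-‿cong (signed-0 r)) (RingProps.-0#≈0# ring)

  term-+ : ∀ s r a b → term s r (a ℕ.+ b) ≋ term s r a S.+ term s r b
  term-+ s r a b with 2 ℕ.* r ℕ.≤ᵇ s
  ... | true = S.trans (S.*-congʳ (S.trans (const-cong (signed-+ r a b)) (const-+ (signed r a) (signed r b)))) (S.distribʳ _ _ _)
  ... | false = S.sym (S.+-identityˡ S.0#)

  term-0 : ∀ s r → term s r 0 ≋ S.0#
  term-0 s r with 2 ℕ.* r ℕ.≤ᵇ s
  ... | true = S.trans (S.*-congʳ (S.trans (const-cong (signed-0 r)) const-0)) (S.zeroˡ _)
  ... | false = S.refl

  <ᵇ-suc : ∀ x y → (x ℕ.<ᵇ suc y) ≡ (x ℕ.≤ᵇ y)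
  <ᵇ-suc zero y = ≡.refl
  <ᵇ-suc (suc x) y = ≡.refl

  term-suc : ∀ s r c → term (2 ℕ.+ s) (suc r) c ≋ S.- term s r c
  term-suc s r c = S.trans (S.reflexive (≡.cong entry (ℕₚ.*-suc 2 r))) shifted
    where
    entry : ℕ → Ser
    entry d = guard (d ℕ.≤ᵇ 2 ℕ.+ s) (const (signed (suc r) c) S.* pow (2 ℕ.+ s ℕ.∸ d))
    shifted : entry (2 ℕ.+ 2 ℕ.* r) ≋ S.- term s r c
    shifted rewrite <ᵇ-suc (2 ℕ.* r) s with 2 ℕ.* r ℕ.≤ᵇ s
    ... | true = S.trans (S.*-congʳ (const-neg (signed r c))) (S.sym (RingProps.-‿distribˡ-* S.ring _ _))
    ... | false = S.sym (RingProps.-0#≈0# S.ring)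

  -- The cut-off K is kept free because using an edge costs two vertices and one unit of K, which
  -- preserves the bound ∣ S ∣ < 2K. The cut-off in `μ` satisfies this bound.
  matching-sum : ∀ E S K → All (λ e → proj₁ e ≢ proj₂ e) E → ∣ S ∣ ℕ.< 2 ℕ.* K →
    sumTo K (λ r → term ∣ S ∣ r (matchings E S r)) ≋ Φ E S
  matching-sum E S zero _ ()
  matching-sum [] S (suc K) [] lt = S.trans (S.+-cong (S.*-congʳ (S.trans (const-cong (+-identityʳ 1#)) const-1)) (sumTo-0 K (λ r → term-0 ∣ S ∣ (suc r))))
    (S.trans (S.+-identityʳ _) (S.*-identityˡ (pow ∣ S ∣)))
  matching-sum ((a , b) ∷ E) S (suc K) (a≢b ∷ ne) lt with (a , b) ⊆ᵇ S in inS
  ... | false = S.trans (sumTo-cong (suc K) (λ r → S.reflexive (≡.cong (term ∣ S ∣ r) (matchings-outside (a , b) E S r inS))))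
    (S.trans (matching-sum E S (suc K) ne lt) (S.sym (S.trans (S.+-congˡ (RingProps.-0#≈0# S.ring)) (S.+-identityʳ (Φ E S)))))
  ... | true = begin
    f′ 0 S.+ sumTo K (f′ ∘ suc)
      ≈⟨ S.+-cong (S.reflexive (≡.cong (term ∣ S ∣ 0) (matchings-zero (a , b) E S))) (sumTo-cong K next) ⟩
    f 0 S.+ sumTo K (λ r → f (suc r) S.- g r)
      ≈⟨ S.+-congˡ (sumTo-minus K (f ∘ suc) g) ⟩
    f 0 S.+ (sumTo K (f ∘ suc) S.- sumTo K g)
      ≈⟨ S.+-assoc (f 0) (sumTo K (f ∘ suc)) (S.- sumTo K g) ⟨
    sumTo (suc K) f S.- sumTo K g
      ≈⟨ S.+-cong (matching-sum E S (suc K) ne lt) (S.-‿cong (matching-sum E S′ K ne smaller)) ⟩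
    Φ E S S.- Φ E S′ ∎
    where
    S′ : Subset n
    S′ = S - a - b
    f f′ g : ℕ → Ser
    f r = term ∣ S ∣ r (matchings E S r)
    f′ r = term ∣ S ∣ r (matchings ((a , b) ∷ E) S r)
    g r = term ∣ S′ ∣ r (matchings E S′ r)
    size : ∣ S ∣ ≡ 2 ℕ.+ ∣ S′ ∣
    size = ≡.trans (size-minus {p = S} {a} (lookup-∈ (proj₁ (∧-true {lookup S a} inS))))
      (≡.cong suc (size-minus {p = S - a} {b} (∈-minus (lookup-∈ {p = S} (proj₂ (∧-true {lookup S a} inS))) (a≢b ∘ ≡.sym))))
    smaller : ∣ S′ ∣ ℕ.< 2 ℕ.* K
    smaller = ℕₚ.≤-pred (ℕₚ.≤-pred (≡.subst₂ ℕ._<_ size (ℕₚ.*-suc 2 K) lt))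
    next : ∀ r → f′ (suc r) ≋ f (suc r) S.- g r
    next r = S.trans (S.reflexive (≡.cong (term ∣ S ∣ (suc r)) (matchings-suc (a , b) E S r inS)))
      (S.trans (term-+ ∣ S ∣ (suc r) (matchings E S (suc r)) (matchings E S′ r))
      (S.+-congˡ (S.trans (S.reflexive (≡.cong (λ s → term s (suc r) (matchings E S′ r)) size)) (term-suc ∣ S′ ∣ r (matchings E S′ r)))))

  τ-if : ∀ b p f → τ p ≋ f → τ (if b then p else []) ≋ guard b f
  τ-if true p f e = e
  τ-if false p f e = S.refl

  τ-μ-edges : ∀ S → τ (μ S) ≋ Φ (edgesOf G S) S
  τ-μ-edges S = begin
    τ (μ S)
      ≈⟨ τ-foldr (λ r → if (2 ℕ.* r) ℕ.≤ᵇ ∣ S ∣ then monomial (signed r (numMatchings G S r)) (∣ S ∣ ℕ.∸ 2 ℕ.* r) else []) (λ r → r) (suc ∣ S ∣) ⟩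
    sumTo (suc ∣ S ∣) (λ r → τ (if (2 ℕ.* r) ℕ.≤ᵇ ∣ S ∣ then monomial (signed r (numMatchings G S r)) (∣ S ∣ ℕ.∸ 2 ℕ.* r) else []))
      ≈⟨ sumTo-cong (suc ∣ S ∣) (λ r → τ-if (2 ℕ.* r ℕ.≤ᵇ ∣ S ∣) (monomial (signed r (numMatchings G S r)) (∣ S ∣ ℕ.∸ 2 ℕ.* r)) _ (τ-monomial (signed r (numMatchings G S r)) (∣ S ∣ ℕ.∸ 2 ℕ.* r))) ⟩
    sumTo (suc ∣ S ∣) (λ r → term ∣ S ∣ r (numMatchings G S r))
      ≈⟨ sumTo-cong (suc ∣ S ∣) (λ r → S.reflexive (≡.cong (term ∣ S ∣ r) (numMatchings≡ S r))) ⟩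
    sumTo (suc ∣ S ∣) (λ r → term ∣ S ∣ r (matchings (edgesOf G S) S r))
      ≈⟨ matching-sum (edgesOf G S) S (suc ∣ S ∣) (All.map proj₂ (edges-valid S)) (ℕₚ.m≤m+n (suc ∣ S ∣) _) ⟩
    Φ (edgesOf G S) S ∎

  Φ-thin : ∀ {E E′ S} → Thin S E E′ → Φ E S ≋ Φ E′ S
  Φ-thin nil = S.refl
  Φ-thin {S = S} (keep {a , b} t) with (a , b) ⊆ᵇ S
  ... | true = S.+-cong (Φ-thin t) (S.-‿cong (Φ-thin (thin-minus b (thin-minus a t))))
  ... | false = S.+-congʳ (Φ-thin t)
  Φ-thin {E} {_ ∷ E′} {S} (drop o t) rewrite o = S.trans (Φ-thin t) (S.sym (S.trans (S.+-congˡ (RingProps.-0#≈0# S.ring)) (S.+-identityʳ (Φ E′ S))))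

  listSum : {A : Set} → (A → Ser) → List A → Ser
  listSum g [] = S.0#
  listSum g (x ∷ xs) = g x S.+ listSum g xs

  listSum-cong : ∀ {A : Set} {g h : A → Ser} xs → (∀ x → g x ≋ h x) → listSum g xs ≋ listSum h xs
  listSum-cong [] e = S.refl
  listSum-cong (x ∷ xs) e = S.+-cong (e x) (listSum-cong xs e)

  listSum-minus : ∀ {A : Set} (g h : A → Ser) xs → listSum (λ x → g x S.- h x) xs ≋ listSum g xs S.- listSum h xs
  listSum-minus g h [] = S.sym (S.-‿inverseʳ S.0#)
  listSum-minus g h (x ∷ xs) = S.trans (S.+-congˡ (listSum-minus g h xs))
    (solve 4 (λ a b c d → (a :- b) :+ (c :- d) := (a :+ c) :- (b :+ d)) S.refl (g x) (h x) (listSum g xs) (listSum h xs))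

  listSum-++ : ∀ {A : Set} (g : A → Ser) xs ys → listSum g (xs ++ ys) ≋ listSum g xs S.+ listSum g ys
  listSum-++ g [] ys = S.sym (S.+-identityˡ _)
  listSum-++ g (x ∷ xs) ys = S.trans (S.+-congˡ (listSum-++ g xs ys)) (S.sym (S.+-assoc (g x) (listSum g xs) (listSum g ys)))

  listSum-tabulate : ∀ {k} {A : Set} (g : A → Ser) (f : Fin k → A) → listSum g (tabulate f) ≋ SSum.sum (g ∘ f)
  listSum-tabulate {zero} g f = S.refl
  listSum-tabulate {suc k} g f = S.+-congˡ (listSum-tabulate g (f ∘ suc))

  listSum-concatMap : ∀ {A B : Set} (g : B → Ser) (f : A → List B) xs → listSum g (concatMap f xs) ≋ listSum (λ x → listSum g (f x)) xs
  listSum-concatMap g f [] = S.refl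
  listSum-concatMap g f (x ∷ xs) = S.trans (listSum-++ g (f x) (concatMap f xs)) (S.+-congˡ (listSum-concatMap g f xs))

  listSum-filter-map : ∀ {A B : Set} (g : B → Ser) (f : A → B) c xs → listSum g (map f (boolFilter c xs)) ≋ listSum (λ x → guard (c x) (g (f x))) xs
  listSum-filter-map g f c [] = S.refl
  listSum-filter-map g f c (x ∷ xs) with c x
  ... | true = S.+-congˡ (listSum-filter-map g f c xs)
  ... | false = S.trans (listSum-filter-map g f c xs) (S.sym (S.+-identityˡ _))

  -- The share of one edge in the neighbour sum at u: the value at its other end if u is an end.
  -- Summing over edges lets the recursion be proved by induction on the list.
  incidence : Fin n → Subset n → (Fin n → Ser) → Edge → Ser
  incidence u S h (a , b) = guard (does (u ≟ a)) (guard (lookup S b) (h b)) S.+ guard (does (u ≟ b)) (guard (lookup S a) (h a))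

  incidence-minus : ∀ u S g h e → incidence u S (λ v → g v S.- h v) e ≋ incidence u S g e S.- incidence u S h e
  incidence-minus u S g h (a , b) = S.trans
    (S.+-cong (S.trans (guard-cong (does (u ≟ a)) (guard-minus (lookup S b) (g b) (h b))) (guard-minus (does (u ≟ a)) _ _))
              (S.trans (guard-cong (does (u ≟ b)) (guard-minus (lookup S a) (g a) (h a))) (guard-minus (does (u ≟ b)) _ _)))
    (solve 4 (λ a b c d → (a :- b) :+ (c :- d) := (a :+ c) :- (b :+ d)) S.refl
      (guard (does (u ≟ a)) (guard (lookup S b) (g b))) (guard (does (u ≟ a)) (guard (lookup S b) (h b)))
      (guard (does (u ≟ b)) (guard (lookup S a) (g a))) (guard (does (u ≟ b)) (guard (lookup S a) (h a))))

  incidence-cong : ∀ u S T g h → (∀ v → guard (lookup S v) (g v) ≋ guard (lookup T v) (h v)) → ∀ e → incidence u S g e ≋ incidence u T h e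
  incidence-cong u S T g h eq (a , b) = S.+-cong (guard-cong (does (u ≟ a)) (eq b)) (guard-cong (does (u ≟ b)) (eq a))

  ⊆ᵇ-minus-endpointˡ : ∀ a b S → (a , b) ⊆ᵇ (S - a) ≡ false
  ⊆ᵇ-minus-endpointˡ a b S rewrite x∉p-x S a = ≡.refl

  ⊆ᵇ-minus-endpointʳ : ∀ a b S → (a , b) ⊆ᵇ (S - b) ≡ false
  ⊆ᵇ-minus-endpointʳ a b S rewrite x∉p-x S b = Boolₚ.∧-zeroʳ (lookup (S - b) a)

  Φ-outside : ∀ e E S → e ⊆ᵇ S ≡ false → Φ (e ∷ E) S ≋ Φ E S
  Φ-outside e E S o rewrite o = S.trans (S.+-congˡ (RingProps.-0#≈0# S.ring)) (S.+-identityʳ (Φ E S))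

  minus-swap₄ : ∀ (S : Subset n) u v a b → S - u - v - a - b ≡ S - a - b - u - v
  minus-swap₄ S u v a b = ≡.trans (≡.cong (_- b) (≡.trans (p─x─y≡p─y─x (S - u) v a) (≡.cong (_- v) (p─x─y≡p─y─x S u a))))
    (≡.trans (p─x─y≡p─y─x (S - a - u) v b) (≡.cong (_- v) (p─x─y≡p─y─x (S - a) u b)))

  minus-swap₃ : ∀ (S : Subset n) u a b → S - u - a - b ≡ S - a - b - u
  minus-swap₃ S u a b = ≡.trans (≡.cong (_- b) (p─x─y≡p─y─x S u a)) (p─x─y≡p─y─x (S - a) u b)

  opaque
    -- Induction on the edge list. An edge at u adds exactly its own neighbour term, as it cannot
    -- lie in any set without u. For an edge a b away from u, the recursions for S and for S - a - b
    -- are subtracted.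
    vertex-recursion : ∀ E S u → All (λ e → proj₁ e ≢ proj₂ e) E → u ∈ S →
      Φ E S ≋ X S.* Φ E (S - u) S.- listSum (incidence u S (λ v → Φ E (S - u - v))) E
    vertex-recursion [] S u [] u∈S = S.trans (S.reflexive (≡.cong pow (size-minus u∈S)))
      (S.sym (S.trans (S.+-congˡ (RingProps.-0#≈0# S.ring)) (S.+-identityʳ _)))
    vertex-recursion ((a , b) ∷ E) S u (a≢b ∷ ne) u∈S = cases (u ≟ a) (u ≟ b)
      where
      h h′ : Fin n → Ser
      h v = Φ E (S - u - v)
      h′ v = Φ ((a , b) ∷ E) (S - u - v)
      IH : Φ E S ≋ X S.* Φ E (S - u) S.- listSum (incidence u S h) E
      IH = vertex-recursion E S u ne u∈S
      Goal : Set
      Goal = Φ ((a , b) ∷ E) S ≋ X S.* Φ ((a , b) ∷ E) (S - u) S.- (incidence u S h′ (a , b) S.+ listSum (incidence u S h′) E)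

      touching : (∀ v → (a , b) ⊆ᵇ (S - u - v) ≡ false) → (a , b) ⊆ᵇ (S - u) ≡ false →
        guard ((a , b) ⊆ᵇ S) (Φ E (S - a - b)) ≋ incidence u S h (a , b) → Goal
      touching out₂ out e = begin
        Φ E S S.- guard ((a , b) ⊆ᵇ S) (Φ E (S - a - b))
          ≈⟨ S.+-cong IH (S.-‿cong e) ⟩
        (X S.* Φ E (S - u) S.- listSum (incidence u S h) E) S.- incidence u S h (a , b)
          ≈⟨ solve 3 (λ x s i → (x :- s) :- i := x :- (i :+ s)) S.refl (X S.* Φ E (S - u)) (listSum (incidence u S h) E) (incidence u S h (a , b)) ⟩
        X S.* Φ E (S - u) S.- (incidence u S h (a , b) S.+ listSum (incidence u S h) E)
          ≈⟨ S.+-cong (S.*-congˡ (Φ-outside (a , b) E (S - u) out)) (S.-‿cong (S.+-cong (inc (a , b)) (listSum-cong E inc))) ⟨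
        X S.* Φ ((a , b) ∷ E) (S - u) S.- (incidence u S h′ (a , b) S.+ listSum (incidence u S h′) E) ∎
        where
        inc : ∀ e → incidence u S h′ e ≋ incidence u S h e
        inc = incidence-cong u S S h′ h (λ v → guard-cong (lookup S v) (Φ-outside (a , b) E (S - u - v) (out₂ v)))

      apart : u ≢ a → u ≢ b → Goal
      apart u≢a u≢b with (a , b) ⊆ᵇ S in inS
      ... | false = begin
        Φ E S S.- S.0#
          ≈⟨ S.trans (S.+-congˡ (RingProps.-0#≈0# S.ring)) (S.+-identityʳ (Φ E S)) ⟩
        Φ E S
          ≈⟨ IH ⟩
        X S.* Φ E (S - u) S.- listSum (incidence u S h) E
          ≈⟨ S.+-cong (S.*-congˡ (Φ-outside (a , b) E (S - u) out)) (S.-‿cong (S.trans (S.+-cong head (listSum-cong E inc)) (S.+-identityˡ _))) ⟨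
        X S.* Φ ((a , b) ∷ E) (S - u) S.- (incidence u S h′ (a , b) S.+ listSum (incidence u S h′) E) ∎
        where
        out : (a , b) ⊆ᵇ (S - u) ≡ false
        out = ⊈-minus (a , b) S u inS
        inc : ∀ e → incidence u S h′ e ≋ incidence u S h e
        inc = incidence-cong u S S h′ h (λ v → guard-cong (lookup S v) (Φ-outside (a , b) E (S - u - v) (⊈-minus (a , b) (S - u) v out)))
        head : incidence u S h′ (a , b) ≋ S.0#
        head rewrite dec-false (u ≟ a) u≢a | dec-false (u ≟ b) u≢b = S.+-identityˡ S.0#
      ... | true = begin
        Φ E S S.- Φ E S′
          ≈⟨ S.+-cong IH (S.-‿cong (vertex-recursion E S′ u ne (∈-minus (∈-minus u∈S u≢a) u≢b))) ⟩
        (X S.* Φ E (S - u) S.- listSum (incidence u S h) E) S.- (X S.* Φ E (S′ - u) S.- listSum (incidence u S′ k) E)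
          ≈⟨ solve 5 (λ x f s g r → (x :* f :- s) :- (x :* g :- r) := x :* (f :- g) :- (con (0 , 0) :+ (s :- r))) S.refl
               X (Φ E (S - u)) (listSum (incidence u S h) E) (Φ E (S′ - u)) (listSum (incidence u S′ k) E) ⟩
        X S.* (Φ E (S - u) S.- Φ E (S′ - u)) S.- (S.0# S.+ (listSum (incidence u S h) E S.- listSum (incidence u S′ k) E))
          ≈⟨ S.+-cong (S.*-congˡ first) (S.-‿cong (S.+-cong head rest)) ⟨
        X S.* Φ ((a , b) ∷ E) (S - u) S.- (incidence u S h′ (a , b) S.+ listSum (incidence u S h′) E) ∎
        where
        S′ : Subset n
        S′ = S - a - b
        a∈S : lookup S a ≡ true
        a∈S = proj₁ (∧-true {lookup S a} inS)
        b∈S : lookup S b ≡ true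
        b∈S = proj₂ (∧-true {lookup S a} inS)
        k j : Fin n → Ser
        k v = Φ E (S′ - u - v)
        j v = guard ((a , b) ⊆ᵇ (S - u - v)) (Φ E (S - u - v - a - b))
        first : Φ ((a , b) ∷ E) (S - u) ≋ Φ E (S - u) S.- Φ E (S′ - u)
        first rewrite lookup-minus-≢ S u≢a | lookup-minus-≢ S u≢b | a∈S | b∈S | minus-swap₃ S u a b = S.refl
        head : incidence u S h′ (a , b) ≋ S.0#
        head rewrite dec-false (u ≟ a) u≢a | dec-false (u ≟ b) u≢b = S.+-identityˡ S.0#
        -- On both sides the guard says that v lies in S and is neither a nor b: once the edge has
        -- to survive the deletion of v, once v that of a and b.
        j≋k : ∀ v → guard (lookup S v) (j v) ≋ guard (lookup S′ v) (k v)
        j≋k v rewrite lookup-minus (S - a) b v | lookup-minus S a v | lookup-minus (S - u) v a | lookup-minus (S - u) v b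
          | lookup-minus-≢ S u≢a | lookup-minus-≢ S u≢b | a∈S | b∈S | minus-swap₄ S u v a b with lookup S v | a ≟ v | b ≟ v
        ... | false | _ | _ = S.refl
        ... | true | yes ≡.refl | _ rewrite dec-true (v ≟ v) ≡.refl = S.refl
        ... | true | no a≢v | yes ≡.refl rewrite dec-true (v ≟ v) ≡.refl | Boolₚ.∧-zeroʳ (not (does (v ≟ a))) = S.refl
        ... | true | no a≢v | no b≢v rewrite dec-false (v ≟ a) (a≢v ∘ ≡.sym) | dec-false (v ≟ b) (b≢v ∘ ≡.sym) = S.refl
        rest : listSum (incidence u S h′) E ≋ listSum (incidence u S h) E S.- listSum (incidence u S′ k) E
        rest = S.trans (listSum-cong E (incidence-minus u S h j))
          (S.trans (listSum-minus (incidence u S h) (incidence u S j) E)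
          (S.+-congˡ (S.-‿cong (listSum-cong E (incidence-cong u S S′ j k j≋k)))))

      cases : Dec (u ≡ a) → Dec (u ≡ b) → Goal
      cases (yes ≡.refl) _ = touching (λ v → ⊈-minus (u , b) (S - u) v (⊆ᵇ-minus-endpointˡ u b S)) (⊆ᵇ-minus-endpointˡ u b S) here′
        where
        here′ : guard ((u , b) ⊆ᵇ S) (Φ E (S - u - b)) ≋ incidence u S h (u , b)
        here′ rewrite ∈-lookup u∈S | dec-true (u ≟ u) ≡.refl | dec-false (u ≟ b) a≢b = S.sym (S.+-identityʳ _)
      cases (no _) (yes ≡.refl) = touching (λ v → ⊈-minus (a , u) (S - u) v (⊆ᵇ-minus-endpointʳ a u S)) (⊆ᵇ-minus-endpointʳ a u S) here′
        where
        here′ : guard ((a , u) ⊆ᵇ S) (Φ E (S - a - u)) ≋ incidence u S h (a , u)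
        here′ rewrite ∈-lookup u∈S | dec-true (u ≟ u) ≡.refl | dec-false (u ≟ a) (a≢b ∘ ≡.sym) | Boolₚ.∧-identityʳ (lookup S a) | p─x─y≡p─y─x S a u = S.sym (S.+-identityˡ _)
      cases (no u≢a) (no u≢b) = apart u≢a u≢b

  <ᵇ-true : ∀ {i j} → i ℕ.< j → (i ℕ.<ᵇ j) ≡ true
  <ᵇ-true {i} {j} lt with i ℕ.<ᵇ j | ℕₚ.<⇒<ᵇ lt
  ... | true | _ = ≡.refl

  <ᵇ-false : ∀ {i j} → j ℕ.< i → (i ℕ.<ᵇ j) ≡ false
  <ᵇ-false {i} {j} gt with i ℕ.<ᵇ j in eq
  ... | false = ≡.refl
  ... | true = contradiction (ℕₚ.<ᵇ⇒< i j (≡.subst T (≡.sym eq) _)) (ℕₚ.<-asym gt)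

  -- Edges are listed with the smaller index first, so exactly one of the two orientations of an
  -- adjacent pair occurs.
  orient : ∀ S u v f → guard (condition ⊤ u v) (guard (lookup S v) f) S.+ guard (condition ⊤ v u) (guard (lookup S v) f)
    ≋ guard (lookup S v ∧ adj G u v) f
  orient S u v f rewrite lookup-replicate u true | lookup-replicate v true | adj-sym G v u with adj G u v in isAdj
  ... | false rewrite Boolₚ.∧-zeroʳ (toℕ u ℕ.<ᵇ toℕ v) | Boolₚ.∧-zeroʳ (toℕ v ℕ.<ᵇ toℕ u) | Boolₚ.∧-zeroʳ (lookup S v) = S.+-identityˡ S.0#
  ... | true rewrite Boolₚ.∧-identityʳ (toℕ u ℕ.<ᵇ toℕ v) | Boolₚ.∧-identityʳ (toℕ v ℕ.<ᵇ toℕ u) | Boolₚ.∧-identityʳ (lookup S v)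
    with ℕₚ.<-cmp (toℕ u) (toℕ v)
  ...   | tri< lt _ _ rewrite <ᵇ-true lt | <ᵇ-false lt = S.+-identityʳ _
  ...   | tri≈ _ eq _ = contradiction (Finₚ.toℕ-injective eq) (adj⇒≢ G isAdj)
  ...   | tri> _ _ gt rewrite <ᵇ-true gt | <ᵇ-false gt = S.+-identityˡ _

  incidence-neighbours : ∀ S u h → listSum (incidence u S h) (edgesOf G ⊤) ≋ neighbourSum G S u h
  incidence-neighbours S u h = begin
    listSum g (edgesOf G ⊤)
      ≈⟨ listSum-concatMap g (λ i → row ⊤ i (allFin n)) (allFin n) ⟩
    listSum (λ i → listSum g (row ⊤ i (allFin n))) (allFin n)
      ≈⟨ listSum-tabulate (λ i → listSum g (row ⊤ i (allFin n))) (λ i → i) ⟩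
    SSum.sum (λ i → listSum g (row ⊤ i (allFin n)))
      ≈⟨ SSum.sum-cong-≋ (λ i → S.trans (listSum-filter-map g (i ,_) (condition ⊤ i) (allFin n)) (listSum-tabulate (λ j → guard (condition ⊤ i j) (g (i , j))) (λ j → j))) ⟩
    SSum.sum (λ i → SSum.sum (λ j → guard (condition ⊤ i j) (g (i , j))))
      ≈⟨ SSum.sum-cong-≋ inner ⟩
    SSum.sum (λ i → guard (does (u ≟ i)) (SSum.sum (λ j → guard (condition ⊤ i j) (z j))) S.+ guard (condition ⊤ i u) (z i))
      ≈⟨ SSum.∑-distrib-+ (λ i → guard (does (u ≟ i)) (SSum.sum (λ j → guard (condition ⊤ i j) (z j)))) (λ i → guard (condition ⊤ i u) (z i)) ⟩
    SSum.sum (λ i → guard (does (u ≟ i)) (SSum.sum (λ j → guard (condition ⊤ i j) (z j)))) S.+ SSum.sum (λ i → guard (condition ⊤ i u) (z i))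
      ≈⟨ S.+-congʳ (sum-δ u (λ i → SSum.sum (λ j → guard (condition ⊤ i j) (z j)))) ⟩
    SSum.sum (λ v → guard (condition ⊤ u v) (z v)) S.+ SSum.sum (λ v → guard (condition ⊤ v u) (z v))
      ≈⟨ SSum.∑-distrib-+ (λ v → guard (condition ⊤ u v) (z v)) (λ v → guard (condition ⊤ v u) (z v)) ⟨
    SSum.sum (λ v → guard (condition ⊤ u v) (z v) S.+ guard (condition ⊤ v u) (z v))
      ≈⟨ SSum.sum-cong-≋ (λ v → orient S u v (h v)) ⟩
    neighbourSum G S u h ∎
    where
    g : Edge → Ser
    g = incidence u S h
    z : Fin n → Ser
    z v = guard (lookup S v) (h v)
    inner : ∀ i → SSum.sum (λ j → guard (condition ⊤ i j) (g (i , j))) ≋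
      guard (does (u ≟ i)) (SSum.sum (λ j → guard (condition ⊤ i j) (z j))) S.+ guard (condition ⊤ i u) (z i)
    inner i = begin
      SSum.sum (λ j → guard (condition ⊤ i j) (g (i , j)))
        ≈⟨ SSum.sum-cong-≋ (λ j → S.trans (guard-+ (condition ⊤ i j) (guard (does (u ≟ i)) (z j)) (guard (does (u ≟ j)) (z i)))
             (S.+-cong (guard-comm (condition ⊤ i j) (does (u ≟ i)) (z j)) (guard-comm (condition ⊤ i j) (does (u ≟ j)) (z i)))) ⟩
      SSum.sum (λ j → guard (does (u ≟ i)) (guard (condition ⊤ i j) (z j)) S.+ guard (does (u ≟ j)) (guard (condition ⊤ i j) (z i)))
        ≈⟨ SSum.∑-distrib-+ (λ j → guard (does (u ≟ i)) (guard (condition ⊤ i j) (z j))) (λ j → guard (does (u ≟ j)) (guard (condition ⊤ i j) (z i))) ⟩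
      SSum.sum (λ j → guard (does (u ≟ i)) (guard (condition ⊤ i j) (z j))) S.+ SSum.sum (λ j → guard (does (u ≟ j)) (guard (condition ⊤ i j) (z i)))
        ≈⟨ S.+-cong (guard-sum (does (u ≟ i)) (λ j → guard (condition ⊤ i j) (z j))) (sum-δ u (λ j → guard (condition ⊤ i j) (z i))) ⟩
      guard (does (u ≟ i)) (SSum.sum (λ j → guard (condition ⊤ i j) (z j))) S.+ guard (condition ⊤ i u) (z i) ∎

  Φ-⊥ : ∀ E → Φ E ⊥ ≋ one
  Φ-⊥ [] = S.reflexive (≡.cong pow (∣⊥∣≡0 n))
  Φ-⊥ ((a , b) ∷ E) = S.trans (Φ-outside (a , b) E ⊥ out) (Φ-⊥ E)
    where
    out : (a , b) ⊆ᵇ ⊥ ≡ false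
    out rewrite lookup-replicate a false = ≡.refl

  opaque
    -- Built on the edges of the whole graph, unlike `μ`, so that the list does not change when
    -- vertices are deleted.
    F : Subset n → Ser
    F = Φ (edgesOf G ⊤)

    τ-μ : ∀ S → τ (μ S) ≋ F S
    τ-μ S = S.trans (τ-μ-edges S) (Φ-thin (thin-edges S))

    F-⊥ : F ⊥ ≋ one
    F-⊥ = Φ-⊥ (edgesOf G ⊤)

    F-system : IsMatchingSystem G (λ _ → X) F
    F-system S u u∈S = S.trans (vertex-recursion (edgesOf G ⊤) S u (All.map proj₂ (edges-valid ⊤)) u∈S)
      (S.+-congˡ (S.-‿cong (incidence-neighbours S u (λ v → Φ (edgesOf G ⊤) (S - u - v)))))

-- Connected components of an induced subgraph

module Components {n : ℕ} (G : Graph n) where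

  reach-trans : ∀ {Q x y z} → Reach G Q x y → Reach G Q y z → Reach G Q x z
  reach-trans here r = r
  reach-trans (step e z∈ p) r = step e z∈ (reach-trans p r)

  reach-sym : ∀ {Q x y} → x ∈ Q → Reach G Q x y → Reach G Q y x
  reach-sym x∈ here = here
  reach-sym {x = x} x∈ (step {z = z} e z∈ p) = reach-trans (reach-sym z∈ p) (step (≡.trans (adj-sym G z x) e) x∈ here)

  reach-mono : ∀ {Q Q′ x y} → Q ⊆ Q′ → Reach G Q x y → Reach G Q′ x y
  reach-mono sub here = here
  reach-mono sub (step e z∈ p) = step e (sub z∈) (reach-mono sub p)

  -- Adjoin a vertex of S outside Q that is adjacent to Q, as long as there is one. Reachability
  -- from x inside Q is the invariant, and S ─ Q shrinks.
  grow : ∀ k S Q x → ∣ S ─ Q ∣ ℕ.< k → Q ⊆ S → x ∈ Q → (∀ y → y ∈ Q → Reach G Q x y) →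
    ∃ λ Q′ → IsComponent G S Q′ × x ∈ Q′
  grow zero S Q x ()
  grow (suc k) S Q x lt Q⊆S x∈Q reach with Finₚ.any? (λ y → Finₚ.any? (λ z → (y ∈? Q) ×-dec (z ∈? S) ×-dec ¬? (z ∈? Q) ×-dec (adj G y z Boolₚ.≟ true)))
  ... | no none = Q , (Q⊆S , (x , x∈Q) , (λ y z y∈ z∈ → reach-trans (reach-sym x∈Q (reach y y∈)) (reach z z∈)) , closed) , x∈Q
    where
    closed : ∀ y z → y ∈ Q → z ∈ S → adj G y z ≡ true → z ∈ Q
    closed y z y∈ z∈S e with z ∈? Q
    ... | yes z∈Q = z∈Q
    ... | no z∉Q = contradiction (y , z , y∈ , z∈S , z∉Q , e) none
  ... | yes (y , z , y∈ , z∈S , z∉Q , e) = grow k S Q′ x smaller Q′⊆S (Q⊆Q′ x∈Q) reach′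
    where
    Q′ : Subset n
    Q′ = Q ∪ ⁅ z ⁆
    Q⊆Q′ : Q ⊆ Q′
    Q⊆Q′ = p⊆p∪q ⁅ z ⁆
    z∈Q′ : z ∈ Q′
    z∈Q′ = q⊆p∪q Q ⁅ z ⁆ (x∈⁅x⁆ z)
    smaller : ∣ S ─ Q′ ∣ ℕ.< k
    smaller = ≡.subst (λ T → ∣ T ∣ ℕ.< k) (p─q─r≡p─q∪r S Q ⁅ z ⁆) (minus-shrinks (x∈p∧x∉q⇒x∈p─q z∈S z∉Q) lt)
    Q′⊆S : Q′ ⊆ S
    Q′⊆S w∈ with x∈p∪q⁻ Q ⁅ z ⁆ w∈
    ... | inj₁ w∈Q = Q⊆S w∈Q
    ... | inj₂ w∈z = ≡.subst (_∈ S) (≡.sym (x∈⁅y⁆⇒x≡y z w∈z)) z∈S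
    reach′ : ∀ w → w ∈ Q′ → Reach G Q′ x w
    reach′ w w∈ with x∈p∪q⁻ Q ⁅ z ⁆ w∈
    ... | inj₁ w∈Q = reach-mono Q⊆Q′ (reach w w∈Q)
    ... | inj₂ w∈z rewrite x∈⁅y⁆⇒x≡y z w∈z = reach-trans (reach-mono Q⊆Q′ (reach y y∈)) (step e z∈Q′ here)

  component-of : ∀ {S x} → x ∈ S → ∃ λ Q → IsComponent G S Q × x ∈ Q
  component-of {S} {x} x∈S = grow _ S ⁅ x ⁆ x ℕₚ.≤-refl
    (λ w∈ → ≡.subst (_∈ S) (≡.sym (x∈⁅y⁆⇒x≡y x w∈)) x∈S) (x∈⁅x⁆ x)
    (λ y y∈ → ≡.subst (Reach G ⁅ x ⁆ x) (≡.sym (x∈⁅y⁆⇒x≡y x y∈)) here)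

  closed-reach : ∀ {S Q Q′ x y} → Q ⊆ S → (∀ y z → y ∈ Q′ → z ∈ S → adj G y z ≡ true → z ∈ Q′) →
    x ∈ Q′ → Reach G Q x y → y ∈ Q′
  closed-reach Q⊆S closed x∈ here = x∈
  closed-reach Q⊆S closed x∈ (step e z∈ p) = closed-reach Q⊆S closed (closed _ _ x∈ (Q⊆S z∈) e) p

  components-disjoint : ∀ {S Q Q′ x} → IsComponent G S Q → IsComponent G S Q′ → x ∈ Q → x ∈ Q′ → Q ≡ Q′
  components-disjoint {x = x} (Q⊆S , _ , reach , closed) (Q′⊆S , _ , reach′ , closed′) x∈Q x∈Q′ = ⊆-antisym
    (λ {y} y∈ → closed-reach Q⊆S closed′ x∈Q′ (reach x y x∈Q y∈))
    (λ {y} y∈ → closed-reach Q′⊆S closed x∈Q (reach′ x y x∈Q′ y∈))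

-- Reduction to the components after deleting the special vertices

module Structure (ℝ : RealField) (θ : RealField.Carrier ℝ) {n : ℕ} (G : Graph n)
  (F : Subset n → Series.Ser ℝ)
  (F-⊥ : Series._≋_ ℝ (F ⊥) (Series.one ℝ))
  (rec : SeriesTools.IsMatchingSystem ℝ G (λ _ → Taylor.X ℝ θ) F)
  where
  open UniformSystem ℝ θ G F F-⊥ rec using (m; interlace₂; Separated; separated-minus; order-additive; no-essential⇒order-zero)
  open Stability ℝ θ G F F-⊥ rec
  open Components G

  module Decomposition (A : Subset n)
    (A⇒special : ∀ w → w ∈ A → Special′ ⊤ w) (special⇒A : ∀ w → Special′ ⊤ w → w ∈ A) where

    -- The invariant of deleting special vertices one at a time, with `shift` growing by one at each
    -- deletion. It compares with ⊤ throughout because A consists of the vertices special in ⊤.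
    record Shifted (T : Subset n) : Set where
      field
        shift : ℕ
        shift₀ : m T ≡ shift ℕ.+ m ⊤
        shift₁ : ∀ v → v ∈ T → m (T - v) ≡ shift ℕ.+ m (⊤ - v)
        shift₂ : ∀ u v → u ∈ T → v ∈ T → u ≢ v → NonEssential ⊤ u → m (T - u - v) ≡ shift ℕ.+ m (⊤ - u - v)

    module _ {T : Subset n} (sh : Shifted T) where
      open Shifted sh

      shift-nonEssential : ∀ {u} → u ∈ T → NonEssential ⊤ u → NonEssential T u
      shift-nonEssential {u} u∈T ne = ≡.subst₂ ℕ._≤_ (≡.sym shift₀) (≡.sym (shift₁ u u∈T)) (ℕₚ.+-monoʳ-≤ shift ne)

      -- All the orders compared have moved by the same amount, so a member of A still present in T
      -- is special there with its old witness.
      shift-special : ∀ {a} → a ∈ T → a ∈ A → (∀ w → Essential′ ⊤ w → w ∈ T) → Special′ T a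
      shift-special {a} a∈T a∈A ess∈T = record
        { inside = a∈T
        ; nonEssential = shift-nonEssential a∈T nonEssential
        ; adjacent = adjacent
        ; witness∈ = ess∈T witness essential
        ; essential = ≡.trans (≡.cong suc (shift₁ witness (ess∈T witness essential)))
            (≡.trans (≡.sym (ℕₚ.+-suc shift (m (⊤ - witness)))) (≡.trans (≡.cong (shift ℕ.+_) essential) (≡.sym shift₀)))
        }
        where open Special′ (A⇒special a a∈A)

      shift-step : ∀ {a} → Special′ T a → Shifted (T - a)
      shift-step {a} sp = record
        { shift = suc shift
        ; shift₀ = ≡.trans (special-positive sp) (≡.cong suc shift₀)
        ; shift₁ = λ v v∈ → ≡.trans (stability sp (proj₁ (∈-minus⁻ v∈)) (proj₂ (∈-minus⁻ v∈))) (≡.cong suc (shift₁ v (proj₁ (∈-minus⁻ v∈))))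
        ; shift₂ = λ u v u∈ v∈ u≢v ne → ≡.trans
            (stability₂ sp (proj₁ (∈-minus⁻ u∈)) (proj₁ (∈-minus⁻ v∈)) (proj₂ (∈-minus⁻ u∈)) (proj₂ (∈-minus⁻ v∈)) u≢v (shift-nonEssential (proj₁ (∈-minus⁻ u∈)) ne))
            (≡.cong suc (shift₂ u v (proj₁ (∈-minus⁻ u∈)) (proj₁ (∈-minus⁻ v∈)) u≢v ne))
        }

    remove-special : ∀ k A′ → ∣ A′ ∣ ℕ.< k → A′ ⊆ A → Shifted (⊤ ─ A′)
    remove-special zero A′ ()
    remove-special (suc k) A′ lt A′⊆A with nonempty? A′
    ... | no empty rewrite Empty-unique empty | p─⊥≡p (⊤ {n}) = record
      { shift = 0
      ; shift₀ = ≡.refl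
      ; shift₁ = λ _ _ → ≡.refl
      ; shift₂ = λ _ _ _ _ _ _ → ≡.refl
      }
    -- The other members of A′ go first, so a is still present. Essential vertices survive, as every
    -- member of A is non-essential.
    ... | yes (a , a∈A′) = ≡.subst Shifted (─-restore a∈A′) (shift-step previous
        (shift-special previous (x∈p∧x∉q⇒x∈p─q ∈⊤ (λ a∈ → proj₂ (∈-minus⁻ a∈) ≡.refl)) (A′⊆A a∈A′)
          (λ w e → x∈p∧x∉q⇒x∈p─q ∈⊤ (λ w∈ → ess-≢-noness (Special′.nonEssential (A⇒special w (A′⊆A (proj₁ (∈-minus⁻ w∈))))) e ≡.refl))))
      where
      previous : Shifted (⊤ ─ (A′ - a))
      previous = remove-special k (A′ - a) (minus-shrinks a∈A′ lt) (λ w∈ → A′⊆A (proj₁ (∈-minus⁻ w∈)))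

    H : Subset n
    H = ⊤ ─ A

    opaque
      shifted : Shifted H
      shifted = remove-special _ A ℕₚ.≤-refl (λ x → x)
    open Shifted shifted

    module Component {Q : Subset n} (comp : IsComponent G H Q) where
      R : Subset n
      R = H ─ Q

      Q⊆H : Q ⊆ H
      Q⊆H = proj₁ comp

      separated : Separated Q H
      separated x y _ y∈H x∈Q e = proj₂ (proj₂ (proj₂ comp)) x y x∈Q y∈H e

      m-H : m H ≡ m Q ℕ.+ m R
      m-H = ≡.trans (order-additive separated) (≡.cong (λ p → m p ℕ.+ m R) (∩-subset Q⊆H))

      ∩-minus : ∀ u → (H - u) ∩ Q ≡ Q - u
      ∩-minus u = ≡.trans (minus-∩ H Q u) (≡.cong (_- u) (∩-subset Q⊆H))

      m-H-inside : ∀ {u} → u ∈ Q → m (H - u) ≡ m (Q - u) ℕ.+ m R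
      m-H-inside {u} u∈Q = ≡.trans (order-additive (separated-minus u separated))
        (≡.cong₂ (λ p q → m p ℕ.+ m q) (∩-minus u) (minus-─ H Q u∈Q))

      m-H-outside : ∀ {v} → v ∉ Q → m (H - v) ≡ m Q ℕ.+ m (R - v)
      m-H-outside {v} v∉Q = ≡.trans (order-additive (separated-minus v separated))
        (≡.cong₂ (λ p q → m p ℕ.+ m q) (≡.trans (∩-minus v) (minus-absent v∉Q)) (p─q─r≡p─r─q H ⁅ v ⁆ Q))

      m-H-inside₂ : ∀ {u v} → u ∈ Q → v ∈ Q → m (H - u - v) ≡ m (Q - u - v) ℕ.+ m R
      m-H-inside₂ {u} {v} u∈Q v∈Q = ≡.trans (order-additive (separated-minus v (separated-minus u separated)))
        (≡.cong₂ (λ p q → m p ℕ.+ m q) (≡.trans (minus-∩ (H - u) Q v) (≡.cong (_- v) (∩-minus u)))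
          (≡.trans (minus-─ (H - u) Q v∈Q) (minus-─ H Q u∈Q)))

      m-H-across : ∀ {u v} → u ∈ Q → v ∉ Q → m (H - u - v) ≡ m (Q - u) ℕ.+ m (R - v)
      m-H-across {u} {v} u∈Q v∉Q = ≡.trans (order-additive (separated-minus v (separated-minus u separated)))
        (≡.cong₂ (λ p q → m p ℕ.+ m q)
          (≡.trans (minus-∩ (H - u) Q v) (≡.trans (≡.cong (_- v) (∩-minus u)) (minus-absent (v∉Q ∘ proj₁ ∘ ∈-minus⁻))))
          (≡.trans (p─q─r≡p─r─q (H - u) ⁅ v ⁆ Q) (≡.cong (_- v) (minus-─ H Q u∈Q))))

      -- A non-essential vertex next to an essential one would be special, hence deleted with A. So
      -- along edges inside H non-essentiality spreads.
      nonEssential-reach : ∀ {x y} → x ∈ Q → NonEssential ⊤ x → Reach G Q x y → NonEssential ⊤ y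
      nonEssential-reach x∈Q ne here = ne
      nonEssential-reach {x} x∈Q ne (step {z = z} e z∈Q p) with essential-or-not {⊤} {z} ∈⊤
      ... | inj₂ ne′ = nonEssential-reach z∈Q ne′ p
      ... | inj₁ ess = contradiction (special⇒A x record
              { inside = ∈⊤ ; nonEssential = ne ; adjacent = e ; witness∈ = ∈⊤ ; essential = ess })
            (∈─⁻ (Q⊆H x∈Q))

      -- Connectedness makes all of Q non-essential in ⊤, the shift carries this to H, and
      -- cancelling the order of the other components carries it to Q itself.
      nonEssential-order-zero : ∀ {u} → u ∈ Q → NonEssential ⊤ u → m Q ≡ 0
      nonEssential-order-zero {u} u∈Q ne = no-essential⇒order-zero Q λ x x∈Q →
        ℕₚ.+-cancelʳ-≤ (m R) (m Q) (m (Q - x)) (≡.subst₂ ℕ._≤_ m-H (m-H-inside x∈Q)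
          (shift-nonEssential shifted (Q⊆H x∈Q) (nonEssential-reach u∈Q ne (proj₁ (proj₂ (proj₂ comp)) u x u∈Q x∈Q))))

    -- By stability the order at ⊤ - u - v exceeds m (⊤ - v) by one, hence also exceeds m ⊤. This
    -- keeps the ends of an edge between non-essential vertices out of A.
    special-pair : ∀ {u v} → Special′ ⊤ u → v ≢ u → NonEssential ⊤ v → ¬ (m (⊤ - u - v) ℕ.≤ m ⊤)
    special-pair {u} {v} sp v≢u ne le = ℕₚ.<-irrefl ≡.refl
      (ℕₚ.≤-trans (s≤s ne) (≡.subst (ℕ._≤ m ⊤) (stability sp ∈⊤ v≢u) le))

    Conclusion : Fin n → Fin n → Set
    Conclusion u v =
      (Essential′ ⊤ u ⊎ Essential′ ⊤ v)
      ⊎ ((m (⊤ - u) ≡ m ⊤ × m (⊤ - v) ≡ m ⊤)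
         × ∃ λ Q₁ → ∃ λ Q₂ → IsComponent G H Q₁ × m Q₁ ≡ 0 × IsComponent G H Q₂ × m Q₂ ≡ 0
           × ¬ (Q₁ ≡ Q₂) × u ∈ Q₁ × v ∈ Q₂)
      ⊎ (∃ λ Q → IsComponent G H Q × m Q ≡ 0 × u ∈ Q × v ∈ Q × m (Q - u - v) ≡ m Q)

    module _ {u v : Fin n} (u≢v : u ≢ v) where

      module Forward (nu : NonEssential ⊤ u) (nv : NonEssential ⊤ v) (le : m (⊤ - u - v) ℕ.≤ m ⊤) where
        u∈H : u ∈ H
        u∈H = x∈p∧x∉q⇒x∈p─q ∈⊤ λ u∈A → special-pair (A⇒special u u∈A) (u≢v ∘ ≡.sym) nv le
        v∈H : v ∈ H
        v∈H = x∈p∧x∉q⇒x∈p─q ∈⊤ λ v∈A → special-pair (A⇒special v v∈A) u≢v nu (≡.subst (ℕ._≤ m ⊤) (m-swap ⊤ u v) le)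

        le-H : m (H - u - v) ℕ.≤ m H
        le-H = ≡.subst₂ ℕ._≤_ (≡.sym (shift₂ u v u∈H v∈H u≢v nu)) (≡.sym shift₀) (ℕₚ.+-monoʳ-≤ shift le)

        neutral : ∀ {x} → x ∈ H → m (H - x) ≡ m H → m (⊤ - x) ≡ m ⊤
        neutral {x} x∈H e = ℕₚ.+-cancelˡ-≡ shift (m (⊤ - x)) (m ⊤) (≡.trans (≡.sym (shift₁ x x∈H)) (≡.trans e shift₀))

        conclusion : Conclusion u v
        conclusion with component-of u∈H
        ... | Q , comp , u∈Q with v ∈? Q
        -- As m Q is zero, the inequality inherited from H is the equality that (c) demands.
        ...   | yes v∈Q = inj₂ (inj₂ (Q , comp , zero-Q , u∈Q , v∈Q , ≡.trans (ℕₚ.n≤0⇒n≡0 (≡.subst (m (Q - u - v) ℕ.≤_) zero-Q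
                  (ℕₚ.+-cancelʳ-≤ (m R) _ _ (≡.subst₂ ℕ._≤_ (m-H-inside₂ u∈Q v∈Q) m-H le-H)))) (≡.sym zero-Q)))
          where
          open Component comp
          zero-Q : m Q ≡ 0
          zero-Q = nonEssential-order-zero u∈Q nu
        ...   | no v∉Q with component-of v∈H
        ...     | Q₂ , comp₂ , v∈Q₂ = inj₂ (inj₁ ((neutral u∈H u-neutral , neutral v∈H v-neutral) ,
            Q , Q₂ , comp , nonEssential-order-zero u∈Q nu , comp₂ , Component.nonEssential-order-zero comp₂ v∈Q₂ nv ,
            (λ { ≡.refl → v∉Q v∈Q₂ }) , u∈Q , v∈Q₂))
          where
          open Component comp
          Q≤ : m Q ℕ.≤ m (Q - u)
          Q≤ = ℕₚ.+-cancelʳ-≤ (m R) _ _ (≡.subst₂ ℕ._≤_ m-H (m-H-inside u∈Q) (shift-nonEssential shifted u∈H nu))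
          R≤ : m R ℕ.≤ m (R - v)
          R≤ = ℕₚ.+-cancelˡ-≤ (m Q) _ _ (≡.subst₂ ℕ._≤_ m-H (m-H-outside v∉Q) (shift-nonEssential shifted v∈H nv))
          -- Neither summand falls below its counterpart on the right, so the bound on the sum
          -- forces both to be equal: u and v are neutral.
          total : m (Q - u) ℕ.+ m (R - v) ℕ.≤ m Q ℕ.+ m R
          total = ≡.subst₂ ℕ._≤_ (m-H-across u∈Q v∉Q) m-H le-H
          Q≡ : m (Q - u) ≡ m Q
          Q≡ = ℕₚ.≤-antisym (ℕₚ.+-cancelʳ-≤ (m R) _ _ (ℕₚ.≤-trans (ℕₚ.+-monoʳ-≤ (m (Q - u)) R≤) total)) Q≤
          R≡ : m (R - v) ≡ m R
          R≡ = ℕₚ.≤-antisym (ℕₚ.+-cancelˡ-≤ (m Q) _ _ (ℕₚ.≤-trans (ℕₚ.+-monoˡ-≤ (m (R - v)) Q≤) total)) R≤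
          u-neutral : m (H - u) ≡ m H
          u-neutral = ≡.trans (m-H-inside u∈Q) (≡.trans (≡.cong (ℕ._+ m R) Q≡) (≡.sym m-H))
          v-neutral : m (H - v) ≡ m H
          v-neutral = ≡.trans (m-H-outside v∉Q) (≡.trans (≡.cong (m Q ℕ.+_) R≡) (≡.sym m-H))

      forward : m (⊤ - u - v) ℕ.≤ m ⊤ → Conclusion u v
      forward le with essential-or-not {⊤} {u} ∈⊤ | essential-or-not {⊤} {v} ∈⊤
      ... | inj₁ eu | _ = inj₁ (inj₁ eu)
      ... | inj₂ nu | inj₁ ev = inj₁ (inj₂ ev)
      ... | inj₂ nu | inj₂ nv = Forward.conclusion nu nv le

      -- Deleting x lowers the order by one, and deleting y afterwards raises it by at most one.
      essential-pair : ∀ {x y} → x ≢ y → Essential′ ⊤ x → m (⊤ - x - y) ℕ.≤ m ⊤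
      essential-pair {x} {y} x≢y e = ≡.subst (m (⊤ - x - y) ℕ.≤_) e (interlace₂ (∈-minus ∈⊤ (x≢y ∘ ≡.sym)))

      descend : u ∈ H → v ∈ H → NonEssential ⊤ u → m (H - u - v) ≡ m H → m (⊤ - u - v) ℕ.≤ m ⊤
      descend u∈H v∈H nu e = ℕₚ.≤-reflexive (ℕₚ.+-cancelˡ-≡ shift _ _ (≡.trans (≡.sym (shift₂ u v u∈H v∈H u≢v nu)) (≡.trans e shift₀)))

      backward : Conclusion u v → m (⊤ - u - v) ℕ.≤ m ⊤
      backward (inj₁ (inj₁ eu)) = essential-pair u≢v eu
      backward (inj₁ (inj₂ ev)) = ≡.subst (ℕ._≤ m ⊤) (m-swap ⊤ v u) (essential-pair (u≢v ∘ ≡.sym) ev)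
      backward (inj₂ (inj₁ ((eu , ev) , Q₁ , Q₂ , comp , _ , comp₂ , _ , Q₁≢Q₂ , u∈Q₁ , v∈Q₂))) =
        descend (Q⊆H u∈Q₁) v∈H (ℕₚ.≤-reflexive (≡.sym eu)) (≡.trans (m-H-across u∈Q₁ v∉Q₁) (≡.trans (≡.cong₂ ℕ._+_ Q≡ R≡) (≡.sym m-H)))
        where
        open Component comp
        v∈H : v ∈ H
        v∈H = proj₁ comp₂ v∈Q₂
        v∉Q₁ : v ∉ Q₁
        v∉Q₁ v∈Q₁ = Q₁≢Q₂ (components-disjoint comp comp₂ v∈Q₁ v∈Q₂)
        lift : ∀ {x} → x ∈ H → m (⊤ - x) ≡ m ⊤ → m (H - x) ≡ m H
        lift {x} x∈H e = ≡.trans (shift₁ x x∈H) (≡.trans (≡.cong (shift ℕ.+_) e) (≡.sym shift₀))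
        Q≡ : m (Q₁ - u) ≡ m Q₁
        Q≡ = ℕₚ.+-cancelʳ-≡ (m R) _ _ (≡.trans (≡.sym (m-H-inside u∈Q₁)) (≡.trans (lift (Q⊆H u∈Q₁) eu) m-H))
        R≡ : m (R - v) ≡ m R
        R≡ = ℕₚ.+-cancelˡ-≡ (m Q₁) _ _ (≡.trans (≡.sym (m-H-outside v∉Q₁)) (≡.trans (lift v∈H ev) m-H))
      -- Case (c) does not state that u is non-essential, which `shift₂` asks for; an essential u is
      -- settled by `essential-pair`.
      backward (inj₂ (inj₂ (Q , comp , _ , u∈Q , v∈Q , e))) with essential-or-not {⊤} {u} ∈⊤
      ... | inj₁ eu = essential-pair u≢v eu
      ... | inj₂ nu = descend (Q⊆H u∈Q) (Q⊆H v∈Q) nu (≡.trans (m-H-inside₂ u∈Q v∈Q) (≡.trans (≡.cong (ℕ._+ m R) e) (≡.sym m-H)))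
        where open Component comp

-- From multiplicities to orders

module Translation (ℝ : RealField) (θ : RealField.Carrier ℝ) {n : ℕ} (G : Graph n) where
  open MatchingPolynomial ℝ θ G using (F; τ-μ; F-⊥; F-system)
  open TaylorShift ℝ θ using (mult⇒ord; ord⇒mult)
  open Match G ℝ
  open Series ℝ using (ord-resp; module S)

  open UniformSystem ℝ θ G F F-⊥ F-system using (m; m-unique; ord-m)
  open Stability ℝ θ G F F-⊥ F-system using (Essential′; NonEssential; Special′; essential-or-not; ess-≢-noness)

  mult⇒m : ∀ {S k} → Mult θ S k → m S ≡ k
  mult⇒m {S} mu = m-unique (ord-resp (τ-μ S) (mult⇒ord {μ S} mu))

  m⇒mult : ∀ S {k} → m S ≡ k → Mult θ S k
  m⇒mult S ≡.refl = ord⇒mult (m S) (μ S) (ord-resp (S.sym (τ-μ S)) (ord-m S))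

  -- The definitions quantify over all multiplicities. Uniqueness gives one direction; the other
  -- takes existence, without which the quantified statement could hold vacuously.
  relate : ∀ S T (_~_ : ℕ → ℕ → Set) → (∀ k k′ → Mult θ S k → Mult θ T k′ → k′ ~ k) ⇔ (m T ~ m S)
  relate S T _~_ = mk⇔ (λ r → r _ _ (m⇒mult S ≡.refl) (m⇒mult T ≡.refl))
    (λ r k k′ mS mT → ≡.subst₂ _~_ (mult⇒m mT) (mult⇒m mS) r)

  essential⇔ : ∀ u → Essential θ ⊤ u ⇔ Essential′ ⊤ u
  essential⇔ u = mk⇔ (λ e → to (proj₂ e)) (λ e → ∈⊤ , from e)
    where open Equivalence (relate ⊤ (⊤ - u) (λ k′ k → suc k′ ≡ k))

  neutral⇔ : ∀ u → Neutral θ ⊤ u ⇔ (m (⊤ - u) ≡ m ⊤)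
  neutral⇔ u = mk⇔ (λ e → to (proj₂ e)) (λ e → ∈⊤ , from e)
    where open Equivalence (relate ⊤ (⊤ - u) _≡_)

  special⇔ : ∀ u → Special θ ⊤ u ⇔ Special′ ⊤ u
  special⇔ u = mk⇔ forth back
    where
    forth : Special θ ⊤ u → Special′ ⊤ u
    forth (_ , ne , w , e , ess) with essential-or-not {⊤} {u} ∈⊤
    ... | inj₁ eu = contradiction (Equivalence.from (essential⇔ u) eu) ne
    ... | inj₂ nu = record { inside = ∈⊤ ; nonEssential = nu ; adjacent = e ; witness∈ = ∈⊤ ; essential = Equivalence.to (essential⇔ w) ess }
    back : Special′ ⊤ u → Special θ ⊤ u
    back sp = ∈⊤ , (λ e → ess-≢-noness nonEssential (Equivalence.to (essential⇔ u) e) ≡.refl) ,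
      witness , adjacent , Equivalence.from (essential⇔ witness) essential
      where open Special′ sp

  pair⇔ : ∀ S u v (_~_ : ℕ → ℕ → Set) →
    (∀ k k′ → Mult θ S k → Mult θ (S ─ (⁅ u ⁆ ∪ ⁅ v ⁆)) k′ → k′ ~ k) ⇔ (m (S - u - v) ~ m S)
  pair⇔ S u v _~_ rewrite ≡.sym (p─q─r≡p─q∪r S ⁅ u ⁆ ⁅ v ⁆) = relate S (S - u - v) _~_

theorem5p18 : (ℝ : RealField) (θ : RealField.Carrier ℝ) (n : ℕ) (G : Graph n)
    (A : Subset n) → (∀ w → (w ∈ A) ⇔ Match.Special G ℝ θ ⊤ w) →
    (u v : Fin n) → ¬ (u ≡ v) →
    Match.DEdge G ℝ θ ⊤ u v ⇔
    ((Match.Essential G ℝ θ ⊤ u ⊎ Match.Essential G ℝ θ ⊤ v)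
    ⊎ ((Match.Neutral G ℝ θ ⊤ u × Match.Neutral G ℝ θ ⊤ v)
    × ∃ λ Q₁ → ∃ λ Q₂ → IsComponent G (⊤ ─ A) Q₁ × Match.Mult G ℝ θ Q₁ 0
    × IsComponent G (⊤ ─ A) Q₂ × Match.Mult G ℝ θ Q₂ 0
    × ¬ (Q₁ ≡ Q₂) × u ∈ Q₁ × v ∈ Q₂)
    ⊎ (∃ λ Q → IsComponent G (⊤ ─ A) Q × Match.Mult G ℝ θ Q 0
    × Match.D0Edge G ℝ θ Q u v))
theorem5p18 ℝ θ n G A A⇔special u v u≢v = mk⇔
  (λ (_ , _ , _ , d) → from translate (forward u≢v (to (pair⇔ ⊤ u v ℕ._≤_) d)))
  (λ c → ∈⊤ , ∈⊤ , u≢v , from (pair⇔ ⊤ u v ℕ._≤_) (backward u≢v (to translate c)))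
  where
  open Equivalence using (to; from)
  open Translation ℝ θ G
  open MatchingPolynomial ℝ θ G using (F; F-⊥; F-system)
  open Structure.Decomposition ℝ θ G F F-⊥ F-system A
    (λ w w∈A → to (special⇔ w) (to (A⇔special w) w∈A)) (λ w sp → from (A⇔special w) (from (special⇔ w) sp))
  translate : ((Match.Essential G ℝ θ ⊤ u ⊎ Match.Essential G ℝ θ ⊤ v)
    ⊎ ((Match.Neutral G ℝ θ ⊤ u × Match.Neutral G ℝ θ ⊤ v)
    × ∃ λ Q₁ → ∃ λ Q₂ → IsComponent G (⊤ ─ A) Q₁ × Match.Mult G ℝ θ Q₁ 0
    × IsComponent G (⊤ ─ A) Q₂ × Match.Mult G ℝ θ Q₂ 0
    × ¬ (Q₁ ≡ Q₂) × u ∈ Q₁ × v ∈ Q₂)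
    ⊎ (∃ λ Q → IsComponent G (⊤ ─ A) Q × Match.Mult G ℝ θ Q 0
    × Match.D0Edge G ℝ θ Q u v)) ⇔ Conclusion u v
  translate = (essential⇔ u ⊎-⇔ essential⇔ v) ⊎-⇔ (((neutral⇔ u ×-⇔ neutral⇔ v) ×-⇔ mk⇔
      (λ (Q₁ , Q₂ , c₁ , z₁ , c₂ , z₂ , r) → Q₁ , Q₂ , c₁ , mult⇒m z₁ , c₂ , mult⇒m z₂ , r)
      (λ (Q₁ , Q₂ , c₁ , z₁ , c₂ , z₂ , r) → Q₁ , Q₂ , c₁ , m⇒mult Q₁ z₁ , c₂ , m⇒mult Q₂ z₂ , r))
    ⊎-⇔ mk⇔
      (λ (Q , c , z , u∈ , v∈ , _ , e) → Q , c , mult⇒m z , u∈ , v∈ , to (pair⇔ Q u v _≡_) e)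
      (λ (Q , c , z , u∈ , v∈ , e) → Q , c , m⇒mult Q z , u∈ , v∈ , u≢v , from (pair⇔ Q u v _≡_) e))
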